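{- Let $n,m$ be integers with $4 \le m \le n$ and let $G = P_n \Box P_m$. Write $[1,r]$ for the set of integers $s$ with $1\le s\le r$. Then: (i) if $m=4$, then $S_{SC}(G) = [1,nm-4]\setminus\{2,3,5\}$; (ii) if $m=5$, then $S_{SC}(G) = [1,nm-5]\setminus\{2,3,5\}$; (iii) if $m\ge 6$, then $S_{SC}(G) = [1,nm-6]\setminus\{2,3,5\}$.
   Context: $P_n$ denotes the path on $n$ vertices and $G\Box H$ the cartesian product of graphs. An orientation $D$ of a graph is strong if for every ordered pair of vertices $u,v$ there is a directed path from $u$ to $v$. A $uv$-geodesic in $D$ is a shortest directed path from $u$ to $v$. A nonempty set $S\subseteq V(D)$ is convex in $D$ if for every $u,v\in S$, every vertex lying on a $uv$-geodesic or on a $vu$-geodesic belongs to $S$. The convexity number $\mathrm{con}(D)$ is the maximum cardinality of a convex set of $D$ different from $V(D)$. The strong convexity spectrum of a graph $G$ is $S_{SC}(G)=\{\mathrm{con}(D) : D \text{ is a strong orientation of } G\}$. -}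

module Defs where

open import Data.Fin.Base using (Fin; toℕ; remQuot)
open import Data.Fin.Properties using () renaming (_≟_ to _≟ᶠ_)
open import Data.Fin.Subset using (Subset; ⊤; ∣_∣; Nonempty) renaming (_∈_ to _∈ˢ_)
open import Data.List.Base using (List; []; _∷_)
open import Data.List.Membership.Propositional using () renaming (_∈_ to _∈ˡ_)
open import Data.List.Relation.Unary.Unique.Propositional using (Unique)
open import Data.Nat.Base using (ℕ; zero; suc; _*_; _≤_)
open import Data.Nat.Properties using (_≟_; 1+n≢n)
open import Data.Product.Base using (Σ-syntax; ∃-syntax; _×_; _,_; proj₁; proj₂)
open import Data.Sum.Base using (_⊎_; inj₁; inj₂; [_,_]; swap)
import Data.Sum.Base as Sum
import Data.Product.Base as Product
open import Level using (0ℓ)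
open import Relation.Binary.Construct.Closure.ReflexiveTransitive using (Star; ε; _◅_)
open import Relation.Binary.Core using (Rel)
open import Relation.Binary.Definitions using (Asymmetric; Decidable; Irreflexive; Symmetric)
open import Relation.Binary.PropositionalEquality.Core using (_≡_; _≢_; refl; sym)
open import Relation.Nullary.Decidable.Core using (_⊎-dec_; _×-dec_)
open import Relation.Unary using (Pred)

record Graph (n : ℕ) : Set₁ where
  field
    Adj         : Rel (Fin n) 0ℓ
    adj-sym     : Symmetric Adj
    adj-irrefl  : Irreflexive _≡_ Adj
    adj?        : Decidable Adj

P : ∀ n → Graph n
P n = record
  { Adj        = λ i j → suc (toℕ i) ≡ toℕ j ⊎ suc (toℕ j) ≡ toℕ i
  ; adj-sym    = swap
  ; adj-irrefl = λ { refl → [ 1+n≢n , 1+n≢n ] }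
  ; adj?       = λ i j → (suc (toℕ i) ≟ toℕ j) ⊎-dec (suc (toℕ j) ≟ toℕ i)
  }

infixl 7 _□_

-- A vertex of G □ H is a pair of vertices, coded in Fin (n * m) through the
-- bijection remQuot m : Fin (n * m) → Fin n × Fin m.
_□_ : ∀ {n m} → Graph n → Graph m → Graph (n * m)
_□_ {n} {m} G H = record
  { Adj        = λ x y → AdjPair (remQuot {n} m x) (remQuot {n} m y)
  ; adj-sym    = Sum.map (Product.map sym H.adj-sym) (Product.map G.adj-sym sym)
  ; adj-irrefl = λ { refl → [ (λ e → H.adj-irrefl refl (proj₂ e))
                            , (λ e → G.adj-irrefl refl (proj₁ e)) ] }
  ; adj?       = λ x y → adjPair? (remQuot {n} m x) (remQuot {n} m y)
  }
  where
  module G = Graph G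
  module H = Graph H

  AdjPair : Rel (Fin n × Fin m) 0ℓ
  AdjPair (g , h) (g′ , h′) = (g ≡ g′ × H.Adj h h′) ⊎ (G.Adj g g′ × h ≡ h′)

  adjPair? : Decidable AdjPair
  adjPair? (g , h) (g′ , h′) =
    ((g ≟ᶠ g′) ×-dec H.adj? h h′) ⊎-dec (G.adj? g g′ ×-dec (h ≟ᶠ h′))

record Orientation {n} (G : Graph n) : Set₁ where
  open Graph G
  field
    Arc      : Rel (Fin n) 0ℓ
    arc⇒adj  : ∀ {u v} → Arc u v → Adj u v
    adj⇒arc  : ∀ {u v} → Adj u v → Arc u v ⊎ Arc v u
    arc-asym : Asymmetric Arc

module _ {n} {G : Graph n} (D : Orientation G) where
  open Orientation D

  Walk : Rel (Fin n) 0ℓ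
  Walk = Star Arc

  vertices : ∀ {u v} → Walk u v → List (Fin n)
  vertices {u} ε       = u ∷ []
  vertices {u} (_ ◅ p) = u ∷ vertices p

  length : ∀ {u v} → Walk u v → ℕ
  length ε       = zero
  length (_ ◅ p) = suc (length p)

  IsPath : ∀ {u v} → Walk u v → Set
  IsPath p = Unique (vertices p)

  Strong : Set
  Strong = ∀ u v → Σ[ p ∈ Walk u v ] IsPath p

  IsGeodesic : ∀ {u v} → Walk u v → Set
  IsGeodesic {u} {v} p =
    IsPath p × ((q : Walk u v) → IsPath q → length p ≤ length q)

  OnGeodesic : Fin n → Fin n → Fin n → Set
  OnGeodesic u v w = Σ[ p ∈ Walk u v ] (IsGeodesic p × w ∈ˡ vertices p)

  Convex : Subset n → Set
  Convex S = Nonempty S ×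
    (∀ {u v w} → u ∈ˢ S → v ∈ˢ S → OnGeodesic u v w ⊎ OnGeodesic v u w → w ∈ˢ S)

  ProperConvex : Subset n → Set
  ProperConvex S = Convex S × S ≢ ⊤

  -- con(D) = k, as a relation: a maximum exists only if D has a proper convex set.
  IsConvexityNumber : ℕ → Set
  IsConvexityNumber k =
    (∃[ S ] (ProperConvex S × ∣ S ∣ ≡ k)) × (∀ S → ProperConvex S → ∣ S ∣ ≤ k)

StrongConvexitySpectrum : ∀ {n} → Graph n → Pred ℕ _
StrongConvexitySpectrum G s =
  Σ[ D ∈ Orientation G ] (Strong D × IsConvexityNumber D s)

[1,_] : ℕ → Pred ℕ 0ℓ
[1, r ] s = 1 ≤ s × s ≤ r

{-# OPTIONS --safe #-}
-- Realization: a walk that leaves S returns to it so late that it is not a shortest one, so S is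
-- convex, while the vertices on shortest walks between the ends of an arc not inside S, and on
-- those between the vertices so obtained, fill the whole grid.  The set below a staircase with the
-- heights m, …, m, j, 2, …, 2, 0 gives the large sizes, two regions whose faces are directed cycles
-- of opposite phase give the small ones, and a notch next to a corner gives those above (n - 1) m.
-- The sizes 7, 8, 9 for n = m = 4 come from three orientations with tabulated distances.
--
-- Bound: let the complement C of a convex set S have fewer than min(6, m) vertices, and take a
-- directed path from S through k vertices of C back to S with k minimal.  A monotone path is a
-- geodesic, so the path turns back.  What remains is a finite search in a window around its start,
-- which branches on the walls of the grid, on membership in S and on the orientation of edges;
-- a branch ends when a geodesic leaves S, when C gets too large, when a vertex of S or a part of C
-- has no way in or out, or when a shorter path appears.  For k ≥ 4 the neighbours of the second and
-- third vertex of the path lie in C by minimality, so all k are covered by four search trees,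
-- which are checked by evaluation.
--
-- A convex set with two vertices contains a directed cycle, hence at least four vertices, and a
-- fifth one would give two vertices with three common neighbours.
module Submission where

open import Defs
open import Data.Nat.Base using (ℕ; _*_; _∸_; _≤_)
open import Data.Product.Base using (_×_)
open import Relation.Binary.PropositionalEquality.Core using (_≡_)
open import Relation.Unary using (_≐_; _∖_; _∪_; ｛_｝)

-- The numbers 4, 5 and 6 come from the two smallest complements that work. One is a whole border
-- column. The other is a 2 × 3 block in a corner, whose vertices form a folded path, since a
-- monotone way through the complement would be a geodesic. In both cases a single arc leads back
-- into S, so a potential on the complement bounds every excursion from below. A value of con(D)
-- also requires that no other proper convex set is larger. A convex set with a vertex outside S and
-- a second vertex turns out to be the whole grid or, in a few cases, no larger than S. The argument
-- uses only closure under geodesics and connectivity inside the set. Strong components have both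
-- properties, so the same argument proves D strong. Apart from the tables for the 4 × 4 grid, no
-- exact directed distances are needed: monotone walks attain the distance in the grid, and walks
-- with at most four steps are compared through the bipartition. In the bound n and m are arbitrary,
-- so the search keeps only local facts, with positions relative to the start of the path.

module Core where

  open import Data.Fin.Base using (Fin; toℕ; fromℕ<; combine; remQuot; zero; suc)
  open import Data.Fin.Properties using (toℕ<n; toℕ-fromℕ<; toℕ-injective; remQuot-combine; combine-remQuot; any?) renaming (_≟_ to _≟ᶠ_)
  open import Data.Fin.Subset using (Nonempty) renaming (_∈_ to _∈ˢ_)
  open import Data.Fin.Subset.Properties using (_∈?_)
  open import Data.List.Base using ([]; _∷_)
  open import Data.List.Membership.Propositional using () renaming (_∈_ to _∈ˡ_)
  import Data.List.Membership.DecPropositional as DecMem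
  open import Data.List.Relation.Unary.Any using (here; there)
  open import Data.List.Relation.Unary.All using ([]; _∷_)
  open import Data.List.Relation.Unary.All.Properties using (¬Any⇒All¬)
  open import Data.List.Relation.Unary.AllPairs using ([]; _∷_)
  open import Data.Nat.Base using (ℕ; zero; suc; _+_; _*_; _≤_; _<_; z≤n; s≤s)
  open import Data.Nat.Properties
  open import Data.Product.Base using (Σ-syntax; ∃-syntax; _×_; _,_; proj₁; proj₂)
  open import Data.Sum.Base using (inj₁; inj₂)
  open import Data.Bool.Base using (Bool; true; not)
  open import Function.Base using (_∘_; id)
  open import Relation.Binary.Construct.Closure.ReflexiveTransitive using (ε; _◅_; _◅◅_)
  open import Relation.Binary.PropositionalEquality using (_≡_; refl; sym; trans; cong; cong₂)
  open import Relation.Nullary using (¬_; Dec; yes; no; contradiction)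
  open import Relation.Nullary.Decidable using (_×-dec_)

  least : {Q : ℕ → Set} → (∀ k → Dec (Q k)) → ∀ k → Q k → Σ[ j ∈ ℕ ] Q j × (∀ i → Q i → j ≤ i)
  least q? zero    p = 0 , p , λ _ _ → z≤n
  least q? (suc k) p with q? 0
  ... | yes p₀ = 0 , p₀ , λ _ _ → z≤n
  ... | no ¬p₀ with least (q? ∘ suc) k p
  ...   | j , pj , min = suc j , pj , λ { zero p₀ → contradiction p₀ ¬p₀ ; (suc i) pi → s≤s (min i pi) }

  -- Walks, geodesics and convex sets of an oriented graph.

  module Digraph {N : ℕ} {G : Graph N} (D : Orientation G) where
    open Orientation D public
    open Graph G

    len : ∀ {u v} → Walk D u v → ℕ
    len = length D

    Shortest : ∀ {u v} → Walk D u v → Set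
    Shortest {u} {v} p = (q : Walk D u v) → len p ≤ len q

    len-◅◅ : ∀ {u v w} (p : Walk D u v) (q : Walk D v w) → len (p ◅◅ q) ≡ len p + len q
    len-◅◅ ε       q = refl
    len-◅◅ (_ ◅ p) q = cong suc (len-◅◅ p q)

    start∈ : ∀ {u v} (p : Walk D u v) → u ∈ˡ vertices D p
    start∈ ε       = here refl
    start∈ (_ ◅ _) = here refl

    mid∈ : ∀ {u v w} (p : Walk D u v) (q : Walk D v w) → v ∈ˡ vertices D (p ◅◅ q)
    mid∈ ε       q = start∈ q
    mid∈ (_ ◅ p) q = there (mid∈ p q)

    split : ∀ {u v w} (p : Walk D u v) → w ∈ˡ vertices D p →
            Σ[ q ∈ Walk D u w ] Σ[ r ∈ Walk D w v ] (len q + len r ≡ len p × (IsPath D p → IsPath D r))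
    split ε       (here refl) = ε , ε , refl , id
    split (a ◅ p) (here refl) = ε , a ◅ p , refl , id
    split (a ◅ p) (there w∈)  with split p w∈
    ... | q , r , e , u = a ◅ q , r , cong suc e , λ { (_ ∷ up) → u up }

    shortest⇒path : ∀ {u v} (p : Walk D u v) → Shortest p → IsPath D p
    shortest⇒path ε       _  = [] ∷ []
    shortest⇒path (a ◅ p) sh = ¬Any⇒All¬ _ u∉ ∷ shortest⇒path p (λ q → ≤-pred (sh (a ◅ q)))
      where
      u∉ : ¬ (_ ∈ˡ vertices D p)
      u∉ u∈ with split p u∈
      ... | q , r , e , _ = 1+n≰n (≤-trans (sh r) (≤-trans (m≤n+m (len r) (len q)) (≤-reflexive e)))

    -- Geodesics are compared with paths only. Cutting the closed parts out of a walk shows that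
    -- comparison with all walks gives the same notion, and walks, unlike paths, can be concatenated
    -- freely.
    toPath : ∀ {u v} (p : Walk D u v) → Σ[ q ∈ Walk D u v ] (IsPath D q × len q ≤ len p)
    toPath ε = ε , [] ∷ [] , z≤n
    toPath {u} (a ◅ p) with toPath p
    ... | q , uq , l with DecMem._∈?_ _≟ᶠ_ u (vertices D q)
    ...   | no u∉  = a ◅ q , ¬Any⇒All¬ _ u∉ ∷ uq , s≤s l
    ...   | yes u∈ with split q u∈
    ...     | q′ , r , e , ur = r , ur uq , ≤-trans (m≤n+m (len r) (len q′)) (≤-trans (≤-reflexive e) (m≤n⇒m≤1+n l))

    shortest⇒geodesic : ∀ {u v} (p : Walk D u v) → Shortest p → IsGeodesic D p
    shortest⇒geodesic p sh = shortest⇒path p sh , λ q _ → sh q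

    geodesic⇒shortest : ∀ {u v} (p : Walk D u v) → IsGeodesic D p → Shortest p
    geodesic⇒shortest p (_ , min) q with toPath q
    ... | q′ , uq , l = ≤-trans (min q′ uq) l

    convex-closed : ∀ {S u v w} → Convex D S → u ∈ˢ S → w ∈ˢ S → (p : Walk D u v) (q : Walk D v w) →
                    (∀ r → len p + len q ≤ len {u} {w} r) → v ∈ˢ S
    convex-closed (_ , c) u∈ w∈ p q sh =
      c u∈ w∈ (inj₁ (p ◅◅ q , shortest⇒geodesic (p ◅◅ q)
        (λ r → ≤-trans (≤-reflexive (len-◅◅ p q)) (sh r)) , mid∈ p q))

    closed-convex : ∀ {S} → Nonempty S →
                    (∀ {u v w} → u ∈ˢ S → w ∈ˢ S → (p : Walk D u v) (q : Walk D v w) →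
                      (∀ r → len p + len q ≤ len {u} {w} r) → v ∈ˢ S) → Convex D S
    closed-convex {S} ne cl = ne , λ { u∈ v∈ (inj₁ g) → on u∈ v∈ g ; u∈ v∈ (inj₂ g) → on v∈ u∈ g }
      where
      on : ∀ {u v w} → u ∈ˢ S → v ∈ˢ S → OnGeodesic D u v w → w ∈ˢ S
      on u∈ v∈ (p , g , w∈) with split p w∈
      ... | q , r , e , _ = cl u∈ v∈ q r (λ s → ≤-trans (≤-reflexive e) (geodesic⇒shortest p g s))

    -- `Arc` is an arbitrary relation, but every edge carries exactly one direction, so adjacency
    -- decides it. This makes shortest walks available by search.
    arc? : ∀ u v → Dec (Arc u v)
    arc? u v with adj? u v
    ... | no ¬a = no (¬a ∘ arc⇒adj)
    ... | yes a with adj⇒arc a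
    ...   | inj₁ uv = yes uv
    ...   | inj₂ vu = no (arc-asym vu)

    Reach : ℕ → Fin N → Fin N → Set
    Reach zero    u v = u ≡ v
    Reach (suc k) u v = ∃[ w ] (Arc u w × Reach k w v)

    reach? : ∀ k u v → Dec (Reach k u v)
    reach? zero    u v = u ≟ᶠ v
    reach? (suc k) u v = any? (λ w → arc? u w ×-dec reach? k w v)

    walk⇒reach : ∀ {u v} (p : Walk D u v) → Reach (len p) u v
    walk⇒reach ε       = refl
    walk⇒reach (a ◅ p) = _ , a , walk⇒reach p

    reach⇒walk : ∀ k {u v} → Reach k u v → Σ[ p ∈ Walk D u v ] len p ≡ k
    reach⇒walk zero    refl        = ε , refl
    reach⇒walk (suc k) (w , a , r) with reach⇒walk k r
    ... | p , e = a ◅ p , cong suc e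

    shortestWalk : ∀ {u v} → Walk D u v → Σ[ p ∈ Walk D u v ] Shortest p
    shortestWalk {u} {v} p with least (λ k → reach? k u v) (len p) (walk⇒reach p)
    ... | j , r , min with reach⇒walk j r
    ...   | q , refl = q , λ s → min (len s) (walk⇒reach s)

    data WalkIn (S : Fin N → Set) : Fin N → Fin N → Set where
      []  : ∀ {u} → WalkIn S u u
      _∷_ : ∀ {u v w} → Arc u v × S v → WalkIn S v w → WalkIn S u w

    -- A shortest walk stays inside a convex set that contains its ends: its second vertex is on a
    -- geodesic, and the rest of it is again shortest.
    convex⇒walkIn : ∀ {S u v} → Strong D → Convex D S → u ∈ˢ S → v ∈ˢ S → WalkIn (_∈ˢ S) u v
    convex⇒walkIn {S} {u} {v} st cx u∈ v∈ with shortestWalk (proj₁ (st u v))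
    ... | p , sh = go u∈ p sh
      where
      go : ∀ {u} → u ∈ˢ S → (p : Walk D u v) → Shortest p → WalkIn (_∈ˢ S) u v
      go u∈ ε       _  = []
      go u∈ (a ◅ p) sh = (a , w∈) ∷ go w∈ p (λ q → ≤-pred (sh (a ◅ q)))
        where w∈ = convex-closed cx u∈ v∈ (a ◅ ε) p sh

  isEven : ℕ → Bool
  isEven zero    = true
  isEven (suc n) = not (isEven n)

  -- Vertices of P n □ P m are handled through their coordinates.
  Pt : Set
  Pt = ℕ × ℕ

  module Coordinates (n m : ℕ) where

    InB : Pt → Set
    InB (x , y) = x < n × y < m

    co : Fin (n * m) → Pt
    co v = toℕ (proj₁ (remQuot {n} m v)) , toℕ (proj₂ (remQuot {n} m v))

    co-in : ∀ v → InB (co v)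
    co-in v = toℕ<n (proj₁ (remQuot {n} m v)) , toℕ<n (proj₂ (remQuot {n} m v))

    at : ∀ {a} → InB a → Fin (n * m)
    at (p , q) = combine (fromℕ< p) (fromℕ< q)

    co-at : ∀ {a} (i : InB a) → co (at i) ≡ a
    co-at (p , q) = cong₂ _,_ (trans (cong (toℕ ∘ proj₁) rq) (toℕ-fromℕ< p))
                              (trans (cong (toℕ ∘ proj₂) rq) (toℕ-fromℕ< q))
      where rq = remQuot-combine (fromℕ< p) (fromℕ< q)

    co-injective : ∀ {u v} → co u ≡ co v → u ≡ v
    co-injective {u} {v} e =
      trans (sym (combine-remQuot {n} m u))
        (trans (cong₂ combine (toℕ-injective (cong proj₁ e)) (toℕ-injective (cong proj₂ e)))
               (combine-remQuot {n} m v))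

-- Oriented grids, hulls, and the reduction of the convexity number to them.

module GridD where

  open Core
  open import Data.Fin.Base using (Fin; toℕ; remQuot; zero; suc)
  open import Data.Fin.Properties using (toℕ-injective; any?) renaming (_≟_ to _≟ᶠ_)
  open import Data.Fin.Subset using (Subset; ⊤; ∣_∣; ∁; ⁅_⁆) renaming (_∈_ to _∈ˢ_; _∉_ to _∉ˢ_)
  open import Data.Fin.Subset.Properties using (p⊆q⇒∣p∣≤∣q∣; _∈?_; ⊆⊤; ⊆-antisym; ∣⁅x⁆∣≡1; x∉p⇒x∈∁p; x∈⁅x⁆; x∈⁅y⁆⇒x≡y; ∈⊤)
  open import Data.Nat.Base using (ℕ; zero; suc; _+_; _*_; _∸_; _≤_; _<_; z≤n; s≤s)
  open import Data.Nat.Properties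
  open import Data.Product.Base using (Σ-syntax; ∃; ∃-syntax; _×_; _,_; proj₁; proj₂)
  open import Data.Sum.Base using (_⊎_; inj₁; inj₂; [_,_]′)
  open import Data.Empty using (⊥; ⊥-elim)
  open import Data.Bool.Base using (Bool; true; false; not; _xor_)
  open import Data.Bool.Properties using (not-involutive; not-¬)
  open import Data.Nat.Tactic.RingSolver using (solve-∀)
  open import Function.Base using (_∘_; id)
  open import Data.Vec.Base using (tabulate)
  open import Data.Vec.Properties using (lookup∘tabulate; lookup⇒[]=; []=⇒lookup)
  open import Relation.Binary.Construct.Closure.ReflexiveTransitive using (ε; _◅_)
  open import Relation.Binary.PropositionalEquality using (_≡_; _≢_; refl; sym; trans; cong; cong₂; subst)
  open import Relation.Nullary using (¬_; Dec; yes; no; does; contradiction)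
  open import Relation.Nullary.Decidable using (_×-dec_; ¬?; dec-true; decidable-stable)


  -- The edge from (x , y) to (x + 1 , y) is oriented to the right iff Right x y, the
  -- edge from (x , y) to (x , y + 1) is oriented upwards iff Up x y.
  module OrientedGrid (n m : ℕ) {Right Up : ℕ → ℕ → Set}
                      (right? : ∀ x y → Dec (Right x y)) (up? : ∀ x y → Dec (Up x y)) where

    open Coordinates n m public

    data Step : Pt → Pt → Set where
      →R : ∀ {x y} → Right x y → Step (x , y) (suc x , y)
      ←L : ∀ {x y} → ¬ Right x y → Step (suc x , y) (x , y)
      ↑U : ∀ {x y} → Up x y → Step (x , y) (x , suc y)
      ↓D : ∀ {x y} → ¬ Up x y → Step (x , suc y) (x , y)

    step-asym : ∀ {a b} → Step a b → ¬ Step b a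
    step-asym (→R p) (←L q) = q p
    step-asym (←L p) (→R q) = p q
    step-asym (↑U p) (↓D q) = q p
    step-asym (↓D p) (↑U q) = p q

    infixr 5 _∷⟨_⟩_ _++_

    data Run : Pt → Pt → ℕ → Set where
      []     : ∀ {a} → Run a a 0
      _∷⟨_⟩_ : ∀ {a b c k} → Step a b → InB b → Run b c k → Run a c (suc k)

    _++_ : ∀ {a b c k l} → Run a b k → Run b c l → Run a c (k + l)
    []            ++ q = q
    (s ∷⟨ i ⟩ p) ++ q = s ∷⟨ i ⟩ (p ++ q)

    run-in : ∀ {a b k} → InB a → Run a b k → InB b
    run-in i []            = i
    run-in _ (_ ∷⟨ i ⟩ p) = run-in i p

    D : Orientation (P n □ P m)
    D = record
      { Arc      = λ u v → Step (co u) (co v)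
      ; arc⇒adj  = λ {u} {v} s → step⇒adj (coF u) (coF v) s
      ; adj⇒arc  = λ {u} {v} → adj⇒step (coF u) (coF v)
      ; arc-asym = step-asym
      }
      where
      coF : Fin (n * m) → Fin n × Fin m
      coF v = remQuot {n} m v
      cF : Fin n × Fin m → Pt
      cF (i , j) = toℕ i , toℕ j
      open Graph using (Adj)
      AdjF : Fin n × Fin m → Fin n × Fin m → Set
      AdjF (g , h) (g′ , h′) = (g ≡ g′ × Adj (P m) h h′) ⊎ (Adj (P n) g g′ × h ≡ h′)
      step⇒adj : ∀ a b → Step (cF a) (cF b) → AdjF a b
      step⇒adj (i , j) (i′ , j′) s with toℕ i in ei | toℕ j in ej | toℕ i′ in ei′ | toℕ j′ in ej′
      step⇒adj _ _ (→R _) | _ | _ | _ | _ =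
        inj₂ (inj₁ refl , toℕ-injective (trans ej (sym ej′)))
      step⇒adj _ _ (←L _) | _ | _ | _ | _ =
        inj₂ (inj₂ refl , toℕ-injective (trans ej (sym ej′)))
      step⇒adj _ _ (↑U _) | _ | _ | _ | _ =
        inj₁ (toℕ-injective (trans ei (sym ei′)) , inj₁ refl)
      step⇒adj _ _ (↓D _) | _ | _ | _ | _ =
        inj₁ (toℕ-injective (trans ei (sym ei′)) , inj₂ refl)
      adj⇒step : ∀ a b → AdjF a b → Step (cF a) (cF b) ⊎ Step (cF b) (cF a)
      adj⇒step (i , j) (.i , j′) (inj₁ (refl , inj₁ e)) rewrite sym e with up? (toℕ i) (toℕ j)
      ... | yes p = inj₁ (↑U p)
      ... | no ¬p = inj₂ (↓D ¬p)
      adj⇒step (i , j) (.i , j′) (inj₁ (refl , inj₂ e)) rewrite sym e with up? (toℕ i) (toℕ j′)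
      ... | yes p = inj₂ (↑U p)
      ... | no ¬p = inj₁ (↓D ¬p)
      adj⇒step (i , j) (i′ , .j) (inj₂ (inj₁ e , refl)) rewrite sym e with right? (toℕ i) (toℕ j)
      ... | yes p = inj₁ (→R p)
      ... | no ¬p = inj₂ (←L ¬p)
      adj⇒step (i , j) (i′ , .j) (inj₂ (inj₂ e , refl)) rewrite sym e with right? (toℕ i′) (toℕ j)
      ... | yes p = inj₂ (→R p)
      ... | no ¬p = inj₁ (←L ¬p)

    open Digraph D public using (convex-closed; closed-convex; convex⇒walkIn; WalkIn; []; _∷_; toPath; len-◅◅)

    run⇒walk : ∀ {a b k} → Run a b k → ∀ u v → co u ≡ a → co v ≡ b → Σ[ p ∈ Walk D u v ] length D p ≡ k
    run⇒walk [] u v refl e with co-injective {u} {v} (sym e)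
    ... | refl = ε , refl
    run⇒walk (s ∷⟨ i ⟩ p) u v refl e with run⇒walk p (at i) v (co-at i) e
    ... | q , l = subst (Step (co u)) (sym (co-at i)) s ◅ q , cong suc l

    walk⇒run : ∀ {u v} (p : Walk D u v) → Run (co u) (co v) (length D p)
    walk⇒run ε = []
    walk⇒run (_◅_ {_} {w} a p) = a ∷⟨ co-in w ⟩ walk⇒run p

    Closed : (Pt → Set) → Set
    Closed T = ∀ {a b c k l} → T a → T c → Run a b k → Run b c l →
               (∀ {j} → Run a c j → k + l ≤ j) → T b

    infixr 5 _∷_

    data RunIn (T : Pt → Set) : Pt → Pt → Set where
      []  : ∀ {a} → RunIn T a a
      _∷_ : ∀ {a b c} → Step a b × InB b × T b → RunIn T b c → RunIn T a c

    -- Both a convex set with respect to a strong orientation and a strong component are hulls.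
    record Hull (T : Pt → Set) : Set where
      field
        closed : Closed T
        conn   : ∀ {a b} → T a → T b → RunIn T a b
        inb    : ∀ {a} → T a → InB a

    module _ {T : Pt → Set} where
      -- A hull that meets both sides of a cut contains both ends of an arc across it. Where all
      -- arcs across the cut lead to one vertex, that vertex is forced into the hull.
      cross : ∀ {A : Pt → Set} → (∀ a → Dec (A a)) → ∀ {a b} → T a → A a → ¬ A b → RunIn T a b →
              Σ[ c ∈ Pt ] Σ[ d ∈ Pt ] (T c × A c × T d × ¬ A d × Step c d × InB d)
      cross A? ta Aa ¬Ab [] = contradiction Aa ¬Ab
      cross A? ta Aa ¬Ab (_∷_ {_} {c} (s , i , tc) p) with A? c
      ... | yes Ac = cross A? tc Ac ¬Ab p
      ... | no ¬Ac = _ , _ , ta , Aa , tc , ¬Ac , s , i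

      successor : ∀ {a b} → a ≢ b → RunIn T a b → Σ[ c ∈ Pt ] (T c × Step a c × InB c)
      successor ne []                = contradiction refl ne
      successor ne ((s , i , t) ∷ _) = _ , t , s , i

      lastStep : ∀ {a b c} → T a → Step a c × InB c × T c → RunIn T c b → Σ[ d ∈ Pt ] (T d × Step d b)
      lastStep ta (s , _ , _) []       = _ , ta , s
      lastStep ta (_ , _ , t) (x ∷ p) = lastStep t x p

      predecessor : ∀ {a b} → a ≢ b → T a → RunIn T a b → Σ[ c ∈ Pt ] (T c × Step c b)
      predecessor ne ta []      = contradiction refl ne
      predecessor ne ta (x ∷ p) = lastStep ta x p

    convex⇒hull : ∀ {S} → Strong D → Convex D S → Hull (λ a → Σ[ v ∈ Fin (n * m) ] (co v ≡ a × v ∈ˢ S))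
    convex⇒hull {S} st cx = record
      { closed = closed
      ; conn   = λ { (u , refl , u∈) (v , refl , v∈) → walkIn (convex⇒walkIn st cx u∈ v∈) }
      ; inb    = λ { (v , refl , _) → co-in v }
      }
      where
      T : Pt → Set
      T a = Σ[ v ∈ Fin (n * m) ] (co v ≡ a × v ∈ˢ S)
      walkIn : ∀ {u v} → WalkIn (_∈ˢ S) u v → RunIn T (co u) (co v)
      walkIn []            = []
      walkIn ((a , w∈) ∷ p) = (a , co-in _ , _ , refl , w∈) ∷ walkIn p
      closed : Closed T
      closed (u , refl , u∈) (w , refl , w∈) p q sh =
        let ib = run-in (co-in u) p
            p′ , e = run⇒walk p u (at ib) refl (co-at ib)
            q′ , e′ = run⇒walk q (at ib) w (co-at ib) refl
        in at ib , co-at ib , convex-closed cx u∈ w∈ p′ q′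
             (λ r → ≤-trans (≤-reflexive (cong₂ _+_ e e′)) (sh (walk⇒run r)))

    Mutual : Pt → Pt → Set
    Mutual o a = InB a × ∃ (Run o a) × ∃ (Run a o)

    mutual-hull : ∀ {o} → InB o → Hull (Mutual o)
    mutual-hull {o} io = record
      { closed = λ { (ia , (_ , p) , _) (_ , _ , (_ , q)) r s _ → run-in ia r , (_ , p ++ r) , (_ , s ++ q) }
      ; conn   = λ { (_ , (_ , p) , (_ , q)) (_ , (_ , p′) , (_ , q′)) → runIn (_ , p) (_ , q′) (q ++ p′) }
      ; inb    = proj₁
      }
      where
      runIn : ∀ {a b k} → ∃ (Run o a) → ∃ (Run b o) → Run a b k → RunIn (Mutual o) a b
      runIn _       _       []              = []
      runIn (_ , p) (j , q) (s ∷⟨ i ⟩ r) =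
        (s , i , i , (_ , p ++ (s ∷⟨ i ⟩ [])) , (_ , r ++ q)) ∷ runIn (_ , p ++ (s ∷⟨ i ⟩ [])) (j , q) r

    -- The strong component of `o` is a hull and contains `c`. Hence the filling argument made for
    -- convex sets also shows that this component is the whole grid.
    hull⇒strong : ∀ {o c} → InB o → ∃ (Run o c) → ∃ (Run c o) →
                  (∀ {T} → Hull T → T o → T c → ∀ a → InB a → T a) → Strong D
    hull⇒strong {o} {c} io (_ , p) (_ , q) all u v =
      let path = toPath (proj₁ (run⇒walk (proj₂ (to u) ++ proj₂ (from v)) u v refl refl)) in
      proj₁ path , proj₁ (proj₂ path)
      where
      mut : ∀ w → Mutual o (co w)
      mut w = all (mutual-hull io) (io , (_ , []) , (_ , [])) (run-in io p , (_ , p) , (_ , q)) (co w) (co-in w)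
      to : ∀ w → ∃ (Run (co w) o)
      to w = proj₂ (proj₂ (mut w))
      from : ∀ w → ∃ (Run o (co w))
      from w = proj₁ (proj₂ (mut w))

    module _ {S : Pt → Set} (S? : ∀ a → Dec (S a)) where

      sub : Subset (n * m)
      sub = tabulate (λ v → does (S? (co v)))

      ∈sub⁺ : ∀ {v} → S (co v) → v ∈ˢ sub
      ∈sub⁺ {v} s = lookup⇒[]= v sub (trans (lookup∘tabulate _ v) (dec-true (S? (co v)) s))

      ∈sub⁻ : ∀ {v} → v ∈ˢ sub → S (co v)
      ∈sub⁻ {v} v∈ with S? (co v) | trans (sym (lookup∘tabulate (λ v → does (S? (co v))) v)) ([]=⇒lookup v∈)
      ... | yes s | _  = s
      ... | no _  | ()

      Shortcuts : Set
      Shortcuts = ∀ {a b c k l} → InB a → S a → ¬ S b → S c → Run a b k → Run b c l →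
                  Σ[ j ∈ ℕ ] (Run a c j × j < k + l)

      -- A walk that leaves S re-enters it at t₀ only, so a lower bound Φ on the length of
      -- the walks to t₀ outside S turns into convexity of S.
      single-entrance : (t₀ : Pt) (Φ : Pt → ℕ) →
        (∀ {a b} → InB a → InB b → Step a b → ¬ S a → S b → b ≡ t₀ × Φ a ≤ 1) →
        (∀ {a b} → InB a → InB b → Step a b → ¬ S a → ¬ S b → Φ a ≤ suc (Φ b)) →
        (∀ {a b} → InB a → InB b → Step a b → S a → ¬ S b → Σ[ k ∈ ℕ ] (Run a t₀ k × k ≤ Φ b)) →
        Shortcuts
      single-entrance t₀ Φ entr lip exit = shortcut
        where
        back : ∀ {c v k} → InB c → ¬ S c → S v → Run c v k → Σ[ k′ ∈ ℕ ] (Run t₀ v k′ × Φ c + k′ ≤ k)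
        back ic ¬Sc Sv [] = contradiction Sv ¬Sc
        back {c} ic ¬Sc Sv (_∷⟨_⟩_ {b = b} {k = k} s ib p) with S? b
        ... | no ¬Sb = let k′ , r , l = back ib ¬Sb Sv p in
                       k′ , r , ≤-trans (+-monoˡ-≤ k′ (lip ic ib s ¬Sc ¬Sb)) (s≤s l)
        ... | yes Sb with entr ic ib s ¬Sc Sb
        ...   | refl , l = k , p , +-monoˡ-≤ k l
        shortcut : Shortcuts
        shortcut ia Sa ¬Sb Sc [] q = contradiction Sa ¬Sb
        shortcut {l = l} ia Sa ¬Sb Sc (_∷⟨_⟩_ {b = d} {k = k} s id p) q with S? d
        ... | yes Sd = let j , r , lt = shortcut id Sd ¬Sb Sc p q in suc j , s ∷⟨ id ⟩ r , s≤s lt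
        ... | no ¬Sd = let j , r , le  = exit ia id s Sa ¬Sd
                           k′ , r′ , le′ = back id ¬Sd Sc (p ++ q)
                       -- Inside `S` at most `Φ d` steps lead to `t₀`, outside at least as many from
                       -- `d` on. The step from `S` to `d` is the one that is saved.
                       in j + k′ , r ++ r′ , s≤s (≤-trans (+-monoˡ-≤ k′ le) le′)

      Points : Subset (n * m) → Pt → Set
      Points T a = ∃[ v ] (co v ≡ a × v ∈ˢ T)

      -- A proper convex set lies in `S`, is a single vertex, or has a vertex outside `S` and a
      -- second vertex. The first two kinds are no larger than `S`, so only the third is left to
      -- `gen`.
      spectrum-by : Strong D → Shortcuts →
        (∃[ a ] (InB a × S a)) → (∃[ a ] (InB a × ¬ S a)) →
        (∀ T → Hull (Points T) → ∀ {c d} → Points T c → ¬ S c → Points T d → c ≢ d →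
           (∀ a → InB a → Points T a) ⊎ ∣ T ∣ ≤ ∣ sub ∣) →
        StrongConvexitySpectrum (P n □ P m) ∣ sub ∣
      spectrum-by st sc (s₀ , is₀ , Ss₀) (c₀ , ic₀ , ¬Sc₀) gen =
        D , st , (sub , ((convex , proper) , refl)) , bound
        where
        s₀∈ : at is₀ ∈ˢ sub
        s₀∈ = ∈sub⁺ (subst S (sym (co-at is₀)) Ss₀)
        c₀∉ : at ic₀ ∉ˢ sub
        c₀∉ c∈ = ¬Sc₀ (subst S (co-at ic₀) (∈sub⁻ c∈))
        proper : sub ≢ ⊤
        proper e = c₀∉ (subst (at ic₀ ∈ˢ_) (sym e) ∈⊤)
        convex : Convex D sub
        convex = closed-convex (at is₀ , s₀∈) cl
          where
          cl : ∀ {u v w} → u ∈ˢ sub → w ∈ˢ sub → (p : Walk D u v) (q : Walk D v w) →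
               (∀ r → length D p + length D q ≤ length D {u} {w} r) → v ∈ˢ sub
          cl {u} {v} {w} u∈ w∈ p q sh with S? (co v)
          ... | yes Sv = ∈sub⁺ Sv
          ... | no ¬Sv with sc (co-in u) (∈sub⁻ u∈) ¬Sv (∈sub⁻ w∈) (walk⇒run p) (walk⇒run q)
          ...   | j , r , lt with run⇒walk r u w refl refl
          ...     | r′ , refl = contradiction (sh r′) (<⇒≱ lt)
        bound : ∀ T → ProperConvex D T → ∣ T ∣ ≤ ∣ sub ∣
        bound T (cx , T≢⊤) with any? (λ v → (v ∈? T) ×-dec ¬? (v ∈? sub))
        ... | no none = p⊆q⇒∣p∣≤∣q∣ (λ {v} v∈ → decidable-stable (v ∈? sub) (λ v∉ → none (v , v∈ , v∉)))
        ... | yes (c , c∈ , c∉) with any? (λ v → (v ∈? T) ×-dec ¬? (v ≟ᶠ c))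
        ...   | no alone = ≤-trans (p⊆q⇒∣p∣≤∣q∣ {q = ⁅ c ⁆} (λ {v} v∈ → only v v∈))
                             (≤-trans (≤-reflexive (trans (∣⁅x⁆∣≡1 c) (sym (∣⁅x⁆∣≡1 (at is₀)))))
                                 (p⊆q⇒∣p∣≤∣q∣ {p = ⁅ at is₀ ⁆} (λ {v} v∈ → subst (_∈ˢ sub) (sym (x∈⁅y⁆⇒x≡y _ v∈)) s₀∈)))
          where
          only : ∀ v → v ∈ˢ T → v ∈ˢ ⁅ c ⁆
          only v v∈ = subst (_∈ˢ ⁅ c ⁆) (sym (decidable-stable (v ≟ᶠ c) (λ ne → alone (v , v∈ , ne)))) (x∈⁅x⁆ c)
        ...   | yes (d , d∈ , d≢) with gen T (convex⇒hull st cx) (c , refl , c∈) (c∉ ∘ ∈sub⁺) (d , refl , d∈) (λ e → d≢ (sym (co-injective e)))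
        ...     | inj₂ le = le
        ...     | inj₁ all = contradiction (⊆-antisym ⊆⊤ λ {v} _ → full v) T≢⊤
          where
          full : ∀ v → v ∈ˢ T
          full v with all (co v) (co-in v)
          ... | w , e , w∈ = subst (_∈ˢ T) (co-injective e) w∈

      -- A hull disjoint from `S` need not generate anything if the complement of `S` is no larger
      -- than `S`.
      spectrum : Strong D → Shortcuts →
        (∃[ a ] (InB a × S a)) → (∃[ a ] (InB a × ¬ S a)) →
        (∀ {T} → Hull T → (∃[ e ] (T e × S e)) ⊎ (∀ {a} → T a → ¬ S a) → ∀ {c d} → T c → ¬ S c → T d → c ≢ d →
           (∀ a → InB a → T a) ⊎ ((∀ {a} → T a → ¬ S a) × ∣ ∁ sub ∣ ≤ ∣ sub ∣)) →
        StrongConvexitySpectrum (P n □ P m) ∣ sub ∣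
      spectrum st sc in₀ out₀ gen = spectrum-by st sc in₀ out₀ λ T hull c∈ c∉ d∈ c≢d →
        [ inj₁ , (λ (out , le) → inj₂ (≤-trans (p⊆q⇒∣p∣≤∣q∣ (λ v∈ → x∉p⇒x∈∁p (λ v∈′ → out (_ , refl , v∈) (∈sub⁻ v∈′)))) le)) ]′
          (gen hull (meets T) c∈ c∉ d∈ c≢d)
        where
        meets : ∀ T → (∃[ a ] (Points T a × S a)) ⊎ (∀ {a} → Points T a → ¬ S a)
        meets T with any? (λ v → (v ∈? T) ×-dec S? (co v))
        ... | yes (v , v∈ , Sv) = inj₁ (co v , (v , refl , v∈) , Sv)
        ... | no none = inj₂ (λ { (v , refl , v∈) Sv → none (v , v∈ , Sv) })

    _∷ʳ_ : ∀ {a b c k} → Run a b k → Step b c × InB c → Run a c (suc k)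
    []            ∷ʳ (s , i) = s ∷⟨ i ⟩ []
    (t ∷⟨ j ⟩ p) ∷ʳ x       = t ∷⟨ j ⟩ (p ∷ʳ x)

    -- The difference of `f` and `g` grows by at most one per step. Both sides are kept as sums,
    -- since truncated differences would not telescope.
    lipschitz : ∀ (f g : Pt → ℕ) → (∀ {a b} → Step a b → f b + g a ≤ suc (f a + g b)) →
                ∀ {a c j} → Run a c j → f c + g a ≤ f a + g c + j
    lipschitz f g st {a} [] = ≤-reflexive (sym (+-identityʳ _))
    lipschitz f g st {a} {c} {suc j} (_∷⟨_⟩_ {b = b} s _ p) =
      +-cancelʳ-≤ (f b + g b) _ _ (≤-trans (≤-reflexive (e₁ (f c) (g a) (f b) (g b)))
        (≤-trans (+-mono-≤ (lipschitz f g st p) (st s)) (≤-reflexive (e₂ (f b) (g c) j (f a) (g b)))))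
      where
      e₁ : ∀ p q r s → p + q + (r + s) ≡ p + s + (r + q)
      e₁ = solve-∀
      e₂ : ∀ p q j r s → p + q + j + suc (r + s) ≡ r + q + suc j + (p + s)
      e₂ = solve-∀

    data Mode : Set where
      RU RD LU LD : Mode

    -- The difference of `ahead` and `behind` is the linear form x + y, x - y, y - x or -x - y that
    -- increases along both directions of the mode.
    ahead behind : Mode → Pt → ℕ
    ahead  RU (x , y) = x + y
    ahead  RD (x , y) = x
    ahead  LU (x , y) = y
    ahead  LD (x , y) = 0
    behind RU (x , y) = 0
    behind RD (x , y) = y
    behind LU (x , y) = x
    behind LD (x , y) = x + y

    ahead-lipschitz : ∀ μ {a b} → Step a b → ahead μ b + behind μ a ≤ suc (ahead μ a + behind μ b)
    ahead-lipschitz RU (→R _) = ≤-refl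
    ahead-lipschitz RU (←L _) = m≤n⇒m≤1+n (n≤1+n _)
    ahead-lipschitz RU (↑U {x} {y} _) rewrite +-suc x y = ≤-refl
    ahead-lipschitz RU (↓D {x} {y} _) rewrite +-suc x y = m≤n⇒m≤1+n (n≤1+n _)
    ahead-lipschitz RD (→R _) = ≤-refl
    ahead-lipschitz RD (←L _) = m≤n⇒m≤1+n (n≤1+n _)
    ahead-lipschitz RD (↑U {x} {y} _) rewrite +-suc x y = m≤n⇒m≤1+n (n≤1+n _)
    ahead-lipschitz RD (↓D {x} {y} _) rewrite +-suc x y = ≤-refl
    ahead-lipschitz LU (→R {x} {y} _) rewrite +-suc y x = m≤n⇒m≤1+n (n≤1+n _)
    ahead-lipschitz LU (←L {x} {y} _) rewrite +-suc y x = ≤-refl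
    ahead-lipschitz LU (↑U _) = ≤-refl
    ahead-lipschitz LU (↓D _) = m≤n⇒m≤1+n (n≤1+n _)
    ahead-lipschitz LD (→R _) = m≤n⇒m≤1+n (n≤1+n _)
    ahead-lipschitz LD (←L _) = ≤-refl
    ahead-lipschitz LD (↑U {x} {y} _) rewrite +-suc x y = m≤n⇒m≤1+n (n≤1+n _)
    ahead-lipschitz LD (↓D {x} {y} _) rewrite +-suc x y = ≤-refl

    -- A run whose steps all follow the two directions of the mode; it is a shortest one.
    record Mono (μ : Mode) (a c : Pt) : Set where
      constructor mono
      field
        {steps} : ℕ
        run     : Run a c steps
        tight   : ahead μ a + behind μ c + steps ≤ ahead μ c + behind μ a

    mono-refl : ∀ {μ a} → Mono μ a a
    mono-refl = mono [] (≤-reflexive (+-identityʳ _))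

    infixr 5 _▹_

    _▹_ : ∀ {μ a b c} → Mono μ a b → Mono μ b c → Mono μ a c
    _▹_ {μ} {a} {b} {c} (mono {k} p l) (mono {k′} q l′) = mono (p ++ q)
      (+-cancelʳ-≤ (ahead μ b + behind μ b) _ _
        (≤-trans (≤-reflexive (e₁ (ahead μ a) (behind μ c) k k′ (ahead μ b) (behind μ b)))
          (≤-trans (+-mono-≤ l l′) (≤-reflexive (e₂ (ahead μ b) (behind μ a) (ahead μ c) (behind μ b))))))
      where
      e₁ : ∀ p q k l r s → p + q + (k + l) + (r + s) ≡ p + s + k + (r + q + l)
      e₁ = solve-∀
      e₂ : ∀ p q r s → p + q + (r + s) ≡ r + q + (p + s)
      e₂ = solve-∀

    data Along : Mode → ∀ {a b} → Step a b → Set where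
      ru→ : ∀ {x y p} → Along RU (→R {x} {y} p)
      rd→ : ∀ {x y p} → Along RD (→R {x} {y} p)
      lu← : ∀ {x y p} → Along LU (←L {x} {y} p)
      ld← : ∀ {x y p} → Along LD (←L {x} {y} p)
      ru↑ : ∀ {x y p} → Along RU (↑U {x} {y} p)
      lu↑ : ∀ {x y p} → Along LU (↑U {x} {y} p)
      rd↓ : ∀ {x y p} → Along RD (↓D {x} {y} p)
      ld↓ : ∀ {x y p} → Along LD (↓D {x} {y} p)

    one : ∀ {μ a b} (s : Step a b) → Along μ s → InB b → Mono μ a b
    one s al i = mono (s ∷⟨ i ⟩ []) (le al)
      where
      le : ∀ {μ a b} {s : Step a b} → Along μ s → ahead μ a + behind μ b + 1 ≤ ahead μ b + behind μ a
      le (ru→ {x} {y}) rewrite +-identityʳ (x + y) | +-comm (x + y) 1 = ≤-refl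
      le (rd→ {x} {y}) rewrite +-comm (x + y) 1 = ≤-refl
      le (lu← {x} {y}) rewrite +-comm (y + x) 1 | +-suc y x = ≤-refl
      le (ld← {x} {y}) rewrite +-comm (x + y) 1 = ≤-refl
      le (ru↑ {x} {y}) rewrite +-identityʳ (x + y) | +-comm (x + y) 1 | +-identityʳ (x + suc y) | +-suc x y = ≤-refl
      le (lu↑ {x} {y}) rewrite +-comm (y + x) 1 = ≤-refl
      le (rd↓ {x} {y}) rewrite +-comm (x + y) 1 | +-suc x y = ≤-refl
      le (ld↓ {x} {y}) rewrite +-comm (x + y) 1 | +-suc x y = ≤-refl

    right-run : ∀ {μ x x′ y} → μ ≡ RU ⊎ μ ≡ RD → x ≤ x′ → (∀ i → x ≤ i → i < x′ → Right i y) → InB (x′ , y) → Mono μ (x , y) (x′ , y)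
    right-run {x′ = x′} μ≡ x≤ f i with m≤n⇒m<n∨m≡n x≤
    ... | inj₂ refl = mono-refl
    right-run {x′ = suc x′} μ≡ x≤ f i | inj₁ (s≤s x<) =
      right-run μ≡ x< (λ j p q → f j p (m<n⇒m<1+n q)) (<-trans ≤-refl (proj₁ i) , proj₂ i) ▹ st μ≡
      where
      st : ∀ {μ} → μ ≡ RU ⊎ μ ≡ RD → Mono μ _ _
      st (inj₁ refl) = one (→R (f x′ x< ≤-refl)) ru→ i
      st (inj₂ refl) = one (→R (f x′ x< ≤-refl)) rd→ i

    left-run : ∀ {μ x x′ y} → μ ≡ LU ⊎ μ ≡ LD → x ≤ x′ → (∀ i → x ≤ i → i < x′ → ¬ Right i y) → InB (x′ , y) → Mono μ (x′ , y) (x , y)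
    left-run {x′ = x′} μ≡ x≤ f i with m≤n⇒m<n∨m≡n x≤
    ... | inj₂ refl = mono-refl
    left-run {x′ = suc x′} μ≡ x≤ f i | inj₁ (s≤s x<) =
      st μ≡ ▹ left-run μ≡ x< (λ j p q → f j p (m<n⇒m<1+n q)) i′
      where
      i′ = <-trans ≤-refl (proj₁ i) , proj₂ i
      st : ∀ {μ} → μ ≡ LU ⊎ μ ≡ LD → Mono μ _ _
      st (inj₁ refl) = one (←L (f x′ x< ≤-refl)) lu← i′
      st (inj₂ refl) = one (←L (f x′ x< ≤-refl)) ld← i′

    up-run : ∀ {μ x y y′} → μ ≡ RU ⊎ μ ≡ LU → y ≤ y′ → (∀ i → y ≤ i → i < y′ → Up x i) → InB (x , y′) → Mono μ (x , y) (x , y′)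
    up-run {y′ = y′} μ≡ y≤ f i with m≤n⇒m<n∨m≡n y≤
    ... | inj₂ refl = mono-refl
    up-run {y′ = suc y′} μ≡ y≤ f i | inj₁ (s≤s y<) =
      up-run μ≡ y< (λ j p q → f j p (m<n⇒m<1+n q)) (proj₁ i , <-trans ≤-refl (proj₂ i)) ▹ st μ≡
      where
      st : ∀ {μ} → μ ≡ RU ⊎ μ ≡ LU → Mono μ _ _
      st (inj₁ refl) = one (↑U (f y′ y< ≤-refl)) ru↑ i
      st (inj₂ refl) = one (↑U (f y′ y< ≤-refl)) lu↑ i

    down-run : ∀ {μ x y y′} → μ ≡ RD ⊎ μ ≡ LD → y ≤ y′ → (∀ i → y ≤ i → i < y′ → ¬ Up x i) → InB (x , y′) → Mono μ (x , y′) (x , y)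
    down-run {y′ = y′} μ≡ y≤ f i with m≤n⇒m<n∨m≡n y≤
    ... | inj₂ refl = mono-refl
    down-run {y′ = suc y′} μ≡ y≤ f i | inj₁ (s≤s y<) =
      st μ≡ ▹ down-run μ≡ y< (λ j p q → f j p (m<n⇒m<1+n q)) i′
      where
      i′ = proj₁ i , <-trans ≤-refl (proj₂ i)
      st : ∀ {μ} → μ ≡ RD ⊎ μ ≡ LD → Mono μ _ _
      st (inj₁ refl) = one (↓D (f y′ y< ≤-refl)) rd↓ i′
      st (inj₂ refl) = one (↓D (f y′ y< ≤-refl)) ld↓ i′

    par : Pt → Bool
    par (x , y) = isEven x xor isEven y

    step-par : ∀ {a b} → Step a b → par b ≡ not (par a)
    step-par (→R {x} {y} _) with isEven x | isEven y
    ... | true  | _ = sym (not-involutive _)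
    ... | false | _ = refl
    step-par (←L {x} {y} _) with isEven x | isEven y
    ... | true  | _ = refl
    ... | false | _ = sym (not-involutive _)
    step-par (↑U {x} {y} _) with isEven x | isEven y
    ... | true  | _ = refl
    ... | false | _ = refl
    step-par (↓D {x} {y} _) with isEven x | isEven y
    ... | true  | _ = sym (not-involutive _)
    ... | false | _ = sym (not-involutive _)

    no-triangle : ∀ {a b c} → Step a b → Step b c → ¬ Step a c
    no-triangle {a} s t u with par a in e | step-par s | step-par t | step-par u
    ... | true  | p | q | r rewrite p | q with () ← r
    ... | false | p | q | r rewrite p | q with () ← r

    data Cyclic (x y : ℕ) : Set where
      ccw : Right x y → Up (suc x) y → ¬ Right x (suc y) → ¬ Up x y → Cyclic x y
      cw  : ¬ Right x y → ¬ Up (suc x) y → Right x (suc y) → Up x y → Cyclic x y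

    module _ {T : Pt → Set} (h : Hull T) where
      open Hull h renaming (closed to cl)

      -- Two runs of the same mode, joined, attain the bound of `lipschitz`; so they form a
      -- geodesic, and the joint lies in the hull.
      between : ∀ μ {a b c} → T a → T c → Mono μ a b → Mono μ b c → T b
      between μ {a} {b} {c} ta tc p q =
        cl ta tc (Mono.run p) (Mono.run q)
          (λ r → +-cancelˡ-≤ (ahead μ a + behind μ c) _ _
            (≤-trans (Mono.tight (p ▹ q)) (lipschitz (ahead μ) (behind μ) (ahead-lipschitz μ) r)))

      -- The grid is bipartite, so no arc joins the ends of a directed path with two arcs.
      middle : ∀ {a b c} → T a → T c → a ≢ c → Step a b → InB b → Step b c → InB c → T b
      middle ta tc ne s i t i′ = cl ta tc (s ∷⟨ i ⟩ []) (t ∷⟨ i′ ⟩ [])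
        λ { [] → contradiction refl ne
          ; (u ∷⟨ _ ⟩ []) → contradiction u (no-triangle s t)
          ; (_ ∷⟨ _ ⟩ (_ ∷⟨ _ ⟩ _)) → s≤s (s≤s z≤n) }

      around : ∀ {a b j} → Step a b → Run b a j → 3 ≤ j
      around s (t ∷⟨ _ ⟩ []) = contradiction t (step-asym s)
      around s (t ∷⟨ _ ⟩ (u ∷⟨ _ ⟩ [])) = ⊥-elim (odd s t u)
        where
        odd : ∀ {a b c} → Step a b → Step b c → Step c a → ⊥
        odd {a} s t u with par a in e | step-par s | step-par t | step-par u
        ... | true  | p | q | r rewrite p | q with () ← r
        ... | false | p | q | r rewrite p | q with () ← r
      around s (_ ∷⟨ _ ⟩ (_ ∷⟨ _ ⟩ (_ ∷⟨ _ ⟩ _))) = s≤s (s≤s (s≤s z≤n))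
      around s [] = ⊥-elim (step-asym s s)

      -- A walk from `b` back to `a` has odd length, and length one is excluded by the arc from `a`
      -- to `b`. So the other three sides of a cyclic face are a geodesic.
      face : ∀ {a b c d} → T a → T b → Step a b → Step b c → InB c → Step c d → InB d → Step d a → T c × T d
      face ta tb s t ic u id v =
        cl tb ta (t ∷⟨ ic ⟩ []) (u ∷⟨ id ⟩ (v ∷⟨ inb ta ⟩ [])) (around s) ,
        cl tb ta (t ∷⟨ ic ⟩ (u ∷⟨ id ⟩ [])) (v ∷⟨ inb ta ⟩ []) (around s)

      -- The ends are distinct and in the same class of the bipartition, and two steps are excluded
      -- by hypothesis, so four steps are the least possible.
      detour : ∀ {a b c d e} → T a → T e → a ≢ e → (∀ {x} → Step a x → ¬ Step x e) →
               Step a b → InB b → Step b c → InB c → Step c d → InB d → Step d e → T b × T c × T d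
      detour {a} {b} {c} {d} {e} ta te ne no2 s ib t ic u id v =
        cl ta te (s ∷⟨ ib ⟩ []) (t ∷⟨ ic ⟩ (u ∷⟨ id ⟩ (v ∷⟨ inb te ⟩ []))) far ,
        cl ta te (s ∷⟨ ib ⟩ (t ∷⟨ ic ⟩ [])) (u ∷⟨ id ⟩ (v ∷⟨ inb te ⟩ [])) far ,
        cl ta te (s ∷⟨ ib ⟩ (t ∷⟨ ic ⟩ (u ∷⟨ id ⟩ []))) (v ∷⟨ inb te ⟩ []) far
        where
        even : par e ≡ par a
        even with par a | step-par s | step-par t | step-par u | step-par v
        ... | true  | p | q | r | w rewrite p | q | r = w
        ... | false | p | q | r | w rewrite p | q | r = w
        far : ∀ {j} → Run a e j → 4 ≤ j
        far [] = contradiction refl ne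
        far (x ∷⟨ _ ⟩ []) = ⊥-elim (not-¬ refl (trans (sym even) (step-par x)))
        far (x ∷⟨ _ ⟩ (y ∷⟨ _ ⟩ [])) = contradiction y (no2 x)
        far (x ∷⟨ _ ⟩ (y ∷⟨ _ ⟩ (z ∷⟨ _ ⟩ []))) = ⊥-elim (not-¬ refl (trans (sym even) (trans (step-par z)
          (cong not (trans (step-par y) (trans (cong not (step-par x)) (not-involutive _)))))))
        far (_ ∷⟨ _ ⟩ (_ ∷⟨ _ ⟩ (_ ∷⟨ _ ⟩ (_ ∷⟨ _ ⟩ _)))) = s≤s (s≤s (s≤s (s≤s z≤n)))

      -- A set with two elements contains a closed walk, so it leaves an acyclic region.
      escape : {A : Pt → Set} → (∀ a → Dec (A a)) → (ψ : Pt → ℕ) →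
               (∀ {a b} → InB a → InB b → Step a b → A a → A b → ψ a < ψ b) →
               ∀ {c d} → T c → A c → T d → c ≢ d → Σ[ e ∈ Pt ] (T e × ¬ A e)
      escape {A} A? ψ inc {c} {d} Tc Ac Td ne with A? d
      ... | no ¬Ad = d , Td , ¬Ad
      ... | yes Ad with go Tc Ac (conn Tc Td) | go Td Ad (conn Td Tc)
        where
        go : ∀ {c d} → T c → A c → RunIn T c d → (Σ[ e ∈ Pt ] (T e × ¬ A e)) ⊎ (c ≡ d ⊎ ψ c < ψ d)
        go Tc Ac [] = inj₂ (inj₁ refl)
        go Tc Ac (_∷_ {_} {e} (s , i , Te) p) with A? e
        ... | no ¬Ae = inj₁ (e , Te , ¬Ae)
        ... | yes Ae with go Te Ae p
        ...   | inj₁ r = inj₁ r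
        ...   | inj₂ (inj₁ refl) = inj₂ (inj₂ (inc (inb Tc) i s Ac Ae))
        ...   | inj₂ (inj₂ lt)   = inj₂ (inj₂ (<-trans (inc (inb Tc) i s Ac Ae) lt))
      ...   | inj₁ r | _ = r
      ...   | _ | inj₁ r = r
      ...   | inj₂ (inj₁ e) | _ = contradiction e ne
      ...   | _ | inj₂ (inj₁ e) = contradiction (sym e) ne
      ...   | inj₂ (inj₂ l) | inj₂ (inj₂ l′) = contradiction l′ (<-asym l)

      record Corners (x y : ℕ) : Set where
        constructor corners
        field
          sw : T (x , y)
          se : T (suc x , y)
          nw : T (x , suc y)
          ne : T (suc x , suc y)

      module _ {x y : ℕ} where
        private
          sw-in : InB (suc x , suc y) → InB (x , y)
          sw-in (p , q) = <-trans ≤-refl p , <-trans ≤-refl q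
          se-in : InB (suc x , suc y) → InB (suc x , y)
          se-in (p , q) = p , <-trans ≤-refl q
          nw-in : InB (suc x , suc y) → InB (x , suc y)
          nw-in (p , q) = <-trans ≤-refl p , q

        from-south : Cyclic x y → InB (suc x , suc y) → T (x , y) → T (suc x , y) → Corners x y
        from-south (ccw b r t′ l) i t u = let v , w = face t u (→R b) (↑U r) i (←L t′) (nw-in i) (↓D l) in corners t u w v
        from-south (cw b r t′ l) i t u = let v , w = face u t (←L b) (↑U l) (nw-in i) (→R t′) i (↓D r) in corners t u v w

        from-north : Cyclic x y → InB (suc x , suc y) → T (x , suc y) → T (suc x , suc y) → Corners x y
        from-north (ccw b r t′ l) i t u = let v , w = face u t (←L t′) (↓D l) (sw-in i) (→R b) (se-in i) (↑U r) in corners v w t u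
        from-north (cw b r t′ l) i t u = let v , w = face t u (→R t′) (↓D r) (se-in i) (←L b) (sw-in i) (↑U l) in corners w v t u

        from-west : Cyclic x y → InB (suc x , suc y) → T (x , y) → T (x , suc y) → Corners x y
        from-west (ccw b r t′ l) i t u = let v , w = face u t (↓D l) (→R b) (se-in i) (↑U r) i (←L t′) in corners t v u w
        from-west (cw b r t′ l) i t u = let v , w = face t u (↑U l) (→R t′) i (↓D r) (se-in i) (←L b) in corners t w u v

        from-east : Cyclic x y → InB (suc x , suc y) → T (suc x , y) → T (suc x , suc y) → Corners x y
        from-east (ccw b r t′ l) i t u = let v , w = face t u (↑U r) (←L t′) (nw-in i) (↓D l) (sw-in i) (→R b) in corners w t v u
        from-east (cw b r t′ l) i t u = let v , w = face u t (↓D r) (←L b) (sw-in i) (↑U l) (nw-in i) (→R t′) in corners v t w u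

      -- The faces (x , y) with a ≤ x < e and y < H x are cyclic, hence linked through the bottom row.
      module Faces (a e : ℕ) (H : ℕ → ℕ) (H>0 : ∀ {x} → a ≤ x → x < e → 0 < H x)
                   (cyc : ∀ {x y} → a ≤ x → x < e → y < H x → Cyclic x y × InB (suc x , suc y)) where

        to-bottom : ∀ y {x} → a ≤ x → x < e → y < H x → Corners x y → Corners x 0
        to-bottom zero    _ _ _ c = c
        to-bottom (suc y) p q l c = let l′ = <-trans ≤-refl l; cy , i = cyc p q l′ in
          to-bottom y p q l′ (from-north cy i (Corners.sw c) (Corners.se c))

        from-bottom : ∀ y {x} → a ≤ x → x < e → y < H x → Corners x 0 → Corners x y
        from-bottom zero    _ _ _ c = c
        from-bottom (suc y) p q l c = let c′ = from-bottom y p q (<-trans ≤-refl l) c; cy , i = cyc p q l in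
          from-south cy i (Corners.nw c′) (Corners.ne c′)

        rightwards : ∀ k {x} → a ≤ x → k + x < e → Corners x 0 → Corners (k + x) 0
        rightwards zero    _ _ c = c
        rightwards (suc k) {x} p q c =
          let c′ = rightwards k p (<-trans ≤-refl q) c
              p′ = ≤-trans p (m≤n+m x (suc k))
              cy , i = cyc p′ q (H>0 p′ q)
          in from-west cy i (Corners.se c′) (Corners.ne c′)

        leftwards : ∀ k {x} → a ≤ x → k + x < e → Corners (k + x) 0 → Corners x 0
        leftwards zero    _ _ c = c
        leftwards (suc k) {x} p q c =
          let q′ = <-trans ≤-refl q
              p′ = ≤-trans p (m≤n+m x k)
              cy , i = cyc p′ q′ (H>0 p′ q′)
          in leftwards k p q′ (from-east cy i (Corners.sw c) (Corners.nw c))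

        spread : ∀ {x y x′ y′} → a ≤ x → x < e → y < H x → Corners x y →
                 a ≤ x′ → x′ < e → y′ < H x′ → Corners x′ y′
        spread {x} {y} {x′} {y′} p q l c p′ q′ l′ = from-bottom y′ p′ q′ l′ (move (≤-total x x′))
          where
          c₀ = to-bottom y p q l c
          move : x ≤ x′ ⊎ x′ ≤ x → Corners x′ 0
          move (inj₁ le) = subst (λ i → Corners i 0) (m∸n+n≡m le)
            (rightwards (x′ ∸ x) p (subst (_< e) (sym (m∸n+n≡m le)) q′) c₀)
          move (inj₂ le) = leftwards (x ∸ x′) p′ (subst (_< e) (sym (m∸n+n≡m le)) q)
            (subst (λ i → Corners i 0) (sym (m∸n+n≡m le)) c₀)

-- Sizes of vertex sets whose columns are intervals.

module Count where

  open Core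
  open GridD
  open import Data.Fin.Base using (Fin; toℕ; zero; suc; remQuot; _↑ˡ_; _↑ʳ_)
  open import Data.Fin.Properties using (splitAt-↑ˡ; splitAt-↑ʳ)
  open import Data.Fin.Subset using (∣_∣)
  open import Data.Bool.Base using (Bool; true; false)
  open import Data.Nat.Base using (ℕ; zero; suc; _+_; _*_; _∸_; _≤_; _<_; z≤n; s≤s)
  open import Data.Nat.Properties
  open import Data.Product.Base using (_×_; _,_; proj₁; proj₂)
  open import Data.Vec.Base using (tabulate)
  open import Data.Vec.Properties using (tabulate-cong)
  open import Function.Base using (_∘_)
  open import Relation.Binary.PropositionalEquality using (_≡_; refl; sym; trans; cong; cong₂)
  open import Relation.Nullary using (Dec; does)
  open import Relation.Nullary.Decidable using (dec-true; dec-false)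

  ∣tabulate∣-++ : ∀ m {k} (f : Fin (m + k) → Bool) →
                  ∣ tabulate f ∣ ≡ ∣ tabulate (f ∘ (_↑ˡ k)) ∣ + ∣ tabulate (f ∘ (m ↑ʳ_)) ∣
  ∣tabulate∣-++ zero    f = refl
  ∣tabulate∣-++ (suc m) f with f zero
  ... | true  = cong suc (∣tabulate∣-++ m (f ∘ suc))
  ... | false = ∣tabulate∣-++ m (f ∘ suc)

  sum : ℕ → (ℕ → ℕ) → ℕ
  sum zero    c = 0
  sum (suc n) c = c 0 + sum n (c ∘ suc)

  ∣tabulate∣-columns : ∀ n m (f : ℕ → ℕ → Bool) (c : ℕ → ℕ) →
    (∀ x → x < n → ∣ tabulate {n = m} (f x ∘ toℕ) ∣ ≡ c x) →
    ∣ tabulate {n = n * m} (λ v → f (toℕ (proj₁ (remQuot {n} m v))) (toℕ (proj₂ (remQuot {n} m v)))) ∣ ≡ sum n c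
  ∣tabulate∣-columns zero    m f c e = refl
  ∣tabulate∣-columns (suc n) m f c e = trans (∣tabulate∣-++ m _)
    (cong₂ _+_ (trans (cong ∣_∣ (tabulate-cong first)) (e 0 (s≤s z≤n)))
               (trans (cong ∣_∣ (tabulate-cong rest)) (∣tabulate∣-columns n m (f ∘ suc) (c ∘ suc) (λ x x< → e (suc x) (s≤s x<)))))
    where
    first : ∀ j → f (toℕ (proj₁ (remQuot {suc n} m (j ↑ˡ (n * m))))) (toℕ (proj₂ (remQuot {suc n} m (j ↑ˡ (n * m))))) ≡ f 0 (toℕ j)
    first j rewrite splitAt-↑ˡ m j (n * m) = refl
    rest : ∀ v → f (toℕ (proj₁ (remQuot {suc n} m (m ↑ʳ v)))) (toℕ (proj₂ (remQuot {suc n} m (m ↑ʳ v))))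
               ≡ f (suc (toℕ (proj₁ (remQuot {n} m v)))) (toℕ (proj₂ (remQuot {n} m v)))
    rest v rewrite splitAt-↑ʳ m (n * m) v = refl

  ∣tabulate∣-interval : ∀ m (f : ℕ → Bool) {lo hi} → lo ≤ hi → hi ≤ m →
    (∀ y → lo ≤ y → y < hi → f y ≡ true) → (∀ y → y < lo → f y ≡ false) → (∀ y → hi ≤ y → y < m → f y ≡ false) →
    ∣ tabulate {n = m} (f ∘ toℕ) ∣ ≡ hi ∸ lo
  ∣tabulate∣-interval zero f {zero} {zero} _ _ _ _ _ = refl
  ∣tabulate∣-interval (suc m) f {suc lo} {suc hi} (s≤s l) (s≤s h) t b a
    rewrite b 0 (s≤s z≤n) =
    ∣tabulate∣-interval m (f ∘ suc) l h (λ y p q → t (suc y) (s≤s p) (s≤s q)) (λ y p → b (suc y) (s≤s p)) (λ y p q → a (suc y) (s≤s p) (s≤s q))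
  ∣tabulate∣-interval (suc m) f {zero} {suc hi} l (s≤s h) t b a
    rewrite t 0 z≤n (s≤s z≤n) =
    cong suc (∣tabulate∣-interval m (f ∘ suc) z≤n h (λ y p q → t (suc y) z≤n (s≤s q)) (λ y ()) (λ y p q → a (suc y) (s≤s p) (s≤s q)))
  ∣tabulate∣-interval (suc m) f {zero} {zero} l h t b a
    rewrite a 0 z≤n (s≤s z≤n) =
    ∣tabulate∣-interval m (f ∘ suc) z≤n z≤n (λ y _ ()) (λ y ()) (λ y _ q → a (suc y) z≤n (s≤s q))

  module _ {n m : ℕ} {S : Pt → Set} (S? : ∀ a → Dec (S a)) where
    open Coordinates n m

    ∣sub∣ : (lo hi : ℕ → ℕ) → (∀ x → x < n → lo x ≤ hi x × hi x ≤ m) →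
            (∀ {x y} → x < n → lo x ≤ y → y < hi x → S (x , y)) →
            (∀ {x y} → x < n → y < m → S (x , y) → lo x ≤ y × y < hi x) →
            ∣ tabulate (λ v → does (S? (co v))) ∣ ≡ sum n (λ x → hi x ∸ lo x)
    ∣sub∣ lo hi b into out = ∣tabulate∣-columns n m (λ x y → does (S? (x , y))) _ λ x x< →
      ∣tabulate∣-interval m _ (proj₁ (b x x<)) (proj₂ (b x x<))
        (λ y p q → dec-true (S? _) (into x< p q))
        (λ y p → dec-false (S? _) (λ s → <⇒≱ p (proj₁ (out x< (<-≤-trans p (≤-trans (proj₁ (b x x<)) (proj₂ (b x x<)))) s))))
        (λ y p q → dec-false (S? _) (λ s → <⇒≱ (proj₂ (out x< q s)) p))

  sum-+ : ∀ n k c → sum (n + k) c ≡ sum n c + sum k (λ i → c (n + i))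
  sum-+ zero    k c = refl
  sum-+ (suc n) k c = trans (cong (c 0 +_) (sum-+ n k (c ∘ suc))) (sym (+-assoc (c 0) _ _))

  sum-const : ∀ n {c a} → (∀ x → x < n → c x ≡ a) → sum n c ≡ n * a
  sum-const zero    e = refl
  sum-const (suc n) e = cong₂ _+_ (e 0 (s≤s z≤n)) (sum-const n (λ x x< → e (suc x) (s≤s x<)))

-- Sets below a staircase, entered by a single arc.

module Stair where

  open Core
  open GridD
  open Count
  open import Data.Nat.Base using (ℕ; zero; suc; pred; _+_; _∸_; _≤_; _<_; z≤n; s≤s; >-nonZero)
  open import Data.Nat.Properties
  open import Data.Product.Base using (Σ-syntax; ∃-syntax; _×_; _,_; proj₁; proj₂)
  open import Data.Product.Properties using (≡-dec)
  open import Data.Sum.Base using (_⊎_; inj₁; inj₂)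
  open import Function.Base using (_∘_)
  open import Relation.Binary.PropositionalEquality using (_≡_; _≢_; refl; sym; trans; cong; subst)
  open import Relation.Nullary using (¬_; Dec; yes; no; contradiction)
  open import Relation.Nullary.Decidable using (_×-dec_; _⊎-dec_; ¬?; decidable-stable)

  m+n≤o⇒n≤o∸m : ∀ m {n o} → m + n ≤ o → n ≤ o ∸ m
  m+n≤o⇒n≤o∸m m {n} l = ≤-trans (≤-reflexive (sym (m+n∸m≡n m n))) (∸-monoˡ-≤ m l)

  -- S lies below a staircase that leaves out the last column only.  Its boundary is
  -- directed from the top left corner down to t₀, the rest of S leads from t₀ back to
  -- that corner; every walk outside S ends with the arc from b to t₀.
  module Staircase (L m : ℕ) (h : ℕ → ℕ)
    (anti : ∀ {x x′} → x ≤ x′ → h x′ ≤ h x)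
    (h₀ : h 0 ≡ m) (h₁ : h 1 ≡ m) (h≥2 : ∀ {x} → x ≤ L → 2 ≤ h x) (h-last : h (suc L) ≡ 0) where

    -- Call a vertex inner if its diagonal neighbour to the upper right lies in `S`. A horizontal
    -- edge goes left iff its left end is inner or it is the edge between `t₀` and `b`. Column 0
    -- goes up and the last column goes down; elsewhere a vertical edge goes down iff its upper end
    -- lies in `S` and is not inner.
    Right Up : ℕ → ℕ → Set
    Right x y = h (suc x) ≤ suc y × ¬ (x ≡ L × y ≡ 0)
    Up x y = x ≢ suc L × (x ≡ 0 ⊎ h x ≤ suc y ⊎ suc (suc y) < h (suc x))

    right? : ∀ x y → Dec (Right x y)
    right? x y = (h (suc x) ≤? suc y) ×-dec ¬? ((x ≟ L) ×-dec (y ≟ 0))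

    up? : ∀ x y → Dec (Up x y)
    up? x y = ¬? (x ≟ suc L) ×-dec ((x ≟ 0) ⊎-dec ((h x ≤? suc y) ⊎-dec (suc (suc y) <? h (suc x))))

    open OrientedGrid (suc (suc L)) m right? up?

    S : Pt → Set
    S (x , y) = y < h x

    S? : ∀ a → Dec (S a)
    S? (x , y) = y <? h x

    t₀ b τ : Pt
    t₀ = L , 0
    b  = suc L , 0
    τ  = 0 , pred m

    2≤m : 2 ≤ m
    2≤m = subst (2 ≤_) h₀ (h≥2 z≤n)

    S⇒x≤L : ∀ {x y} → y < h x → x ≤ L
    S⇒x≤L {x} y< with x ≤? L
    ... | yes l = l
    ... | no ¬l = contradiction (≤-trans y< (≤-trans (anti (≰⇒> ¬l)) (≤-reflexive h-last))) λ ()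

    h≤m : ∀ x → h x ≤ m
    h≤m x = ≤-trans (anti z≤n) (≤-reflexive h₀)

    inS : ∀ {x y} → y < h x → InB (x , y)
    inS {x} y< = s≤s (m≤n⇒m≤1+n (S⇒x≤L y<)) , ≤-trans y< (h≤m x)

    τ-in : InB τ
    τ-in = s≤s z≤n , ≤-reflexive (suc-pred m ⦃ >-nonZero (≤-trans (s≤s z≤n) 2≤m) ⦄)

    no-up : ∀ {x y} → suc y < h x → h (suc x) ≤ suc y → ¬ Up x y
    no-up y< l (_ , inj₁ refl)        = <⇒≱ y< (≤-trans (≤-reflexive (trans h₀ (sym h₁))) l)
    no-up y< l (_ , inj₂ (inj₁ l′))   = <⇒≱ y< l′
    no-up y< l (_ , inj₂ (inj₂ l′))   = <⇒≱ l′ (m≤n⇒m≤1+n l)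

    entrance : ∀ {a c} → Step a c → ¬ S a → S c → a ≡ b × c ≡ t₀
    entrance (→R {x} p) ¬Sa Sc = contradiction (≤-trans Sc (anti (n≤1+n x))) ¬Sa
    entrance (←L {x} {y} p) ¬Sa Sc with (x ≟ L) ×-dec (y ≟ 0)
    ... | yes (refl , refl) = refl , refl
    ... | no ¬e = contradiction (m≤n⇒m≤1+n (≮⇒≥ ¬Sa) , ¬e) p
    entrance (↑U _) ¬Sa Sc = contradiction (<-trans ≤-refl Sc) ¬Sa
    entrance (↓D p) ¬Sa Sc = contradiction ((λ { refl → <⇒≱ ≤-refl (S⇒x≤L Sc) }) , inj₂ (inj₁ (≮⇒≥ ¬Sa))) p

    -- The distance to `b` in the undirected grid, plus one for the arc from `b` to `t₀`.
    Φ : Pt → ℕ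
    Φ (x , y) = (suc L ∸ x) + suc y

    n∸m≤1+n∸1+m : ∀ n m → n ∸ m ≤ suc (n ∸ suc m)
    n∸m≤1+n∸1+m zero    zero    = z≤n
    n∸m≤1+n∸1+m zero    (suc m) = z≤n
    n∸m≤1+n∸1+m (suc n) zero    = ≤-refl
    n∸m≤1+n∸1+m (suc n) (suc m) = n∸m≤1+n∸1+m n m

    Φ-lipschitz : ∀ {a c} → Step a c → Φ a ≤ suc (Φ c)
    Φ-lipschitz (→R {x} {y} _) = +-monoˡ-≤ (suc y) (n∸m≤1+n∸1+m (suc L) x)
    Φ-lipschitz (←L {x} {y} _) = m≤n⇒m≤1+n (+-monoˡ-≤ (suc y) (∸-monoʳ-≤ (suc L) (n≤1+n x)))
    Φ-lipschitz (↑U {x} {y} _) = m≤n⇒m≤1+n (+-monoʳ-≤ (suc L ∸ x) (n≤1+n (suc y)))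
    Φ-lipschitz (↓D {x} {y} _) = ≤-reflexive (+-suc (suc L ∸ x) (suc y))

    Boundary Inner : Pt → Set
    Boundary (x , y) = y < h x × h (suc x) ≤ suc y
    Inner (x , y) = suc y < h (suc x)

    -- `d` counts the columns still to come. The boundary goes right if the next column is high
    -- enough and down otherwise. As columns up to `L` have height at least 2, it reaches row 0 only
    -- at `t₀`.
    boundary→t₀ : ∀ d y {x} → x + d ≡ L → Boundary (x , y) → Mono RD (x , y) t₀
    boundary→t₀ d y {x} e o@(y< , l) with y <? h (suc x)
    boundary→t₀ zero y {x} e (y< , l) | yes y<′ =
      contradiction (S⇒x≤L y<′) (<⇒≱ (s≤s (≤-reflexive (trans (sym e) (+-identityʳ x)))))
    boundary→t₀ (suc d) y {x} e (y< , l) | yes y<′ =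
      one (→R (l , λ { (refl , _) → m+1+n≢m x e })) rd→ (inS y<′) ▹
      boundary→t₀ d y (trans (sym (+-suc x d)) e) (y<′ , ≤-trans (anti (n≤1+n _)) l)
    boundary→t₀ d (suc y) {x} e (y< , l) | no y≮ =
      one (↓D (no-up y< (≮⇒≥ y≮))) rd↓ (inS (<-trans ≤-refl y<)) ▹ boundary→t₀ d y e (<-trans ≤-refl y< , ≮⇒≥ y≮)
    boundary→t₀ d zero {x} e (y< , l) | no y≮ with d
    ... | zero  rewrite trans (sym (+-identityʳ x)) e = mono-refl
    ... | suc d = contradiction (<-≤-trans (s≤s z≤n) (h≥2 (≤-trans (m<m+n x (s≤s z≤n)) (≤-reflexive e)))) y≮

    boundary-run : ∀ {x y} → Boundary (x , y) → Mono RD (x , y) t₀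
    boundary-run {x} {y} o = boundary→t₀ (L ∸ x) y (m+[n∸m]≡n (S⇒x≤L (proj₁ o))) o

    -- The boundary traced backwards; `e` counts the rows above y.
    τ→boundary : ∀ x e y → y + suc e ≡ m → Boundary (x , y) → Mono RD τ (x , y)
    τ→boundary x e y eq (y< , l) with suc y <? h x
    τ→boundary x zero y eq (y< , l) | yes y<′ =
      contradiction (≤-trans y<′ (h≤m x)) (<⇒≱ (s≤s (≤-reflexive (trans (sym eq) (+-comm y 1)))))
    τ→boundary x (suc e) y eq (y< , l) | yes y<′ =
      τ→boundary x e (suc y) (trans (sym (+-suc y (suc e))) eq) (y<′ , m≤n⇒m≤1+n l) ▹ one (↓D (no-up y<′ l)) rd↓ (inS y<)
    τ→boundary (suc x) e y eq (y< , l) | no y≮ =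
      τ→boundary x e y eq (≤-trans y< (anti (n≤1+n x)) , ≮⇒≥ y≮) ▹
      one (→R (≮⇒≥ y≮ , λ { (refl , _) → <⇒≱ ≤-refl (S⇒x≤L y<) })) rd→ (inS y<)
    τ→boundary zero e y eq (y< , l) | no y≮
      rewrite suc-injective (trans (≤-antisym (≤-trans y< (h≤m 0)) (≤-trans (≤-reflexive (sym h₀)) (≮⇒≥ y≮)))
                                   (sym (suc-pred m ⦃ >-nonZero (≤-trans (s≤s z≤n) 2≤m) ⦄))) = mono-refl

    boundary-run′ : ∀ {x y} → Boundary (x , y) → Mono RD τ (x , y)
    boundary-run′ {x} {y} o = τ→boundary x (m ∸ suc y) y
      (trans (+-suc y _) (m+[n∸m]≡n (proj₂ (inS (proj₁ o))))) o

    t₀→row : ∀ {x} → x ≤ L → Mono LU t₀ (x , 0)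
    t₀→row x≤ = left-run (inj₁ refl) x≤ (λ i _ i< r → <⇒≱ (h≥2 i<) (proj₁ r)) (inS (<-≤-trans (s≤s z≤n) (h≥2 ≤-refl)))

    column→τ : ∀ {y} → y < m → Mono LU (0 , y) τ
    column→τ y< = up-run (inj₂ refl) (pred-mono-≤ y<) (λ i _ _ → (λ ()) , inj₁ refl) τ-in

    boundary-steps : ∀ {x y} (o : Boundary (x , y)) → Mono.steps (boundary-run o) ≤ (L ∸ x) + y
    boundary-steps {x} {y} o = ≤-trans (m+n≤o⇒n≤o∸m x
      (≤-trans (+-monoˡ-≤ (Mono.steps (boundary-run o)) (≤-reflexive (sym (+-identityʳ x)))) (Mono.tight (boundary-run o))))
      (≤-reflexive (+-∸-comm y (S⇒x≤L (proj₁ o))))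

    -- Only boundary vertices have arcs out of `S`, and their monotone run to `t₀` is no longer than
    -- the way outside to `b` and through the entrance.
    exit : ∀ {a c} → Step a c → S a → ¬ S c → Σ[ k ∈ ℕ ] (Run a t₀ k × k ≤ Φ c)
    exit (→R {x} {y} _) Sa ¬Sc = _ , Mono.run (boundary-run o) ,
      ≤-trans (boundary-steps o) (+-monoʳ-≤ (L ∸ x) (n≤1+n y))
      where o = Sa , m≤n⇒m≤1+n (≮⇒≥ ¬Sc)
    exit (←L {x} _) Sa ¬Sc = contradiction (≤-trans Sa (anti (n≤1+n x))) ¬Sc
    exit (↑U {x} {y} _) Sa ¬Sc = _ , Mono.run (boundary-run o) ,
      ≤-trans (boundary-steps o) (+-mono-≤ (∸-monoˡ-≤ x (n≤1+n L)) (m≤n⇒m≤1+n (n≤1+n y)))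
      where o = Sa , ≤-trans (anti (n≤1+n x)) (≮⇒≥ ¬Sc)
    exit (↓D _) Sa ¬Sc = contradiction (<-trans ≤-refl Sa) ¬Sc

    shortcuts : Shortcuts S?
    shortcuts = single-entrance S? t₀ Φ
      (λ _ _ s ¬Sa Sc → let e , e′ = entrance s ¬Sa Sc in e′ , ≤-trans (≤-reflexive (cong Φ e)) (≤-reflexive (cong (_+ 1) (n∸n≡0 (suc L)))))
      (λ _ _ s _ _ → Φ-lipschitz s) (λ _ _ → exit)

    last-cell : ∀ x {y} → y < m → h x ≤ y → Σ[ i ∈ ℕ ] (i < x × y < h i × h (suc i) ≤ y)
    last-cell zero    y< l = contradiction (≤-trans y< (≤-reflexive (sym h₀))) (≤⇒≯ l)
    last-cell (suc x) {y} y< l with y <? h x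
    ... | yes y<′ = x , ≤-refl , y<′ , l
    ... | no y≮ = let i , i< , r = last-cell x y< (≮⇒≥ y≮) in i , m<n⇒m<1+n i< , r

    module _ {T : Pt → Set} (hull : Hull T) where
      open Hull hull

      -- Three families of monotone runs cover the grid: from `τ` to `t₀` along the boundary; from
      -- `t₀` to `τ` by going left, up, left and up through an inner vertex; and from the boundary
      -- to the right and then down the last column to `b`.
      fill : T b → T t₀ → T τ → ∀ a → InB a → T a
      fill Tb Tt Tτ = all
        where
        boundary : ∀ {x y} → Boundary (x , y) → T (x , y)
        boundary o = between hull RD Tτ Tt (boundary-run′ o) (boundary-run o)
        all : ∀ a → InB a → T a
        all (x , y) (x< , y<) with y <? h x
        all (x , y) (x< , y<) | yes Sa with suc y <? h (suc x)
        ... | no ¬i = boundary (Sa , ≮⇒≥ ¬i)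
        ... | yes i = between hull LU Tt Tτ
          (t₀→row x≤L ▹ up-run (inj₂ refl) z≤n
            (λ j _ j< → (λ { refl → <⇒≱ ≤-refl x≤L }) , inj₂ (inj₂ (<-≤-trans (s≤s (s≤s j<)) i))) (inS Sa))
          (left-run (inj₁ refl) z≤n (λ j _ j< r → <⇒≱ (<-≤-trans i (anti (s≤s (<⇒≤ j<)))) (proj₁ r)) (inS Sa) ▹ column→τ y<)
          where x≤L = ≤-trans (n≤1+n x) (S⇒x≤L (<-trans ≤-refl i))
        all (x , zero) (x< , y<) | no ¬Sa with x ≤? L
        ... | yes x≤ = contradiction (<-≤-trans (s≤s z≤n) (h≥2 x≤)) ¬Sa
        ... | no x≰ rewrite ≤-antisym (≤-pred x<) (≰⇒> x≰) = Tb
        all (x , suc y) (x< , y<) | no ¬Sa with last-cell x y< (≮⇒≥ ¬Sa)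
        ... | i , i<x , y<h , l = between hull RD (boundary (y<h , m≤n⇒m≤1+n l)) Tb
          (right-run (inj₂ refl) (<⇒≤ i<x) (λ j p _ → rt j p) (x< , y<))
          (right-run (inj₂ refl) (≤-pred x<) (λ j p _ → rt j (≤-trans (<⇒≤ i<x) p)) (≤-refl , y<) ▹
            down-run (inj₁ refl) z≤n (λ _ _ _ u → proj₁ u refl) (≤-refl , y<))
          where
          rt : ∀ j → i ≤ j → Right j (suc y)
          rt j p = m≤n⇒m≤1+n (≤-trans (anti (s≤s p)) l) , λ ()

      meets-b : ∀ {c d} → T c → ¬ S c → T d → S d → T b × T t₀
      meets-b Tc ¬Sc Td Sd with cross (λ a → ¬? (S? a)) Tc ¬Sc (λ ¬Sd → ¬Sd Sd) (conn Tc Td)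
      ... | c , d , Tc , ¬Sc , Td , ¬¬Sd , s , _ with entrance s ¬Sc (decidable-stable (S? d) ¬¬Sd)
      ...   | refl , refl = Tc , Td

      -- On the way from `t₀` to `b` the hull has to leave the region formed by `t₀` and the inner
      -- vertices, and every arc out of this region ends in `τ`.
      meets-τ : T b → T t₀ → T τ
      meets-τ Tb Tt with cross {A = λ a → a ≡ t₀ ⊎ Inner a} (λ a → ≡-dec _≟_ _≟_ a t₀ ⊎-dec inner? a) Tt (inj₁ refl)
        (λ { (inj₁ e) → 1+n≢n (cong proj₁ e) ; (inj₂ i) → contradiction (≤-trans i (≤-trans (anti (n≤1+n _)) (≤-reflexive h-last))) λ () }) (conn Tt Tb)
        where
        inner? : ∀ a → Dec (Inner a)
        inner? (x , y) = suc y <? h (suc x)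
      ... | c , d , Tc , Ac , Td , ¬Ad , s , id = subst T (leave s Ac ¬Ad) Td
        where
        leave : ∀ {c d} → Step c d → c ≡ t₀ ⊎ Inner c → ¬ (d ≡ t₀ ⊎ Inner d) → d ≡ τ
        leave (→R (l , ne)) (inj₁ refl) _ = contradiction (refl , refl) ne
        leave (→R (l , _)) (inj₂ i) _ = contradiction i (≤⇒≯ l)
        leave (←L {x} _) (inj₁ refl) ¬A = contradiction (inj₂ (h≥2 ≤-refl)) ¬A
        leave (←L {x} _) (inj₂ i) ¬A = contradiction (inj₂ (≤-trans i (anti (n≤1+n _)))) ¬A
        leave (↑U u) (inj₁ refl) _ = contradiction u (no-up (h≥2 ≤-refl) (≤-trans (≤-reflexive h-last) z≤n))
        leave (↑U (_ , inj₁ refl)) (inj₂ i) ¬A =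
          cong (0 ,_) (cong pred (≤-antisym (≤-trans i (h≤m 1)) (≤-trans (≤-reflexive (sym h₁)) (≮⇒≥ (¬A ∘ inj₂)))))
        leave (↑U {x} (_ , inj₂ (inj₁ l))) (inj₂ i) _ = contradiction (<-≤-trans i (anti (n≤1+n x))) (≤⇒≯ l)
        leave (↑U (_ , inj₂ (inj₂ l))) (inj₂ _) ¬A = contradiction (inj₂ l) ¬A
        leave (↓D _) (inj₂ i) ¬A = contradiction (inj₂ (<-trans ≤-refl i)) ¬A

      -- Outside S the walks run to the right and upwards, then down the last column.
      ψ : Pt → ℕ
      ψ (x , y) with x ≟ suc L
      ... | yes _ = suc (L + m) + (m ∸ y)
      ... | no _  = x + y

      ψ-increasing : ∀ {c d} → InB c → InB d → Step c d → ¬ S c → ¬ S d → ψ c < ψ d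
      ψ-increasing {x , y} ic id (→R _) _ _ with x ≟ suc L | suc x ≟ suc L
      ... | yes refl | _     = contradiction (proj₁ id) (<⇒≱ ≤-refl)
      ... | no _     | yes e = s≤s (≤-trans (+-mono-≤ (≤-reflexive (suc-injective e)) (<⇒≤ (proj₂ ic))) (m≤m+n _ _))
      ... | no _     | no _  = ≤-refl
      ψ-increasing ic id (←L {x} {y} p) ¬Sc ¬Sd =
        contradiction (m≤n⇒m≤1+n (≮⇒≥ ¬Sc) , λ { (refl , refl) → ¬Sd (<-≤-trans (s≤s z≤n) (h≥2 ≤-refl)) }) p
      ψ-increasing ic id (↑U {x} {y} (x≢ , _)) _ _ with x ≟ suc L
      ... | yes e = contradiction e x≢
      ... | no _  = ≤-reflexive (sym (+-suc x y))
      ψ-increasing ic id (↓D {x} {y} p) ¬Sc _ with x ≟ suc L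
      ... | yes _ = +-monoʳ-< (suc (L + m)) (∸-monoʳ-< ≤-refl (<⇒≤ (proj₂ ic)))
      ... | no x≢ = contradiction (x≢ , inj₂ (inj₁ (≮⇒≥ ¬Sc))) p

      meets-S : ∀ {c d} → T c → ¬ S c → T d → c ≢ d → Σ[ e ∈ Pt ] (T e × S e)
      meets-S Tc ¬Sc Td ne with escape hull (λ a → ¬? (S? a)) ψ ψ-increasing Tc ¬Sc Td ne
      ... | e , Te , ¬¬Se = e , Te , decidable-stable (S? e) ¬¬Se

    t₀-in : InB t₀
    t₀-in = inS (<-≤-trans (s≤s z≤n) (h≥2 ≤-refl))

    b-in : InB b
    b-in = ≤-refl , ≤-trans (s≤s z≤n) 2≤m

    ¬Sb : ¬ S b
    ¬Sb Sb = contradiction (≤-trans Sb (≤-reflexive h-last)) λ ()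

    strong : Strong D
    strong = hull⇒strong {t₀} {b} t₀-in
      (_ , Mono.run (t₀→row z≤n ▹ column→τ (≤-trans (s≤s z≤n) 2≤m)) ++ Mono.run (boundary-run′ κ) ++
        (→R (proj₂ κ , λ ()) ∷⟨ ≤-refl , 2≤m ⟩ (↓D (λ u → proj₁ u refl) ∷⟨ b-in ⟩ [])))
      (_ , ←L (λ r → proj₂ r (refl , refl)) ∷⟨ t₀-in ⟩ [])
      (λ hull Tt Tb → fill hull Tb Tt (meets-τ hull Tb Tt))
      where
      κ : Boundary (L , 1)
      κ = h≥2 ≤-refl , ≤-trans (≤-reflexive h-last) z≤n

    staircase-spectrum : StrongConvexitySpectrum (P (suc (suc L)) □ P m) (sum (suc (suc L)) h)
    staircase-spectrum = subst (StrongConvexitySpectrum _)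
      (∣sub∣ S? (λ _ → 0) h (λ x _ → z≤n , h≤m x) (λ _ _ y< → y<) (λ _ _ y< → z≤n , y<))
      (spectrum S? strong shortcuts (t₀ , t₀-in , <-≤-trans (s≤s z≤n) (h≥2 ≤-refl)) (b , b-in , ¬Sb)
        λ hull _ Tc ¬Sc Td ne →
          let e , Te , Se = meets-S hull Tc ¬Sc Td ne
              Tb , Tt = meets-b hull Tc ¬Sc Te Se
          in inj₁ (fill hull Tb Tt (meets-τ hull Tb Tt)))

-- Height profiles of staircases.

module Heights where

  open Core
  open GridD
  open Count
  open Stair
  open import Data.Nat.Base using (ℕ; zero; suc; _+_; _*_; _≤_; _<_; z≤n; s≤s)
  open import Data.Nat.Properties
  open import Data.Nat.Tactic.RingSolver using (solve-∀)
  open import Data.Product.Base using (_,_)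
  open import Function.Base using (_∘_)
  open import Relation.Binary.PropositionalEquality using (_≡_; refl; sym; trans; cong; subst)

  Antitone : (ℕ → ℕ) → Set
  Antitone g = ∀ {x x′} → x ≤ x′ → g x′ ≤ g x

  infixr 5 _times_then_

  _times_then_ : ℕ → ℕ → (ℕ → ℕ) → ℕ → ℕ
  (zero  times a then g) x       = g x
  (suc k times a then g) zero    = a
  (suc k times a then g) (suc x) = (k times a then g) x

  then-head : ∀ k {a g} → g 0 ≤ a → (k times a then g) 0 ≤ a
  then-head zero    l = l
  then-head (suc k) l = ≤-refl

  then-antitone : ∀ k {a g} → g 0 ≤ a → Antitone g → Antitone (k times a then g)
  then-antitone zero    l an p = an p
  then-antitone (suc k) l an {zero}  {zero}   p = ≤-refl
  then-antitone (suc k) l an {zero}  {suc x′} p = ≤-trans (then-antitone k l an {0} {x′} z≤n) (then-head k l)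
  then-antitone (suc k) l an {suc x} {suc x′} (s≤s p) = then-antitone k l an p

  then-skip : ∀ k {a g} i → (k times a then g) (k + i) ≡ g i
  then-skip zero    i = refl
  then-skip (suc k) i = then-skip k i

  then-≥ : ∀ k {a g c} l → c ≤ a → (∀ {i} → i < l → c ≤ g i) → ∀ {x} → x < k + l → c ≤ (k times a then g) x
  then-≥ zero    l ca cg x<             = cg x<
  then-≥ (suc k) l ca cg {zero}  x<       = ca
  then-≥ (suc k) l ca cg {suc x} (s≤s x<) = then-≥ k l ca cg x<

  then-< : ∀ k {a g x} → x < k → (k times a then g) x ≡ a
  then-< (suc k) {x = zero}  x<       = refl
  then-< (suc k) {x = suc x} (s≤s x<) = then-< k x<

  sum-then : ∀ k n {a g} → sum (k + n) (k times a then g) ≡ k * a + sum n g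
  sum-then zero    n = refl
  sum-then (suc k) n {a} = trans (cong (a +_) (sum-then k n)) (sym (+-assoc a (k * a) _))

  module _ (k j e m : ℕ) (2≤j : 2 ≤ j) (j≤m : j ≤ m) where
    private
      h₂ h : ℕ → ℕ
      h₂ = 1 times j then e times 2 then (λ _ → 0)
      h  = suc (suc k) times m then h₂

      h₂-antitone : Antitone h₂
      h₂-antitone = then-antitone 1 (≤-trans (then-head e z≤n) 2≤j) (then-antitone e z≤n (λ _ → z≤n))

    -- Height 2 is the least that works for a column of `S`: row 1 then carries the boundary to the
    -- right and row 0 the way back from `t₀`.
    staircase : StrongConvexitySpectrum (P (suc (suc (suc (suc k + e)))) □ P m) (suc (suc k) * m + (j + e * 2))
    staircase = subst (StrongConvexitySpectrum _) total
      (Staircase.staircase-spectrum (suc (suc (k + e))) m h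
        (then-antitone (suc (suc k)) j≤m h₂-antitone) refl refl
        (λ x≤ → then-≥ (suc (suc k)) (suc e) (≤-trans 2≤j j≤m)
          (then-≥ 1 e 2≤j (then-≥ e 0 ≤-refl (λ ()) ∘ subst (_ <_) (sym (+-identityʳ e))))
          (≤-trans (s≤s x≤) (≤-reflexive (sym (+-suc (suc (suc k)) e)))))
        last)
      where
      last : h (suc (suc (suc (k + e)))) ≡ 0
      last = trans (cong h (sym (+-suc (suc (suc k)) e))) (trans (then-skip (suc (suc k)) (suc e))
               (trans (cong (e times 2 then (λ _ → 0)) (sym (+-identityʳ e))) (then-skip e 0)))
      total : sum (suc (suc (suc (suc k + e)))) h ≡ suc (suc k) * m + (j + e * 2)
      total = trans (cong (λ i → sum i h) (rearrange k e)) (trans (sum-then (suc (suc k)) (suc (e + 1)) {m} {h₂})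
        (cong (suc (suc k) * m +_) (cong (j +_) (trans (sum-then e 1 {2} {λ _ → 0}) (+-identityʳ (e * 2))))))
        where
        rearrange : ∀ k e → suc (suc (suc (suc k + e))) ≡ suc (suc k) + suc (e + 1)
        rearrange = solve-∀

-- Complements next to a corner.

module Corner where

  open Core
  open GridD
  open Count
  open import Data.Fin.Subset using (∣_∣; ∁)
  open import Data.Fin.Subset.Properties using (∣∁p∣≡n∸∣p∣)
  open import Data.Nat.Base using (ℕ; zero; suc; _+_; _*_; _∸_; _≤_; _<_; z≤n; s≤s)
  open import Data.Nat.Properties
  open import Data.Nat.Tactic.RingSolver using (solve-∀)
  open import Data.Product.Base using (Σ-syntax; ∃-syntax; _×_; _,_; proj₁)
  open import Data.Sum.Base using (_⊎_; inj₁; inj₂)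
  open import Data.Empty using (⊥)
  open import Data.Unit.Base using (⊤; tt)
  open import Relation.Binary.PropositionalEquality using (_≡_; _≢_; refl; sym; trans; cong; cong₂; subst)
  open import Relation.Nullary using (¬_; Dec; yes; no; contradiction)
  open import Relation.Nullary.Decidable using (_×-dec_; _⊎-dec_; ¬?)

  -- The complement of S consists of r cells of column 0 and three cells of column 1.
  module SmallCorner (ν μ r : ℕ) (3≤r : 3 ≤ r) (r+1<μ : suc r < μ) where
    N n m : ℕ
    N = suc (suc (suc ν))
    n = suc N
    m = suc μ

    -- The flow in `S` runs from `t₀` right and up to `τ`, left along the top row and down column 0
    -- to `ω`. From there a lane leads back: across to column 1, down to row 3, across to column 2
    -- and down to `t₀`.
    Right Up S : Pt → Set
    Right (0 , y)           = y ≢ μ × (y ≡ 0 ⊎ y ≡ 2 ⊎ r ≤ y)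
    Right (1 , y)           = y ≢ μ × (y ≡ 0 ⊎ 3 ≤ y)
    Right (suc (suc x) , y) = y ≢ μ
    Up (0 , y)                 = y ≡ 1
    Up (1 , y)                 = y ≡ 0 ⊎ (r ≤ y × suc y < μ)
    Up (2 , y)                 = 3 ≤ y × suc y < μ
    Up (suc (suc (suc x)) , y) = suc y < μ ⊎ x ≡ ν
    S (0 , y)           = r ≤ y
    S (1 , y)           = 3 ≤ y
    S (suc (suc x) , y) = ⊤

    right? : ∀ x y → Dec (Right (x , y))
    right? 0             y = ¬? (y ≟ μ) ×-dec ((y ≟ 0) ⊎-dec ((y ≟ 2) ⊎-dec (r ≤? y)))
    right? 1             y = ¬? (y ≟ μ) ×-dec ((y ≟ 0) ⊎-dec (3 ≤? y))
    right? (suc (suc x)) y = ¬? (y ≟ μ)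

    up? : ∀ x y → Dec (Up (x , y))
    up? 0                   y = y ≟ 1
    up? 1                   y = (y ≟ 0) ⊎-dec ((r ≤? y) ×-dec (suc y <? μ))
    up? 2                   y = (3 ≤? y) ×-dec (suc y <? μ)
    up? (suc (suc (suc x))) y = (suc y <? μ) ⊎-dec (x ≟ ν)

    S? : ∀ a → Dec (S a)
    S? (0 , y)           = r ≤? y
    S? (1 , y)           = 3 ≤? y
    S? (suc (suc x) , y) = yes tt

    open OrientedGrid n m right? up?

    t₀ b τ ω : Pt
    t₀ = 2 , 0
    b  = 1 , 0
    τ  = N , μ
    ω  = 0 , r

    5≤μ : 5 ≤ μ
    5≤μ = ≤-trans (s≤s (s≤s 3≤r)) r+1<μ

    r<μ : r < μ
    r<μ = <-trans ≤-refl r+1<μ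

    entrance : ∀ {a c} → Step a c → ¬ S a → S c → a ≡ b × c ≡ t₀
    entrance (→R {0} (_ , inj₁ refl)) ¬Sa ()
    entrance (→R {0} (_ , inj₂ (inj₁ refl))) ¬Sa (s≤s (s≤s ()))
    entrance (→R {0} (_ , inj₂ (inj₂ l))) ¬Sa Sc = contradiction l ¬Sa
    entrance (→R {1} (_ , inj₁ refl)) ¬Sa Sc = refl , refl
    entrance (→R {1} (_ , inj₂ l)) ¬Sa Sc = contradiction l ¬Sa
    entrance (→R {suc (suc x)} _) ¬Sa Sc = contradiction tt ¬Sa
    entrance (←L {0} _) ¬Sa Sc = contradiction (≤-trans 3≤r Sc) ¬Sa
    entrance (←L {suc x} _) ¬Sa Sc = contradiction tt ¬Sa
    entrance (↑U {0} refl) ¬Sa Sc = contradiction (≤-trans 3≤r Sc) λ { (s≤s (s≤s ())) }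
    entrance (↑U {1} (inj₁ refl)) ¬Sa (s≤s ())
    entrance (↑U {1} (inj₂ (l , _))) ¬Sa Sc = contradiction (≤-trans 3≤r l) ¬Sa
    entrance (↑U {suc (suc x)} _) ¬Sa Sc = contradiction tt ¬Sa
    entrance (↓D {0} _) ¬Sa Sc = contradiction (m≤n⇒m≤1+n Sc) ¬Sa
    entrance (↓D {1} _) ¬Sa Sc = contradiction (m≤n⇒m≤1+n Sc) ¬Sa
    entrance (↓D {suc (suc x)} _) ¬Sa Sc = contradiction tt ¬Sa

    -- The complement is folded into a snake: down column 0 to row 2, then (1 , 2), (1 , 1), (0 ,
    -- 1), (0 , 0), (1 , 0) and out to `t₀`. `Φ` counts the steps that remain. Without the fold the
    -- way down column 0 and along row 0 would be monotone and hence a geodesic.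
    Φ : Pt → ℕ
    Φ (0 , 0)                 = 2
    Φ (0 , 1)                 = 3
    Φ (0 , 2)                 = 6
    Φ (0 , suc (suc (suc y))) = y + 7
    Φ (1 , 0)                 = 1
    Φ (1 , 1)                 = 4
    Φ (1 , 2)                 = 5
    Φ _                       = 0

    0≢μ : 0 ≢ μ
    0≢μ = <⇒≢ (≤-trans (s≤s z≤n) 5≤μ)

    2≢μ : 2 ≢ μ
    2≢μ = <⇒≢ (≤-trans (s≤s (s≤s (s≤s z≤n))) 5≤μ)

    Φ-lipschitz : ∀ {a c} → Step a c → ¬ S a → ¬ S c → Φ a ≤ suc (Φ c)
    Φ-lipschitz (→R {0} (_ , inj₁ refl)) _ _ = ≤-refl
    Φ-lipschitz (→R {0} (_ , inj₂ (inj₁ refl))) _ _ = ≤-refl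
    Φ-lipschitz (→R {0} (_ , inj₂ (inj₂ l))) ¬Sa _ = contradiction l ¬Sa
    Φ-lipschitz (→R {suc x} _) _ ¬Sc = contradiction tt ¬Sc
    Φ-lipschitz (←L {0} {0} p) _ _ = contradiction (0≢μ , inj₁ refl) p
    Φ-lipschitz (←L {0} {1} p) _ _ = ≤-refl
    Φ-lipschitz (←L {0} {2} p) _ _ = contradiction (2≢μ , inj₂ (inj₁ refl)) p
    Φ-lipschitz (←L {0} {suc (suc (suc y))} _) ¬Sa _ = contradiction (s≤s (s≤s (s≤s z≤n))) ¬Sa
    Φ-lipschitz (←L {suc x} _) ¬Sa _ = contradiction tt ¬Sa
    Φ-lipschitz (↑U {0} refl) _ _ = s≤s (s≤s (s≤s z≤n))
    Φ-lipschitz (↑U {1} (inj₁ refl)) _ _ = s≤s z≤n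
    Φ-lipschitz (↑U {1} (inj₂ (l , _))) ¬Sa _ = contradiction (≤-trans 3≤r l) ¬Sa
    Φ-lipschitz (↑U {suc (suc x)} _) ¬Sa _ = contradiction tt ¬Sa
    Φ-lipschitz (↓D {0} {0} _) _ _ = ≤-refl
    Φ-lipschitz (↓D {0} {1} p) _ _ = contradiction refl p
    Φ-lipschitz (↓D {0} {2} _) _ _ = ≤-refl
    Φ-lipschitz (↓D {0} {suc (suc (suc y))} _) _ _ = ≤-refl
    Φ-lipschitz (↓D {1} {0} p) _ _ = contradiction (inj₁ refl) p
    Φ-lipschitz (↓D {1} {1} _) _ _ = ≤-refl
    Φ-lipschitz (↓D {1} {suc (suc y)} _) ¬Sa _ = contradiction (s≤s (s≤s (s≤s z≤n))) ¬Sa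
    Φ-lipschitz (↓D {suc (suc x)} _) ¬Sa _ = contradiction tt ¬Sa

    in₀ : ∀ {y} → y ≤ μ → InB (0 , y)
    in₀ l = s≤s z≤n , s≤s l
    in₁ : ∀ {y} → y ≤ μ → InB (1 , y)
    in₁ l = s≤s (s≤s z≤n) , s≤s l
    in₂ : ∀ {y} → y ≤ μ → InB (2 , y)
    in₂ l = s≤s (s≤s (s≤s z≤n)) , s≤s l
    in-N : ∀ {y} → y ≤ μ → InB (N , y)
    in-N l = ≤-refl , s≤s l

    3≤μ : 3 ≤ μ
    3≤μ = ≤-trans (s≤s (s≤s (s≤s z≤n))) 5≤μ

    lane₂ : ∀ {y} → y ≤ 3 → Mono RD (2 , y) t₀
    lane₂ y≤ = down-run (inj₁ refl) z≤n (λ i _ i< u → <⇒≱ (<-≤-trans i< y≤) (proj₁ u)) (in₂ (≤-trans y≤ 3≤μ))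

    lane₃ : ∀ {y} → y ≤ 3 → Mono RD (2 , 3) (2 , y)
    lane₃ y≤ = down-run (inj₁ refl) y≤ (λ i _ i< u → <⇒≱ i< (proj₁ u)) (in₂ 3≤μ)

    lane₁ : ∀ {y y′} → 3 ≤ y → y ≤ y′ → y′ ≤ r → Mono RD (1 , y′) (1 , y)
    lane₁ 3≤y y≤ y≤r = down-run (inj₁ refl) y≤
      (λ { i 3≤i i< (inj₁ refl) → contradiction (≤-trans 3≤y 3≤i) λ () ; i _ i< (inj₂ (l , _)) → <⇒≱ (<-≤-trans i< y≤r) l })
      (in₁ (≤-trans y≤r (<⇒≤ r<μ)))

    turn : Mono RD (1 , 3) (2 , 3)
    turn = one (→R ((λ { refl → <⇒≱ 5≤μ (n≤1+n 3) }) , inj₂ ≤-refl)) rd→ (in₂ 3≤μ)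

    turn₀ : Mono RD ω (1 , r)
    turn₀ = one (→R (<⇒≢ r<μ , inj₂ (inj₂ ≤-refl))) rd→ (in₁ (<⇒≤ r<μ))

    lane : ∀ {y} → 3 ≤ y → y ≤ r → Mono RD (1 , y) t₀
    lane 3≤y y≤r = lane₁ ≤-refl 3≤y y≤r ▹ turn ▹ lane₂ ≤-refl

    exit : ∀ {a c} → Step a c → S a → ¬ S c → Σ[ k ∈ ℕ ] (Run a t₀ k × k ≤ Φ c)
    exit (→R {0} _) Sa ¬Sc = contradiction (≤-trans 3≤r Sa) ¬Sc
    exit (→R {suc x} _) Sa ¬Sc = contradiction tt ¬Sc
    exit (←L {0} {suc (suc (suc y))} _) Sa ¬Sc = _ , Mono.run p ,
      ≤-trans (≤-pred (Mono.tight p)) (≤-trans (≤-reflexive (+-comm 4 y)) (+-monoʳ-≤ y (s≤s (s≤s (s≤s (s≤s z≤n))))))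
      where p = lane Sa (<⇒≤ (≰⇒> ¬Sc))
    exit (←L {0} {suc (suc zero)} _) (s≤s (s≤s ())) ¬Sc
    exit (←L {0} {suc zero} _) (s≤s ()) ¬Sc
    exit (←L {1} {0} p) Sa ¬Sc = contradiction (0≢μ , inj₁ refl) p
    exit (←L {1} {1} p) Sa ¬Sc = _ , Mono.run q , ≤-trans (≤-pred (≤-pred (Mono.tight q))) (s≤s z≤n)
      where q = lane₂ {1} (s≤s z≤n)
    exit (←L {1} {2} p) Sa ¬Sc = _ , Mono.run q , ≤-trans (≤-pred (≤-pred (Mono.tight q))) (s≤s (s≤s z≤n))
      where q = lane₂ {2} (s≤s (s≤s z≤n))
    exit (←L {1} {suc (suc (suc y))} p) Sa ¬Sc = contradiction (s≤s (s≤s (s≤s z≤n))) ¬Sc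
    exit (←L {suc (suc x)} _) Sa ¬Sc = contradiction tt ¬Sc
    exit (↑U {0} _) Sa ¬Sc = contradiction (m≤n⇒m≤1+n Sa) ¬Sc
    exit (↑U {1} _) Sa ¬Sc = contradiction (m≤n⇒m≤1+n Sa) ¬Sc
    exit (↑U {suc (suc x)} _) Sa ¬Sc = contradiction tt ¬Sc
    exit (↓D {0} {y} _) Sa ¬Sc = _ , Mono.run p , ≤-trans (Mono.tight p) (le y (subst (3 ≤_) e 3≤r))
      where
      e = ≤-antisym Sa (≰⇒> ¬Sc)
      p = subst (λ i → Mono RD (0 , i) t₀) e (turn₀ ▹ lane 3≤r ≤-refl)
      le : ∀ y → 3 ≤ suc y → 3 + y ≤ Φ (0 , y)
      le 1 (s≤s (s≤s ()))
      le 2 _ = n≤1+n 5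
      le (suc (suc (suc y))) _ = ≤-trans (≤-reflexive (+-comm 6 y)) (+-monoʳ-≤ y (n≤1+n 6))
    exit (↓D {1} {0} _) (s≤s ()) ¬Sc
    exit (↓D {1} {1} _) (s≤s (s≤s ())) ¬Sc
    exit (↓D {1} {2} _) Sa ¬Sc = _ , Mono.run p , ≤-trans (≤-pred (Mono.tight p)) (n≤1+n 4)
      where p = lane ≤-refl 3≤r
    exit (↓D {1} {suc (suc (suc y))} _) Sa ¬Sc = contradiction (s≤s (s≤s (s≤s z≤n))) ¬Sc
    exit (↓D {suc (suc x)} _) Sa ¬Sc = contradiction tt ¬Sc

    shortcuts : Shortcuts S?
    shortcuts = single-entrance S? t₀ Φ
      (λ _ _ s ¬Sa Sc → let e , e′ = entrance s ¬Sa Sc in e′ , ≤-reflexive (cong Φ e))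
      (λ _ _ → Φ-lipschitz) (λ _ _ → exit)

    τ-in : InB τ
    τ-in = in-N ≤-refl

    top-row : ∀ {x} → x ≤ N → Mono LD τ (x , μ)
    top-row x≤ = left-run (inj₂ refl) x≤ (λ { 0 _ _ r → proj₁ r refl ; 1 _ _ r → proj₁ r refl ; (suc (suc _)) _ _ r → r refl }) τ-in

    top-row′ : ∀ {x x′} → x ≤ x′ → x′ ≤ N → Mono LD (x′ , μ) (x , μ)
    top-row′ x≤ x′≤ = left-run (inj₂ refl) x≤ (λ { 0 _ _ r → proj₁ r refl ; 1 _ _ r → proj₁ r refl ; (suc (suc _)) _ _ r → r refl }) (s≤s x′≤ , ≤-refl)

    left-column : ∀ {y y′} → r ≤ y → y ≤ y′ → y′ ≤ μ → Mono LD (0 , y′) (0 , y)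
    left-column r≤ y≤ y′≤ = down-run (inj₂ refl) y≤ (λ { i p _ refl → <⇒≱ (s≤s (s≤s z≤n)) (≤-trans 3≤r (≤-trans r≤ p)) }) (in₀ y′≤)

    row→τ : ∀ {x y} → x < n → y < μ → (∀ i → x ≤ i → Right (i , y)) → Mono RU (x , y) τ
    row→τ x< y< f = right-run (inj₁ refl) (≤-pred x<) (λ i p _ → f i p) (in-N (<⇒≤ y<)) ▹
      up-run (inj₁ refl) (<⇒≤ y<) (λ _ _ _ → inj₂ refl) τ-in

    right₂ : ∀ {y} → y < μ → ∀ i → 2 ≤ i → Right (i , y)
    right₂ y< (suc (suc i)) _ = <⇒≢ y<
    right₂ y< (suc zero) (s≤s ())

    right₁ : ∀ {y} → 3 ≤ y → y < μ → ∀ i → 1 ≤ i → Right (i , y)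
    right₁ l y< 1 _ = <⇒≢ y< , inj₂ l
    right₁ l y< (suc (suc i)) _ = <⇒≢ y<

    t₀→column : ∀ {x} → 2 ≤ x → x < n → Mono RU t₀ (x , 0)
    t₀→column 2≤x x< = right-run (inj₁ refl) 2≤x (λ i p _ → right₂ (≤-trans (s≤s z≤n) 5≤μ) i p) (x< , s≤s z≤n)

    module _ {T : Pt → Set} (hull : Hull T) where
      open Hull hull

      -- The last vertices of the snake, up to (0 , 1), have a single in-neighbour each, so
      -- connectivity forces the snake into the hull backwards as far as (1 , 1). All other vertices
      -- lie on geodesics: two-step paths, monotone runs between `t₀`, `τ`, `ω` or vertices of the
      -- lane, and runs from the lane into column 0.
      fill : T b → T t₀ → T τ → T ω → ∀ a → InB a → T a
      fill Tb Tt Tτ Tω = all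
        where
        T₁ : ∀ {y} → 3 ≤ y → y ≤ r → T (1 , y)
        T₁ p q = between hull RD Tω Tt (turn₀ ▹ lane₁ p q ≤-refl) (lane p q)
        T₂ : ∀ {y} → y ≤ 3 → T (2 , y)
        T₂ p = between hull RD Tω Tt (turn₀ ▹ lane₁ ≤-refl 3≤r ≤-refl ▹ turn ▹ lane₃ p) (lane₂ p)
        before-b : ∀ {c} → T c → Step c b → c ≡ (0 , 0)
        before-b _ (→R _) = refl
        before-b _ (←L p) = contradiction (0≢μ , inj₁ refl) p
        before-b _ (↓D p) = contradiction (inj₁ refl) p
        before-00 : ∀ {c} → T c → Step c (0 , 0) → c ≡ (0 , 1)
        before-00 _ (←L p) = contradiction (0≢μ , inj₁ refl) p
        before-00 _ (↓D p) = refl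
        before-01 : ∀ {c} → T c → Step c (0 , 1) → c ≡ (1 , 1)
        before-01 _ (←L p) = refl
        before-01 _ (↓D p) = contradiction refl p
        T00 : T (0 , 0)
        T00 with predecessor (λ ()) Tt (conn Tt Tb)
        ... | _ , Tc , s = subst T (before-b Tc s) Tc
        T01 : T (0 , 1)
        T01 with predecessor (λ ()) Tt (conn Tt T00)
        ... | _ , Tc , s = subst T (before-00 Tc s) Tc
        T11 : T (1 , 1)
        T11 with predecessor (λ ()) Tt (conn Tt T01)
        ... | _ , Tc , s = subst T (before-01 Tc s) Tc
        T12 : T (1 , 2)
        T12 = middle hull (T₁ ≤-refl 3≤r) T11 (λ ())
          (↓D λ { (inj₁ ()) ; (inj₂ (l , _)) → <⇒≱ 3≤r l }) (in₁ (≤-trans (n≤1+n 2) 3≤μ))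
          (↓D λ { (inj₁ ()) ; (inj₂ (l , _)) → <⇒≱ (≤-trans (n≤1+n 2) 3≤r) l }) (in₁ (≤-trans (s≤s z≤n) 3≤μ))
        T02 : T (0 , 2)
        T02 = middle hull T01 T12 (λ ()) (↑U refl) (in₀ (≤-trans (n≤1+n 2) 3≤μ)) (→R (2≢μ , inj₂ (inj₁ refl))) (in₁ (≤-trans (n≤1+n 2) 3≤μ))
        all : ∀ a → InB a → T a
        all (0 , y) (x< , y<) with r ≤? y
        ... | yes r≤ = between hull LD Tτ Tω (top-row z≤n ▹ left-column r≤ (≤-pred y<) ≤-refl) (left-column ≤-refl r≤ (≤-pred y<))
        all (0 , 0) _ | no _ = T00
        all (0 , 1) _ | no _ = T01
        all (0 , 2) _ | no _ = T02
        all (0 , y@(suc (suc (suc _)))) (x< , y<) | no r≰ = between hull LD (T₁ 3≤y (<⇒≤ y<r)) T02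
          (one (←L λ { (_ , inj₁ ()) ; (_ , inj₂ (inj₁ ())) ; (_ , inj₂ (inj₂ l)) → r≰ l }) ld← (in₀ (≤-pred y<)))
          (down-run (inj₂ refl) (≤-trans (n≤1+n 2) 3≤y) (λ { i (s≤s ()) _ refl }) (in₀ (≤-pred y<)))
          where
          y<r = ≰⇒> r≰
          3≤y : 3 ≤ y
          3≤y = s≤s (s≤s (s≤s z≤n))
        all (1 , 0) _ = Tb
        all (1 , 1) _ = T11
        all (1 , 2) _ = T12
        all (1 , y@(suc (suc (suc _)))) (x< , y<) with y ≤? r
        ... | yes l = T₁ (s≤s (s≤s (s≤s z≤n))) l
        ... | no r≱ with m≤n⇒m<n∨m≡n (≤-pred y<)
        ...   | inj₂ refl = between hull LD Tτ Tω (top-row (s≤s z≤n)) (top-row′ z≤n (s≤s z≤n) ▹ left-column ≤-refl (<⇒≤ r<μ) ≤-refl)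
        ...   | inj₁ y<μ = between hull RU (T₁ 3≤r ≤-refl) Tτ
          (up-run (inj₁ refl) (<⇒≤ (≰⇒> r≱)) (λ i p q → inj₂ (p , ≤-<-trans q y<μ)) (x< , y<))
          (row→τ x< y<μ (right₁ (s≤s (s≤s (s≤s z≤n))) y<μ))
        all (suc (suc x) , y) (x< , y<) with m≤n⇒m<n∨m≡n (≤-pred y<)
        ... | inj₂ refl = between hull LD Tτ Tω (top-row (≤-pred x<)) (top-row′ z≤n (≤-pred x<) ▹ left-column ≤-refl (<⇒≤ r<μ) ≤-refl)
        all (2 , y) (x< , y<) | inj₁ y<μ with y ≤? 3
        ...   | yes l = T₂ l
        ...   | no 3≱ = between hull RU (T₂ ≤-refl) Tτ
          (up-run (inj₁ refl) (<⇒≤ (≰⇒> 3≱)) (λ i p q → p , ≤-<-trans q y<μ) (x< , y<))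
          (row→τ x< y<μ (right₂ y<μ))
        all (suc (suc (suc x)) , y) (x< , y<) | inj₁ y<μ = between hull RU Tt Tτ
          (t₀→column (s≤s (s≤s z≤n)) x< ▹ up-run (inj₁ refl) z≤n (λ i _ q → inj₁ (≤-<-trans q y<μ)) (x< , y<))
          (row→τ x< y<μ (λ i p → right₂ y<μ i (≤-trans (s≤s (s≤s z≤n)) p)))

      meets-b : ∀ {c d} → T c → ¬ S c → T d → S d → T b × T t₀
      meets-b Tc ¬Sc Td Sd with cross (λ a → ¬? (S? a)) Tc ¬Sc (λ ¬Sd → ¬Sd Sd) (conn Tc Td)
      ... | c , d , Tc , ¬Sc , Td , ¬¬Sd , s , _ with S? d
      ...   | no ¬Sd = contradiction ¬Sd ¬¬Sd
      ...   | yes Sd with entrance s ¬Sc Sd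
      ...     | refl , refl = Tc , Td

      -- Two nested regions that contain `t₀` and not `b`. Every arc of the grid out of `A₂` ends in
      -- `ω`, every arc out of `A₁` ends in `τ`.
      A₂ A₁ : Pt → Set
      A₂ (0 , y)                 = r < y
      A₂ (1 , y)                 = r < y
      A₂ (2 , y)                 = 4 ≤ y ⊎ y ≡ 0
      A₂ (suc (suc (suc x)) , y) = ⊤
      A₁ (0 , y)                 = ⊥
      A₁ (1 , y)                 = r < y × y < μ
      A₁ (2 , y)                 = (4 ≤ y × y < μ) ⊎ y ≡ 0
      A₁ (suc (suc (suc x)) , y) = y < μ

      A₂? : ∀ a → Dec (A₂ a)
      A₂? (0 , y)                 = r <? y
      A₂? (1 , y)                 = r <? y
      A₂? (2 , y)                 = (4 ≤? y) ⊎-dec (y ≟ 0)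
      A₂? (suc (suc (suc x)) , y) = yes tt

      A₁? : ∀ a → Dec (A₁ a)
      A₁? (0 , y)                 = no λ ()
      A₁? (1 , y)                 = (r <? y) ×-dec (y <? μ)
      A₁? (2 , y)                 = ((4 ≤? y) ×-dec (y <? μ)) ⊎-dec (y ≟ 0)
      A₁? (suc (suc (suc x)) , y) = y <? μ

      4≤ : ∀ {y} → r < y → 4 ≤ y
      4≤ l = ≤-trans (s≤s 3≤r) l

      leave₂ : ∀ {c d} → InB c → Step c d → A₂ c → ¬ A₂ d → d ≡ ω
      leave₂ _ (→R {0} _) A ¬A = contradiction A ¬A
      leave₂ _ (→R {1} _) A ¬A = contradiction (inj₁ (4≤ A)) ¬A
      leave₂ _ (→R {suc (suc x)} _) A ¬A = contradiction tt ¬A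
      leave₂ _ (←L {0} _) A ¬A = contradiction A ¬A
      leave₂ _ (←L {1} {y} p) (inj₁ l) ¬A with y ≟ μ
      ... | yes refl = contradiction r<μ ¬A
      ... | no y≢μ = contradiction (y≢μ , inj₂ (≤-trans (n≤1+n 3) l)) p
      leave₂ _ (←L {1} p) (inj₂ refl) ¬A = contradiction (0≢μ , inj₁ refl) p
      leave₂ _ (←L {2} {y} p) A ¬A with y ≟ μ
      ... | yes refl = contradiction (inj₁ (≤-trans (n≤1+n 4) 5≤μ)) ¬A
      ... | no y≢μ = contradiction y≢μ p
      leave₂ _ (←L {suc (suc (suc x))} _) A ¬A = contradiction tt ¬A
      leave₂ _ (↑U {0} _) A ¬A = contradiction (m≤n⇒m≤1+n A) ¬A
      leave₂ _ (↑U {1} _) A ¬A = contradiction (m≤n⇒m≤1+n A) ¬A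
      leave₂ _ (↑U {2} _) (inj₁ l) ¬A = contradiction (inj₁ (m≤n⇒m≤1+n l)) ¬A
      leave₂ _ (↑U {2} (() , _)) (inj₂ refl) ¬A
      leave₂ _ (↑U {suc (suc (suc x))} _) A ¬A = contradiction tt ¬A
      leave₂ _ (↓D {0} _) A ¬A = cong (0 ,_) (≤-antisym (≮⇒≥ ¬A) (≤-pred A))
      leave₂ _ (↓D {1} {y} p) A ¬A with ≤-antisym (≮⇒≥ ¬A) (≤-pred A)
      ... | refl = contradiction (inj₂ (≤-refl , r+1<μ)) p
      leave₂ i (↓D {2} {y} p) (inj₁ l) ¬A with suc y <? μ
      ... | yes y< = contradiction (≤-pred l , y<) p
      ... | no y≮ = contradiction (inj₁ (≤-pred (≤-trans 5≤μ (≮⇒≥ y≮)))) ¬A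
      leave₂ _ (↓D {suc (suc (suc x))} _) A ¬A = contradiction tt ¬A

      leave₁ : ∀ {c d} → InB c → Step c d → A₁ c → ¬ A₁ d → d ≡ τ
      leave₁ _ (→R {1} _) (l , l′) ¬A = contradiction (inj₁ (4≤ l , l′)) ¬A
      leave₁ _ (→R {2} _) (inj₁ (_ , l)) ¬A = contradiction l ¬A
      leave₁ _ (→R {2} _) (inj₂ refl) ¬A = contradiction (≤-trans (s≤s z≤n) 5≤μ) ¬A
      leave₁ _ (→R {suc (suc (suc x))} _) A ¬A = contradiction A ¬A
      leave₁ _ (←L {0} p) (l , l′) ¬A = contradiction (<⇒≢ l′ , inj₂ (inj₂ (<⇒≤ l))) p
      leave₁ _ (←L {1} p) (inj₁ (l , l′)) ¬A = contradiction (<⇒≢ l′ , inj₂ (≤-trans (n≤1+n 3) l)) p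
      leave₁ _ (←L {1} p) (inj₂ refl) ¬A = contradiction (0≢μ , inj₁ refl) p
      leave₁ _ (←L {suc (suc x)} p) A ¬A = contradiction (<⇒≢ A) p
      leave₁ _ (↑U {1} (inj₁ refl)) (() , _) ¬A
      leave₁ _ (↑U {1} (inj₂ (_ , l′))) (l , _) ¬A = contradiction (m≤n⇒m≤1+n l , l′) ¬A
      leave₁ _ (↑U {2} (_ , l′)) (inj₁ (l , _)) ¬A = contradiction (inj₁ (m≤n⇒m≤1+n l , l′)) ¬A
      leave₁ _ (↑U {2} (() , _)) (inj₂ refl) ¬A
      leave₁ _ (↑U {suc (suc (suc x))} (inj₁ l)) A ¬A = contradiction l ¬A
      leave₁ _ (↑U {suc (suc (suc x))} (inj₂ refl)) A ¬A = cong (N ,_) (≤-antisym A (≮⇒≥ ¬A))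
      leave₁ _ (↓D {1} p) (l , l′) ¬A = contradiction (inj₂ (≤-pred l , l′)) p
      leave₁ _ (↓D {2} p) (inj₁ (l , l′)) ¬A = contradiction (≤-pred l , l′) p
      leave₁ _ (↓D {suc (suc (suc x))} _) A ¬A = contradiction (<-trans ≤-refl A) ¬A

      meets-ω : T b → T t₀ → T ω
      meets-ω Tb Tt with cross A₂? Tt (inj₂ refl) (λ ()) (conn Tt Tb)
      ... | c , d , Tc , Ac , Td , ¬Ad , s , _ = subst T (leave₂ (inb Tc) s Ac ¬Ad) Td

      meets-τ : T b → T t₀ → T τ
      meets-τ Tb Tt with cross A₁? Tt (inj₂ refl) (λ ()) (conn Tt Tb)
      ... | c , d , Tc , Ac , Td , ¬Ad , s , _ = subst T (leave₁ (inb Tc) s Ac ¬Ad) Td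

      fill′ : T b → T t₀ → ∀ a → InB a → T a
      fill′ Tb Tt = fill Tb Tt (meets-τ Tb Tt) (meets-ω Tb Tt)

    t₀-in : InB t₀
    t₀-in = in₂ z≤n

    strong : Strong D
    strong = hull⇒strong {t₀} {b} t₀-in
      (_ , Mono.run (t₀→column (s≤s (s≤s z≤n)) ≤-refl ▹ row→τ ≤-refl (≤-trans (s≤s z≤n) 5≤μ) (λ i p → right₂ (≤-trans (s≤s z≤n) 5≤μ) i (≤-trans (s≤s (s≤s z≤n)) p))) ++
        Mono.run (top-row z≤n ▹ left-column ≤-refl (<⇒≤ r<μ) ≤-refl) ++
        Mono.run (turn₀ ▹ lane₁ ≤-refl 3≤r ≤-refl ▹ turn ▹ lane₃ {1} (s≤s z≤n)) ++
        (←L (λ { (_ , inj₁ ()) ; (_ , inj₂ (s≤s ())) }) ∷⟨ in₁ 1≤μ ⟩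
          (←L (λ { (_ , inj₁ ()) ; (_ , inj₂ (inj₁ ())) ; (_ , inj₂ (inj₂ l)) → <⇒≱ (s≤s (s≤s z≤n)) (≤-trans 3≤r l) }) ∷⟨ in₀ 1≤μ ⟩
            (↓D (λ ()) ∷⟨ in₀ z≤n ⟩ (→R (0≢μ , inj₁ refl) ∷⟨ in₁ z≤n ⟩ [])))))
      (_ , →R (0≢μ , inj₁ refl) ∷⟨ t₀-in ⟩ [])
      (λ hull Tt Tb → fill′ hull Tb Tt)
      where
      1≤μ : 1 ≤ μ
      1≤μ = ≤-trans (s≤s z≤n) 5≤μ

    lo : ℕ → ℕ
    lo 0 = r
    lo 1 = 3
    lo (suc (suc _)) = 0

    ∣S∣ : ∣ sub S? ∣ ≡ (m ∸ r) + ((m ∸ 3) + suc (suc ν) * m)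
    ∣S∣ = trans (∣sub∣ S? lo (λ _ → m)
        (λ { 0 _ → m≤n⇒m≤1+n (<⇒≤ r<μ) , ≤-refl ; 1 _ → m≤n⇒m≤1+n 3≤μ , ≤-refl ; (suc (suc _)) _ → z≤n , ≤-refl })
        (λ { {0} _ l _ → l ; {1} _ l _ → l ; {suc (suc _)} _ _ _ → tt })
        λ { {0} _ y< l → l , y< ; {1} _ y< l → l , y< ; {suc (suc _)} _ y< _ → z≤n , y< })
      (cong ((m ∸ r) +_) (cong ((m ∸ 3) +_) (sum-const (suc (suc ν)) {a = m} (λ _ _ → refl))))

    ∣S∣+ : ∣ sub S? ∣ + (3 + r) ≡ n * m
    ∣S∣+ = trans (cong (_+ (3 + r)) ∣S∣) (trans (rearrange (m ∸ r) (m ∸ 3) (suc (suc ν) * m) r)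
      (cong₂ (λ p q → p + (q + suc (suc ν) * m)) (m∸n+n≡m (m≤n⇒m≤1+n (<⇒≤ r<μ))) (m∸n+n≡m (m≤n⇒m≤1+n 3≤μ))))
      where
      rearrange : ∀ p q s r → p + (q + s) + (3 + r) ≡ p + r + (q + 3 + s)
      rearrange = solve-∀

    -- The complement contains the directed 4-cycle through (0 , 1), (0 , 2), (1 , 2) and (1 , 1),
    -- so acyclicity does not exclude convex sets outside `S`. Their size does.
    ∣∁S∣≤∣S∣ : ∣ ∁ (sub S?) ∣ ≤ ∣ sub S? ∣
    ∣∁S∣≤∣S∣ = ≤-trans (≤-reflexive (trans (∣∁p∣≡n∸∣p∣ (sub S?)) (trans (cong (_∸ ∣ sub S? ∣) (sym ∣S∣+)) (m+n∸m≡n ∣ sub S? ∣ (3 + r)))))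
      (≤-trans (≤-trans (+-mono-≤ (m≤n⇒m≤1+n 3≤μ) (m≤n⇒m≤1+n (<⇒≤ r<μ))) (+-monoʳ-≤ m (m≤m+n m (ν * m))))
        (≤-trans (m≤n+m _ (m ∸ 3)) (≤-trans (m≤n+m _ (m ∸ r)) (≤-reflexive (sym ∣S∣)))))

    corner-spectrum : StrongConvexitySpectrum (P n □ P m) (n * m ∸ (3 + r))
    corner-spectrum = subst (StrongConvexitySpectrum _) (trans (sym (m+n∸n≡m ∣ sub S? ∣ (3 + r))) (cong (_∸ (3 + r)) ∣S∣+))
      (spectrum S? strong shortcuts (t₀ , t₀-in , tt) (b , in₁ z≤n , λ ()) λ where
        hull (inj₂ out) _ _ _ _ → inj₂ (out , ∣∁S∣≤∣S∣)
        hull (inj₁ (e , Te , Se)) Tc ¬Sc _ _ → let Tb , Tt = meets-b hull Tc ¬Sc Te Se in inj₁ (fill′ hull Tb Tt))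

-- Two cyclic patterns of opposite phase.

module Psi where

  open Core
  open GridD
  open Count
  open import Data.Bool.Base using (Bool; true; false; not; _xor_)
  open import Data.Bool.Properties using (not-involutive; not-¬; ¬-not) renaming (_≟_ to _≟ᵇ_)
  open import Data.Fin.Subset using (∣_∣)
  open import Data.Nat.Base using (ℕ; zero; suc; pred; _+_; _*_; _∸_; _≤_; _<_; z≤n; s≤s)
  open import Data.Nat.Properties
  open import Data.Product.Base using (Σ-syntax; ∃-syntax; _×_; _,_; proj₁; proj₂)
  open import Data.Product.Properties using (≡-dec)
  open import Data.Sum.Base using (_⊎_; inj₁; inj₂)
  open import Function.Base using (_∘_)
  open import Relation.Binary.PropositionalEquality using (_≡_; _≢_; refl; sym; trans; cong; subst)
  open import Relation.Nullary using (¬_; Dec; yes; no; contradiction)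
  open import Relation.Nullary.Decidable using (_×-dec_; _⊎-dec_; ¬?; decidable-stable)

  gap : ℕ → ℕ → ℕ
  gap zero    k       = k
  gap (suc y) zero    = suc y
  gap (suc y) (suc k) = gap y k

  gap-suc : ∀ y k → gap y k ≤ suc (gap (suc y) k) × gap (suc y) k ≤ suc (gap y k)
  gap-suc zero    zero    = z≤n , ≤-refl
  gap-suc zero    (suc k) = ≤-refl , m≤n⇒m≤1+n (n≤1+n k)
  gap-suc (suc y) zero    = m≤n⇒m≤1+n (n≤1+n (suc y)) , ≤-refl
  gap-suc (suc y) (suc k) = gap-suc y k

  gap-refl : ∀ k → gap k k ≡ 0
  gap-refl zero    = refl
  gap-refl (suc k) = gap-refl k

  gap-+ : ∀ v k → gap (v + k) k ≡ v
  gap-+ zero    k       = gap-refl k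
  gap-+ (suc v) zero    = cong suc (+-identityʳ v)
  gap-+ (suc v) (suc k) rewrite +-suc v k = gap-+ (suc v) k

  gap-below : ∀ y → gap y (suc y) ≡ 1
  gap-below zero    = refl
  gap-below (suc y) = gap-below y

  gap-up : ∀ {y k} → k ≤ y → gap y k ≤ gap (suc y) k
  gap-up {y} {zero} z≤n with y
  ... | zero  = z≤n
  ... | suc y = n≤1+n (suc y)
  gap-up (s≤s l) = gap-up l

  twice : ∀ {u v} → u ≤ suc v → 2 * u ≤ 2 + 2 * v
  twice {u} {v} l = ≤-trans (*-monoʳ-≤ 2 l) (≤-reflexive (*-suc 2 v))

  -- Both S and the columns x > q carry the parity pattern, with opposite phases; the
  -- remaining vertices are passed to the right and upwards.  All edges between S and its
  -- complement leave S, except for the one that enters t₀.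
  module TwoPhase (q y₀ n m : ℕ) {S : Pt → Set} (S? : ∀ a → Dec (S a))
    (S-left : ∀ {x y} → S (x , y) → x ≤ q × y < m)
    (St₀ : S (q , y₀)) (Sκ : S (q , suc y₀)) (¬Sγ : ¬ S (q , suc (suc y₀)))
    (q+2<n : suc (suc q) < n) (y₀+2<m : suc (suc y₀) < m)
    (low : ∀ {x y} → x ≤ q → ¬ S (x , y) → ¬ S (x , suc y) → y₀ ≤ y) where

    p₀ : Bool
    p₀ = isEven q xor isEven y₀

    pr : ℕ → ℕ → Bool
    pr x y = isEven x xor isEven y

    prˣ : ∀ x y → pr (suc x) y ≡ not (pr x y)
    prˣ x y with isEven x
    ... | true  = sym (not-involutive _)
    ... | false = refl

    prʸ : ∀ x y → pr x (suc y) ≡ not (pr x y)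
    prʸ x y with isEven x
    ... | true  = refl
    ... | false = refl

    Right Up : ℕ → ℕ → Set
    Right x y = (q < x × pr x y ≡ p₀) ⊎
                (x ≤ q × ¬ (x ≡ q × y ≡ y₀) × ((S (x , y) × S (suc x , y) × pr x y ≢ p₀) ⊎ ¬ S (suc x , y)))
    Up x y = (q < x × pr x y ≢ p₀) ⊎
             (x ≤ q × ((S (x , y) × S (x , suc y) × pr x y ≡ p₀) ⊎ ¬ S (x , suc y)))

    right? : ∀ x y → Dec (Right x y)
    right? x y = ((q <? x) ×-dec (pr x y ≟ᵇ p₀)) ⊎-dec ((x ≤? q) ×-dec (¬? ((x ≟ q) ×-dec (y ≟ y₀)) ×-dec
      ((S? (x , y) ×-dec (S? (suc x , y) ×-dec ¬? (pr x y ≟ᵇ p₀))) ⊎-dec ¬? (S? (suc x , y)))))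

    up? : ∀ x y → Dec (Up x y)
    up? x y = ((q <? x) ×-dec ¬? (pr x y ≟ᵇ p₀)) ⊎-dec ((x ≤? q) ×-dec
      ((S? (x , y) ×-dec (S? (x , suc y) ×-dec (pr x y ≟ᵇ p₀))) ⊎-dec ¬? (S? (x , suc y))))

    open OrientedGrid n m right? up? public

    t₀ b κ γ : Pt
    t₀ = q , y₀
    b  = suc q , y₀
    κ  = q , suc y₀
    γ  = q , suc (suc y₀)

    ¬S-right : ∀ {y} → ¬ S (suc q , y)
    ¬S-right s = <⇒≱ ≤-refl (proj₁ (S-left s))

    entrance : ∀ {a c} → Step a c → ¬ S a → S c → a ≡ b × c ≡ t₀
    entrance (→R (inj₁ (l , _))) ¬Sa Sc = contradiction (≤-trans (n≤1+n _) (proj₁ (S-left Sc))) (<⇒≱ l)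
    entrance (→R (inj₂ (_ , _ , inj₁ (Sa , _)))) ¬Sa Sc = contradiction Sa ¬Sa
    entrance (→R (inj₂ (_ , _ , inj₂ ¬Sc))) ¬Sa Sc = contradiction Sc ¬Sc
    entrance (←L {x} {y} r) ¬Sa Sc with (x ≟ q) ×-dec (y ≟ y₀)
    ... | yes (refl , refl) = refl , refl
    ... | no ¬e = contradiction (inj₂ (proj₁ (S-left Sc) , ¬e , inj₂ ¬Sa)) r
    entrance (↑U (inj₁ (l , _))) ¬Sa Sc = contradiction (proj₁ (S-left Sc)) (<⇒≱ l)
    entrance (↑U (inj₂ (_ , inj₁ (Sa , _)))) ¬Sa Sc = contradiction Sa ¬Sa
    entrance (↑U (inj₂ (_ , inj₂ ¬Sc))) ¬Sa Sc = contradiction Sc ¬Sc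
    entrance (↓D u) ¬Sa Sc = contradiction (inj₂ (proj₁ (S-left Sc) , inj₂ ¬Sa)) u

    tag : Bool → ℕ
    tag p with p ≟ᵇ p₀
    ... | yes _ = 1
    ... | no _  = 0

    tag≤1 : ∀ p → tag p ≤ 1
    tag≤1 p with p ≟ᵇ p₀
    ... | yes _ = ≤-refl
    ... | no _  = z≤n

    tag-≢ : ∀ {p} → p ≢ p₀ → tag p ≡ 0
    tag-≢ {p} ne with p ≟ᵇ p₀
    ... | yes e = contradiction e ne
    ... | no _  = refl

    tag-≡ : ∀ {p} → p ≡ p₀ → tag p ≡ 1
    tag-≡ {p} e with p ≟ᵇ p₀
    ... | yes _ = refl
    ... | no ne = contradiction e ne

    -- In the columns x > q the horizontal edges leave the vertices of parity `p₀` and enter the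
    -- others, and the vertical edges do the reverse. So walks alternate, each unit of height costs
    -- two steps, `tag` pays for a horizontal first step, and one step is the arc from `b`. Further
    -- left, walks outside `S` move right or up, and `low` ensures that they do not approach row
    -- `y₀`.
    Φ : Pt → ℕ
    Φ (x , y) with q <? x
    ... | yes _ = suc (2 * gap y y₀ + tag (pr x y))
    ... | no _  = suc q ∸ x + suc (2 * gap y y₀)

    Φ-right : ∀ {x y} → q < x → Φ (x , y) ≡ suc (2 * gap y y₀ + tag (pr x y))
    Φ-right {x} l with q <? x
    ... | yes _ = refl
    ... | no ¬l = contradiction l ¬l

    Φ-left : ∀ {x y} → x ≤ q → Φ (x , y) ≡ suc q ∸ x + suc (2 * gap y y₀)
    Φ-left {x} l with q <? x
    ... | yes l′ = contradiction l (<⇒≱ l′)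
    ... | no _   = refl

    flip : ∀ {p} → p ≢ p₀ → not p ≡ p₀
    flip ne = trans (cong not (¬-not ne)) (not-involutive _)

    Φ-down : ∀ x y → q < x → pr x y ≡ p₀ → Φ (x , suc y) ≤ suc (Φ (x , y))
    Φ-down x y l e rewrite Φ-right {x} {y} l | Φ-right {x} {suc y} l | tag-≡ e
      | tag-≢ {pr x (suc y)} (λ e′ → not-¬ refl (trans (sym e′) (trans (prʸ x y) (cong not e)))) =
      s≤s (≤-trans (≤-reflexive (+-identityʳ _)) (≤-trans (twice (proj₂ (gap-suc y y₀))) (≤-reflexive (cong suc (+-comm 1 _)))))

    Φ-lipschitz : ∀ {a c} → Step a c → ¬ S a → ¬ S c → Φ a ≤ suc (Φ c)
    Φ-lipschitz (→R {x} {y} (inj₁ (l , e))) _ _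
      rewrite Φ-right {x} {y} l | Φ-right {suc x} {y} (m<n⇒m<1+n l) | tag-≡ e =
      s≤s (≤-trans (≤-reflexive (+-comm _ 1)) (s≤s (m≤m+n _ _)))
    Φ-lipschitz (→R (inj₂ (_ , _ , inj₁ (Sa , _)))) ¬Sa _ = contradiction Sa ¬Sa
    Φ-lipschitz (→R {x} {y} (inj₂ (l , _ , inj₂ _))) _ _ with m≤n⇒m<n∨m≡n l
    ... | inj₁ l′ rewrite Φ-left {x} {y} l | Φ-left {suc x} {y} l′ =
      ≤-reflexive (cong (_+ suc (2 * gap y y₀)) (+-∸-assoc 1 l))
    ... | inj₂ refl rewrite Φ-left {x} {y} ≤-refl | Φ-right {suc x} {y} ≤-refl | m+n∸n≡m 1 x =
      s≤s (s≤s (m≤m+n _ _))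
    Φ-lipschitz (←L {x} {y} r) ¬Sa ¬Sc with q <? x
    ... | no ¬l = contradiction (inj₂ (≮⇒≥ ¬l , (λ { (refl , refl) → ¬Sc St₀ }) , inj₂ ¬Sa)) r
    ... | yes l rewrite Φ-right {suc x} {y} (m<n⇒m<1+n l) =
      s≤s (≤-trans (+-monoʳ-≤ (2 * gap y y₀) (tag≤1 (pr (suc x) y))) (≤-trans (≤-reflexive (+-comm _ 1)) (s≤s (m≤m+n _ _))))
    Φ-lipschitz (↑U {x} {y} (inj₁ (l , ne))) _ _
      rewrite Φ-right {x} {y} l | Φ-right {x} {suc y} l | tag-≢ ne | tag-≡ (trans (prʸ x y) (flip ne)) =
      s≤s (≤-trans (≤-reflexive (+-identityʳ _)) (≤-trans (twice (proj₁ (gap-suc y y₀))) (≤-reflexive (cong suc (+-comm 1 _)))))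
    Φ-lipschitz (↑U (inj₂ (_ , inj₁ (Sa , _)))) ¬Sa _ = contradiction Sa ¬Sa
    Φ-lipschitz (↑U {x} {y} (inj₂ (l , inj₂ _))) ¬Sa ¬Sc
      rewrite Φ-left {x} {y} l | Φ-left {x} {suc y} l =
      m≤n⇒m≤1+n (+-monoʳ-≤ (suc q ∸ x) (s≤s (*-monoʳ-≤ 2 (gap-up (low l ¬Sa ¬Sc)))))
    Φ-lipschitz (↓D {x} {y} u) ¬Sa ¬Sc with q <? x | pr x y ≟ᵇ p₀ | Φ-down x y
    ... | no ¬l | _     | _ = contradiction (inj₂ (≮⇒≥ ¬l , inj₂ ¬Sa)) u
    ... | yes l | no ne | _ = contradiction (inj₁ (l , ne)) u
    ... | yes l | yes e | f = f l e

    pr-b : pr (suc q) y₀ ≢ p₀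
    pr-b e = not-¬ refl (trans (sym e) (prˣ q y₀))

    Φ-b : Φ b ≤ 1
    Φ-b rewrite Φ-right {suc q} {y₀} ≤-refl | gap-refl y₀ | tag-≢ pr-b = ≤-refl

    Right-R : ∀ {x y} → q < x → pr x y ≡ p₀ → Right x y
    Right-R l e = inj₁ (l , e)

    ¬Right-R : ∀ {x y} → q < x → pr x y ≢ p₀ → ¬ Right x y
    ¬Right-R l ne (inj₁ (_ , e))  = ne e
    ¬Right-R l ne (inj₂ (l′ , _)) = <⇒≱ l l′

    Up-R : ∀ {x y} → q < x → pr x y ≢ p₀ → Up x y
    Up-R l ne = inj₁ (l , ne)

    ¬Up-R : ∀ {x y} → q < x → pr x y ≡ p₀ → ¬ Up x y
    ¬Up-R l e (inj₁ (_ , ne)) = ne e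
    ¬Up-R l e (inj₂ (l′ , _)) = <⇒≱ l l′

    Right-S : ∀ {x y} → x ≤ q → S (x , y) → S (suc x , y) → pr x y ≢ p₀ → Right x y
    Right-S l s s′ ne = inj₂ (l , (λ { (refl , refl) → ne refl }) , inj₁ (s , s′ , ne))

    ¬Right-S : ∀ {x y} → x ≤ q → S (suc x , y) → pr x y ≡ p₀ → ¬ Right x y
    ¬Right-S l s e (inj₁ (l′ , _))                        = <⇒≱ l′ l
    ¬Right-S l s e (inj₂ (_ , _ , inj₁ (_ , _ , ne)))     = ne e
    ¬Right-S l s e (inj₂ (_ , _ , inj₂ ¬s))               = ¬s s

    Up-S : ∀ {x y} → x ≤ q → S (x , y) → S (x , suc y) → pr x y ≡ p₀ → Up x y
    Up-S l s s′ e = inj₂ (l , inj₁ (s , s′ , e))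

    ¬Up-S : ∀ {x y} → x ≤ q → S (x , suc y) → pr x y ≢ p₀ → ¬ Up x y
    ¬Up-S l s ne (inj₁ (l′ , _))                = <⇒≱ l′ l
    ¬Up-S l s ne (inj₂ (_ , inj₁ (_ , _ , e)))  = ne e
    ¬Up-S l s ne (inj₂ (_ , inj₂ ¬s))           = ¬s s

    prˣ-≢ : ∀ {x y} → pr x y ≡ p₀ → pr (suc x) y ≢ p₀
    prˣ-≢ {x} {y} e e′ = not-¬ refl (trans (sym e′) (trans (prˣ x y) (cong not e)))

    prˣ-≡ : ∀ {x y} → pr x y ≢ p₀ → pr (suc x) y ≡ p₀
    prˣ-≡ {x} {y} ne = trans (prˣ x y) (flip ne)

    prʸ-≢ : ∀ {x y} → pr x y ≡ p₀ → pr x (suc y) ≢ p₀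
    prʸ-≢ {x} {y} e e′ = not-¬ refl (trans (sym e′) (trans (prʸ x y) (cong not e)))

    prʸ-≡ : ∀ {x y} → pr x y ≢ p₀ → pr x (suc y) ≡ p₀
    prʸ-≡ {x} {y} ne = trans (prʸ x y) (flip ne)

    cyclic-R : ∀ {x y} → q < x → Cyclic x y
    cyclic-R {x} {y} l with pr x y ≟ᵇ p₀
    ... | yes e = ccw (Right-R l e) (Up-R (m<n⇒m<1+n l) (prˣ-≢ {x} {y} e)) (¬Right-R l (prʸ-≢ {x} {y} e)) (¬Up-R l e)
    ... | no ne = cw (¬Right-R l ne) (¬Up-R (m<n⇒m<1+n l) (prˣ-≡ {x} {y} ne)) (Right-R l (prʸ-≡ {x} {y} ne)) (Up-R l ne)

    cyclic-S : ∀ {x y} → S (x , y) → S (suc x , y) → S (x , suc y) → S (suc x , suc y) → Cyclic x y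
    cyclic-S {x} {y} sw se nw ne with pr x y ≟ᵇ p₀ | proj₁ (S-left se)
    ... | yes e | l = cw (¬Right-S (<⇒≤ l) se e) (¬Up-S l ne (prˣ-≢ {x} {y} e))
                         (Right-S (<⇒≤ l) nw ne (prʸ-≢ {x} {y} e)) (Up-S (<⇒≤ l) sw nw e)
    ... | no e  | l = ccw (Right-S (<⇒≤ l) sw se e) (Up-S l se ne (prˣ-≡ {x} {y} e))
                         (¬Right-S (<⇒≤ l) ne (prʸ-≡ {x} {y} e)) (¬Up-S (<⇒≤ l) nw e)

    <pred⇒suc< : ∀ {k x} → x < pred k → suc x < k
    <pred⇒suc< {suc k} l = s≤s l

    suc<⇒<pred : ∀ {k x} → suc x < k → x < pred k
    suc<⇒<pred (s≤s l) = l

    b→t₀ : Step b t₀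
    b→t₀ = ←L λ { (inj₁ (l , _)) → <⇒≱ l ≤-refl ; (inj₂ (_ , ne , _)) → ne (refl , refl) }

    t₀→κ : Step t₀ κ
    t₀→κ = ↑U (Up-S ≤-refl St₀ Sκ refl)

    κ→γ : Step κ γ
    κ→γ = ↑U (inj₂ (≤-refl , inj₂ ¬Sγ))

    γ→ : Step γ (suc q , suc (suc y₀))
    γ→ = →R (inj₂ (≤-refl , (λ { (_ , ()) }) , inj₂ ¬S-right))

    in-q : ∀ {y} → y ≤ suc (suc y₀) → InB (q , y)
    in-q l = <-trans (n<1+n q) (<-trans ≤-refl q+2<n) , ≤-<-trans l y₀+2<m

    in-q₁ : ∀ {y} → y ≤ suc (suc y₀) → InB (suc q , y)
    in-q₁ l = <-trans ≤-refl q+2<n , ≤-<-trans l y₀+2<m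

    in-q₂ : ∀ {y} → y ≤ suc (suc y₀) → InB (suc (suc q) , y)
    in-q₂ l = q+2<n , ≤-<-trans l y₀+2<m

    module _ {T : Pt → Set} (hull : Hull T) where
      open Hull hull

      private
        module R = Faces hull (suc q) (pred n) (λ _ → pred m)
          (λ _ _ → suc<⇒<pred (<-trans (s≤s (s≤s z≤n)) y₀+2<m))
          (λ l x< y< → cyclic-R l , (<pred⇒suc< x< , <pred⇒suc< y<))

      record FaceR : Set where
        constructor faceR
        field
          {fx fy} : ℕ
          fx>     : q < fx
          fx<     : suc fx < n
          fy<     : suc fy < m
          fc      : Corners hull fx fy

      horizontal : ∀ {x} y → T (x , y) → T (suc x , y) → q < x → FaceR
      horizontal zero t u l = faceR l (proj₁ (inb u)) 1<m
        (from-south hull (cyclic-R l) (proj₁ (inb u) , 1<m) t u)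
        where 1<m = <-trans (s≤s (s≤s z≤n)) y₀+2<m
      horizontal (suc y) t u l = faceR l (proj₁ (inb u)) (proj₂ (inb u)) (from-north hull (cyclic-R l) (inb u) t u)

      vertical : ∀ {x y} → T (x , y) → T (x , suc y) → q < x → FaceR
      vertical {x} t u l with suc x <? n
      ... | yes x< = faceR l x< (proj₂ (inb u)) (from-west hull (cyclic-R l) (x< , proj₂ (inb u)) t u)
      vertical {zero} t u () | no _
      vertical {suc x} t u l | no x≮ = faceR l′ (proj₁ (inb u)) (proj₂ (inb u)) (from-east hull (cyclic-R l′) (inb u) t u)
        where l′ = ≤-pred (≤-pred (≤-trans q+2<n (≮⇒≥ x≮)))

      corners-R : ∀ {a c} → Step a c → T a → T c → q < proj₁ a → q < proj₁ c → FaceR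
      corners-R (→R {x} {y} _) Ta Tc l _ = horizontal y Ta Tc l
      corners-R (←L {x} {y} _) Ta Tc _ l = horizontal y Tc Ta l
      corners-R (↑U _) Ta Tc l _ = vertical Ta Tc l
      corners-R (↓D _) Ta Tc l _ = vertical Tc Ta l

      fill-R : FaceR → ∀ {x y} → InB (x , y) → q < x → T (x , y)
      fill-R (faceR fx> fx< fy< fc) {x} {y} (x< , y<) l = go x y x< y< l
        where
        face-at : ∀ {x y} → q < x → suc x < n → suc y < m → Corners hull x y
        face-at p p′ p″ = R.spread fx> (suc<⇒<pred fx<) (suc<⇒<pred fy<) fc p (suc<⇒<pred p′) (suc<⇒<pred p″)
        1<m = <-trans (s≤s (s≤s z≤n)) y₀+2<m
        go : ∀ x y → x < n → y < m → q < x → T (x , y)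
        go x y x< y< l with suc x <? n
        go x zero x< y< l | yes x<′ = Corners.sw (face-at l x<′ 1<m)
        go x (suc y) x< y< l | yes x<′ = Corners.nw (face-at l x<′ y<)
        go (suc x) zero x< y< l | no x≮ = Corners.se (face-at (≤-pred (≤-pred (≤-trans q+2<n (≮⇒≥ x≮)))) x< 1<m)
        go (suc x) (suc y) x< y< l | no x≮ = Corners.ne (face-at (≤-pred (≤-pred (≤-trans q+2<n (≮⇒≥ x≮)))) x< y<)

      -- Only b has an arc out of the right part, and the arcs into b come from the right part.
      inside-R : ∀ {a c} → T a → q < proj₁ a → T c → a ≢ c → FaceR
      inside-R {a} {c} Ta l Tc ne with ≡-dec _≟_ _≟_ a b
      ... | yes refl with predecessor (ne ∘ sym) Tc (conn Tc Ta)
      ...   | e , Te , s = corners-R s Te Ta (into s) l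
        where
        into : ∀ {e} → Step e b → q < proj₁ e
        into (→R (inj₁ (l , _))) = contradiction ≤-refl (<⇒≱ l)
        into (→R (inj₂ (_ , ne , _))) = contradiction (refl , refl) ne
        into (←L _) = m<n⇒m<1+n ≤-refl
        into (↑U _) = ≤-refl
        into (↓D _) = ≤-refl
      inside-R {a} {c} Ta l Tc ne | no a≢b with successor ne (conn Ta Tc)
      ... | e , Te , s , _ = corners-R s Ta Te l (out s l a≢b)
        where
        out : ∀ {a e} → Step a e → q < proj₁ a → a ≢ b → q < proj₁ e
        out (→R _) l _ = m<n⇒m<1+n l
        out (←L {x} {y} r) l a≢b with m≤n⇒m<n∨m≡n (≤-pred l)
        ... | inj₁ l′ = l′
        ... | inj₂ refl = contradiction (inj₂ (≤-refl , (λ { (_ , refl) → a≢b refl }) , inj₂ ¬S-right)) r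
        out (↑U _) l _ = l
        out (↓D _) l _ = l

      -- Outside `S` and left of the cyclic columns every step increases x + y, so the hull has to
      -- leave this zone. An arc into `S` would start at `b`, hence it leaves into the columns x >
      -- q.
      find-R : ∀ {c d} → T c → ¬ S c → T d → c ≢ d → FaceR
      find-R {c} {d} Tc ¬Sc Td ne with q <? proj₁ c
      ... | yes l = inside-R Tc l Td ne
      ... | no ¬l with escape hull {A = Z} Z? (λ { (x , y) → x + y }) inc Tc (≮⇒≥ ¬l , ¬Sc) Td ne
        where
        Z : Pt → Set
        Z a = proj₁ a ≤ q × ¬ S a
        Z? : ∀ a → Dec (Z a)
        Z? a = (proj₁ a ≤? q) ×-dec ¬? (S? a)
        inc : ∀ {a e} → InB a → InB e → Step a e → Z a → Z e → proj₁ a + proj₂ a < proj₁ e + proj₂ e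
        inc _ _ (→R _) _ _ = ≤-refl
        inc _ _ (←L r) (_ , ¬Sa) (l , ¬Se) = contradiction (inj₂ (l , (λ { (refl , refl) → ¬Se St₀ }) , inj₂ ¬Sa)) r
        inc _ _ (↑U {x} {y} _) _ _ = ≤-reflexive (sym (+-suc x y))
        inc _ _ (↓D u) (_ , ¬Sa) (l , _) = contradiction (inj₂ (l , inj₂ ¬Sa)) u
      ...   | e , Te , ¬Ze with cross {A = λ a → proj₁ a ≤ q × ¬ S a} (λ a → (proj₁ a ≤? q) ×-dec ¬? (S? a)) Tc (≮⇒≥ ¬l , ¬Sc) ¬Ze (conn Tc Te)
      ...     | a , f , Ta , (la , ¬Sa) , Tf , ¬Zf , s , _ with q <? proj₁ f
      ...       | yes l = inside-R Tf l Ta (λ { refl → <⇒≱ l la })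
      ...       | no ¬l′ with entrance s ¬Sa (decidable-stable (S? f) (λ ¬Sf → ¬Zf (≮⇒≥ ¬l′ , ¬Sf)))
      ...         | refl , refl = contradiction la (<⇒≱ ≤-refl)

      -- The column of `b` goes up at `b` and down in the next row, so it cannot be climbed by two
      -- steps. The four steps around through `t₀`, `κ` and `γ` are therefore a geodesic, and this
      -- is how the right part takes hold of `S`.
      gadget : FaceR → T t₀ × T κ × T γ
      gadget f = detour hull (fill-R f (in-q₁ (m≤n⇒m≤1+n (n≤1+n y₀))) ≤-refl) (fill-R f (in-q₁ ≤-refl) ≤-refl) (λ ())
        no-shortcut b→t₀ (in-q (m≤n⇒m≤1+n (n≤1+n y₀))) t₀→κ (in-q (n≤1+n _)) κ→γ (in-q ≤-refl) γ→
        where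
        no-shortcut : ∀ {x} → Step b x → ¬ Step x (suc q , suc (suc y₀))
        no-shortcut (↑U _) (↑U u) with u
        ... | inj₁ (_ , ne) = ne (prʸ-≡ {suc q} {y₀} pr-b)
        ... | inj₂ (l , _)  = <⇒≱ ≤-refl l

    module Conclusion
      (home : ∀ {a c} → InB c → Step a c → S a → ¬ S c → Σ[ k ∈ ℕ ] (Run a t₀ k × k ≤ Φ c))
      (fill-left : ∀ {T} (hull : Hull T) → T t₀ → T κ → T γ → (∀ {x y} → InB (x , y) → q < x → T (x , y)) →
                   ∀ {x y} → InB (x , y) → x ≤ q → T (x , y)) where

      fill : ∀ {T} (hull : Hull T) → FaceR hull → ∀ a → InB a → T a
      fill hull f (x , y) i with q <? x
      ... | yes l = fill-R hull f i l
      ... | no ¬l = let Tt , Tκ , Tγ = gadget hull f in fill-left hull Tt Tκ Tγ (fill-R hull f) i (≮⇒≥ ¬l)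

      shortcuts : Shortcuts S?
      shortcuts = single-entrance S? t₀ Φ
        (λ _ _ s ¬Sa Sc → let e , e′ = entrance s ¬Sa Sc in e′ , subst (λ a → Φ a ≤ 1) (sym e) Φ-b)
        (λ _ _ → Φ-lipschitz) (λ _ → home)

      t₀-in : InB t₀
      t₀-in = in-q (m≤n⇒m≤1+n (n≤1+n y₀))

      strong : Strong D
      strong = hull⇒strong {t₀} {b} t₀-in
        (_ , t₀→κ ∷⟨ in-q (n≤1+n _) ⟩ (κ→γ ∷⟨ in-q ≤-refl ⟩ (γ→ ∷⟨ in-q₁ ≤-refl ⟩
          (↓D (¬Up-R ≤-refl e₁) ∷⟨ in-q₁ (n≤1+n _) ⟩ (→R (Right-R ≤-refl e₁) ∷⟨ in-q₂ (n≤1+n _) ⟩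
            (↓D (¬Up-R (m<n⇒m<1+n ≤-refl) (prˣ-≡ {suc q} {y₀} pr-b)) ∷⟨ in-q₂ (m≤n⇒m≤1+n (n≤1+n y₀)) ⟩
              (←L (¬Right-R ≤-refl pr-b) ∷⟨ in-q₁ (m≤n⇒m≤1+n (n≤1+n y₀)) ⟩ [])))))))
        (_ , b→t₀ ∷⟨ t₀-in ⟩ [])
        (λ hull Tt Tb → fill hull (inside-R hull Tb ≤-refl Tt (λ ())))
        where
        e₁ : pr (suc q) (suc y₀) ≡ p₀
        e₁ = prʸ-≡ {suc q} {y₀} pr-b

      two-phase-spectrum : StrongConvexitySpectrum (P n □ P m) ∣ sub S? ∣
      two-phase-spectrum = spectrum S? strong shortcuts (t₀ , t₀-in , St₀)
        (b , in-q₁ (m≤n⇒m≤1+n (n≤1+n y₀)) , ¬S-right)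
        (λ hull _ Tc ¬Sc Td ne → inj₁ (fill hull (find-R hull Tc ¬Sc Td ne)))

-- Low staircases in the two-phase orientation.

module Psi2 where

  open Core
  open GridD
  open Count
  open Heights
  open Psi
  open import Data.Bool.Base using (not)
  open import Data.Bool.Properties using (not-involutive) renaming (_≟_ to _≟ᵇ_)
  open import Data.Nat.Base using (ℕ; zero; suc; pred; _+_; _*_; _∸_; _≤_; _<_; z≤n; s≤s; >-nonZero)
  open import Data.Nat.Properties
  open import Data.Nat.Tactic.RingSolver using (solve-∀)
  open import Data.Product.Base using (Σ-syntax; ∃-syntax; _×_; _,_; proj₁; proj₂)
  open import Data.Sum.Base using (_⊎_; inj₁; inj₂)
  open import Function.Base using (_∘_)
  open import Relation.Binary.PropositionalEquality using (_≡_; _≢_; refl; sym; trans; cong; subst; subst₂)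
  open import Relation.Nullary using (¬_; Dec; yes; no; contradiction)

  -- By `flat` the heights can drop only after the columns p - 1, p and q. By `tops` a column before
  -- p reaches the top of the grid unless it is the one next to p and equally high. So arcs out of
  -- `S` start in these three columns, close enough to `t₀` for a zigzag.
  module LowStair (p y₀ n m : ℕ) (h : ℕ → ℕ) (anti : Antitone h)
    (h-q : h (suc p) ≡ suc (suc y₀)) (h-end : h (suc (suc p)) ≡ 0) (y₀≤1 : y₀ ≤ 1)
    (y₀+2<m : suc (suc y₀) < m) (h≤m : h 0 ≤ m) (h₀≡h₁ : h 0 ≡ h 1)
    (flat : ∀ {x} → suc (suc x) < suc p → h x ≡ h (suc x))
    (tops : ∀ {x} → x < p → h x ≡ m ⊎ (suc x ≡ p × h x ≡ h p))
    (p+3<n : suc (suc (suc p)) < n) where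

    S : Pt → Set
    S (x , y) = y < h x

    S? : ∀ a → Dec (S a)
    S? (x , y) = y <? h x

    q : ℕ
    q = suc p

    S-left : ∀ {x y} → S (x , y) → x ≤ q × y < m
    S-left {x} s = ≮⇒≥ (λ l → contradiction (≤-trans s (≤-trans (anti l) (≤-reflexive h-end))) λ ()) ,
      ≤-trans s (≤-trans (anti z≤n) h≤m)

    base : ∀ {x y} → x ≤ q → y ≤ suc y₀ → S (x , y)
    base x≤ y≤ = ≤-trans (s≤s y≤) (≤-trans (≤-reflexive (sym h-q)) (anti x≤))

    open TwoPhase q y₀ n m S? S-left (base ≤-refl (n≤1+n y₀)) (base ≤-refl ≤-refl)
      (λ s → <⇒≱ s (≤-reflexive h-q)) p+3<n y₀+2<m
      (λ x≤ ¬s _ → ≤-trans (n≤1+n y₀) (≤-trans (n≤1+n (suc y₀)) (≤-trans (≤-reflexive (sym h-q)) (≤-trans (anti x≤) (≮⇒≥ ¬s)))))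

    S-in : ∀ {x y} → S (x , y) → InB (x , y)
    S-in s = ≤-<-trans (proj₁ (S-left s)) (<-trans (s≤s ≤-refl) (<-trans ≤-refl p+3<n)) , proj₂ (S-left s)

    -- In the columns c and c + 1 a walk inside S zigzags down through the vertices with
    -- parity p₀, which leave vertically.
    turning : ℕ → ℕ → ℕ
    turning c y with pr c y ≟ᵇ p₀
    ... | yes _ = c
    ... | no _  = suc c

    turning-≡ : ∀ {c y} → pr c y ≡ p₀ → turning c y ≡ c
    turning-≡ {c} {y} e with pr c y ≟ᵇ p₀
    ... | yes _ = refl
    ... | no ne = contradiction e ne

    turning-≢ : ∀ {c y} → pr c y ≢ p₀ → turning c y ≡ suc c
    turning-≢ {c} {y} ne with pr c y ≟ᵇ p₀
    ... | yes e = contradiction e ne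
    ... | no _  = refl

    zigzag-step : ∀ {c} y → S (suc c , suc y) → Run (turning c (suc y) , suc y) (turning c y , y) 2
    zigzag-step {c} y s with pr c y ≟ᵇ p₀
    ... | yes e rewrite turning-≢ {c} {suc y} (prʸ-≢ {c} {y} e) =
      ↓D (¬Up-S x≤ s (prˣ-≢ {c} {y} e)) ∷⟨ S-in s′ ⟩
        (←L (¬Right-S (<⇒≤ x≤) s′ e) ∷⟨ S-in (≤-trans s′ (anti (n≤1+n c))) ⟩ [])
      where
      x≤ = proj₁ (S-left s)
      s′ = <-trans ≤-refl s
    ... | no ne rewrite turning-≡ {c} {suc y} (prʸ-≡ {c} {y} ne) =
      ↓D (¬Up-S (<⇒≤ x≤) (≤-trans s (anti (n≤1+n c))) ne) ∷⟨ S-in (≤-trans s′ (anti (n≤1+n c))) ⟩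
        (→R (Right-S (<⇒≤ x≤) (≤-trans s′ (anti (n≤1+n c))) s′ ne) ∷⟨ S-in s′ ⟩ [])
      where
      x≤ = proj₁ (S-left s)
      s′ = <-trans ≤-refl s

    zigzag : ∀ {c} d y → S (suc c , d + y) → Run (turning c (d + y) , d + y) (turning c y , y) (2 * d)
    zigzag zero    y s = []
    zigzag {c} (suc d) y s = subst (Run _ _) (sym (*-suc 2 d)) (zigzag-step (d + y) s ++ zigzag d y (<-trans ≤-refl s))

    enter-zigzag : ∀ {c x} y → x ≡ c ⊎ x ≡ suc c → S (suc c , y) → Σ[ k ∈ ℕ ] (Run (x , y) (turning c y , y) k × k ≤ 1)
    enter-zigzag {c} y x≡ s with pr c y ≟ᵇ p₀ | proj₁ (S-left s) | x≡
    ... | yes e | _  | inj₁ refl = 0 , [] , z≤n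
    ... | no ne | x≤ | inj₁ refl = 1 , →R (Right-S (<⇒≤ x≤) (≤-trans s (anti (n≤1+n c))) s ne) ∷⟨ S-in s ⟩ [] , ≤-refl
    ... | yes e | x≤ | inj₂ refl = 1 , ←L (¬Right-S (<⇒≤ x≤) s e) ∷⟨ S-in (≤-trans s (anti (n≤1+n c))) ⟩ [] , ≤-refl
    ... | no ne | _  | inj₂ refl = 0 , [] , z≤n

    p-y₀ : pr p y₀ ≢ p₀
    p-y₀ e = prˣ-≢ {p} {y₀} e refl

    landing : Run (p , suc y₀) t₀ 2
    landing = ↓D (¬Up-S (n≤1+n p) (base (n≤1+n p) ≤-refl) p-y₀) ∷⟨ S-in (base (n≤1+n p) (n≤1+n y₀)) ⟩
      (→R (Right-S (n≤1+n p) (base (n≤1+n p) (n≤1+n y₀)) (base ≤-refl (n≤1+n y₀)) p-y₀) ∷⟨ S-in (base ≤-refl (n≤1+n y₀)) ⟩ [])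

    Home : ℕ → ℕ → Set
    Home x y = Σ[ k ∈ ℕ ] (Run (x , y) t₀ k × k ≤ suc (2 * gap y y₀))

    -- For y = y₀ + 1 + d there is at most one step to the turning vertex, then two steps per row
    -- down to (p , y₀ + 1), then two steps to `t₀`. The total 1 + 2 (d + 1) is exactly what is
    -- allowed.
    home₁ : ∀ {c x y} → suc c ≡ p → x ≡ c ⊎ x ≡ p → suc y₀ ≤ y → S (p , y) → Home x y
    home₁ {c} {x} {y} refl x≡ l s with m≤n⇒∃[o]m+o≡n l
    ... | d , refl with enter-zigzag (suc y₀ + d) x≡ s
    ...   | k , r , k≤ = k + (2 * d + 2) , r ++ z ++ landing , (begin
        k + (2 * d + 2)                       ≤⟨ +-monoˡ-≤ _ k≤ ⟩
        suc (2 * d + 2)                       ≡⟨ cong suc (trans (+-comm (2 * d) 2) (sym (*-suc 2 d))) ⟩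
        suc (2 * suc d)                       ≡⟨ cong (λ g → suc (2 * g)) (sym (trans (cong (λ i → gap (suc i) y₀) (+-comm y₀ d)) (gap-+ (suc d) y₀))) ⟩
        suc (2 * gap (suc y₀ + d) y₀)         ∎)
      where
      open ≤-Reasoning
      z : Run (turning c (suc y₀ + d) , suc y₀ + d) (p , suc y₀) (2 * d)
      z = subst (λ i → Run (turning c (suc y₀ + d) , suc y₀ + d) (i , suc y₀) (2 * d))
            (turning-≢ {c} {suc y₀} (prʸ-≢ {c} {y₀} (trans (sym (not-involutive _)) (trans (cong not (sym (prˣ c y₀))) (flip p-y₀)))))
            (subst (λ i → Run (turning c i , i) (turning c (suc y₀) , suc y₀) (2 * d)) (+-comm d (suc y₀))
              (zigzag d (suc y₀) (subst (λ i → S (p , i)) (+-comm (suc y₀) d) s)))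

    -- The same one column further left. The zigzag stops at height y₀ + 2, and the two steps that
    -- change to column p also descend a row, so nothing is lost.
    home₂ : ∀ {c x y} → suc (suc c) ≡ p → x ≡ c ⊎ x ≡ suc c → suc (suc y₀) ≤ y → S (suc c , y) → Home x y
    home₂ {c} {x} {y} refl x≡ l s with m≤n⇒∃[o]m+o≡n l
    ... | d , refl with enter-zigzag (suc (suc y₀) + d) x≡ s
    ...   | k , r , k≤ = k + (2 * d + 4) , r ++ z ++ drop ++ landing , (begin
        k + (2 * d + 4)                       ≤⟨ +-monoˡ-≤ _ k≤ ⟩
        suc (2 * d + 4)                       ≡⟨ cong suc (rearrange d) ⟩
        suc (2 * suc (suc d))                 ≡⟨ cong (λ g → suc (2 * g)) (sym (trans (cong (λ i → gap (suc (suc i)) y₀) (+-comm y₀ d)) (gap-+ (suc (suc d)) y₀))) ⟩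
        suc (2 * gap (suc (suc y₀) + d) y₀)   ∎)
      where
      open ≤-Reasoning
      rearrange : ∀ d → 2 * d + 4 ≡ 2 * suc (suc d)
      rearrange = solve-∀
      e₁ : pr (suc c) y₀ ≡ p₀
      e₁ = trans (sym (not-involutive _)) (trans (cong not (sym (prˣ (suc c) y₀))) (flip p-y₀))
      z : Run (turning c (suc (suc y₀) + d) , suc (suc y₀) + d) (suc c , suc (suc y₀)) (2 * d)
      z = subst (λ i → Run (turning c (suc (suc y₀) + d) , suc (suc y₀) + d) (i , suc (suc y₀)) (2 * d))
            (turning-≢ {c} {suc (suc y₀)} (λ e → prˣ-≢ {c} {suc (suc y₀)} e (prʸ-≡ {suc c} {suc y₀} (prʸ-≢ {suc c} {y₀} e₁))))
            (subst (λ i → Run (turning c i , i) (turning c (suc (suc y₀)) , suc (suc y₀)) (2 * d)) (+-comm d (suc (suc y₀)))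
              (zigzag d (suc (suc y₀)) (subst (λ i → S (suc c , i)) (+-comm (suc (suc y₀)) d) s)))
      c≤ : suc c ≤ q
      c≤ = s≤s (≤-trans (n≤1+n c) (n≤1+n (suc c)))
      drop : Run (suc c , suc (suc y₀)) (p , suc y₀) 2
      drop = ↓D (¬Up-S c≤ (≤-<-trans (m≤m+n _ d) s) (prʸ-≢ {suc c} {y₀} e₁)) ∷⟨ S-in (base c≤ ≤-refl) ⟩
        (→R (Right-S c≤ (base c≤ ≤-refl) (base (n≤1+n p) ≤-refl) (prʸ-≢ {suc c} {y₀} e₁)) ∷⟨ S-in (base (n≤1+n p) ≤-refl) ⟩ [])

    -- Column q has height y₀ + 2 with y₀ at most 1. Besides `t₀` it contains only `κ` and possibly
    -- one vertex below, and from each of them three sides of a cyclic face lead to `t₀`.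
    home-q : ∀ {y} → S (q , y) → y ≢ y₀ → Home q y
    home-q {y} s ne with m≤n⇒m<n∨m≡n (≤-pred (≤-trans s (≤-reflexive h-q)))
    ... | inj₂ refl = 3 , ←L (¬Right-S (n≤1+n p) s (prʸ-≡ {p} {y₀} p-y₀)) ∷⟨ S-in (base (n≤1+n p) ≤-refl) ⟩ landing ,
      s≤s (*-monoʳ-≤ 2 (≤-reflexive (sym (gap-+ 1 y₀))))
    ... | inj₁ l = 3 , subst (λ i → Run (q , y) (q , i) 3) e run ,
      s≤s (*-monoʳ-≤ 2 (≤-reflexive (sym (trans (cong (gap y) (sym e)) (gap-below y)))))
      where
      y<y₀ = ≤∧≢⇒< (≤-pred l) ne
      e : suc y ≡ y₀
      e = ≤-antisym y<y₀ (≤-trans y₀≤1 (s≤s z≤n))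
      odd : pr p (suc y) ≢ p₀
      odd = subst (λ i → pr p i ≢ p₀) (sym e) p-y₀
      even : pr p y ≡ p₀
      even = trans (sym (not-involutive _)) (trans (cong not (sym (prʸ p y))) (flip odd))
      sp : S (p , suc y)
      sp = base (n≤1+n p) (≤-trans y<y₀ (n≤1+n y₀))
      run : Run (q , y) (q , suc y) 3
      run = ←L (¬Right-S (n≤1+n p) s even) ∷⟨ S-in (<-trans ≤-refl sp) ⟩
        (↑U (Up-S (n≤1+n p) (<-trans ≤-refl sp) sp even) ∷⟨ S-in sp ⟩
          (→R (Right-S (n≤1+n p) sp (base ≤-refl (≤-trans y<y₀ (n≤1+n y₀))) odd) ∷⟨ S-in (base ≤-refl (≤-trans y<y₀ (n≤1+n y₀))) ⟩ []))

    y₀+2≤ : ∀ {x y} → x ≤ q → ¬ S (x , y) → suc (suc y₀) ≤ y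
    y₀+2≤ x≤ ¬s = ≤-trans (≤-reflexive (sym h-q)) (≤-trans (anti x≤) (≮⇒≥ ¬s))

    zero-or-suc : ∀ k → k ≡ 0 ⊎ Σ[ c ∈ ℕ ] suc c ≡ k
    zero-or-suc zero    = inj₁ refl
    zero-or-suc (suc c) = inj₂ (c , refl)

    home-right : ∀ {x y} → S (x , y) → ¬ S (suc x , y) → ¬ (x ≡ q × y ≡ y₀) → Home x y
    home-right {x} {y} s ¬s ne with m≤n⇒m<n∨m≡n (proj₁ (S-left s))
    ... | inj₂ refl = home-q s (λ e → ne (refl , e))
    ... | inj₁ (s≤s x≤p) with m≤n⇒m<n∨m≡n x≤p
    ...   | inj₂ x≡p with zero-or-suc p
    ...     | inj₁ p≡0 = contradiction (≤-trans s (≤-reflexive (subst (λ i → h i ≡ h (suc i)) (sym (trans x≡p p≡0)) h₀≡h₁))) ¬s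
    ...     | inj₂ (c , c+1≡p) = home₁ c+1≡p (inj₂ x≡p) (≤-trans (n≤1+n _) (y₀+2≤ (s≤s x≤p) ¬s)) (subst (λ i → S (i , y)) x≡p s)
    home-right {x} {y} s ¬s ne | inj₁ (s≤s x≤p) | inj₁ x<p with m≤n⇒m<n∨m≡n x<p
    ... | inj₁ l = contradiction (≤-trans s (≤-reflexive (flat (s≤s l)))) ¬s
    ... | inj₂ e with zero-or-suc x
    ...   | inj₁ refl = contradiction (≤-trans s (≤-reflexive h₀≡h₁)) ¬s
    ...   | inj₂ (c , refl) = home₂ e (inj₂ refl) (y₀+2≤ (s≤s x≤p) ¬s) s

    home-top : ∀ {x y} → S (x , y) → ¬ S (x , suc y) → suc y < m → Home x y
    home-top {x} {y} s ¬s y< with m≤n⇒m<n∨m≡n (proj₁ (S-left s)) | ≤-pred (y₀+2≤ (proj₁ (S-left s)) ¬s)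
    ... | inj₂ refl | l = home-q s (λ { refl → <⇒≱ l ≤-refl })
    ... | inj₁ (s≤s x≤p) | l with m≤n⇒m<n∨m≡n x≤p
    ...   | inj₁ x<p with tops x<p
    ...     | inj₁ e = contradiction (≤-trans y< (≤-reflexive (sym e))) ¬s
    ...     | inj₂ (e , e′) = home₁ e (inj₁ refl) l (≤-trans s (≤-reflexive e′))
    home-top {x} {y} s ¬s y< | inj₁ (s≤s x≤p) | l | inj₂ x≡p with zero-or-suc p
    ... | inj₂ (c , c+1≡p) = home₁ c+1≡p (inj₂ x≡p) l (subst (λ i → S (i , y)) x≡p s)
    ... | inj₁ p≡0 = 2 , subst₂ (λ i j → Run (i , j) t₀ 2) (sym x≡p) (sym y≡) landing ,
      ≤-trans (s≤s (s≤s z≤n)) (s≤s (*-monoʳ-≤ 2 (≤-reflexive (sym (trans (cong (λ i → gap i y₀) y≡) (gap-+ 1 y₀))))))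
      where
      y≡ : y ≡ suc y₀
      y≡ = ≤-antisym (≤-pred (≤-trans s (≤-reflexive (trans (cong h (trans x≡p p≡0)) (trans h₀≡h₁ (trans (cong (h ∘ suc) (sym p≡0)) h-q)))))) l

    home : ∀ {a c} → InB c → Step a c → S a → ¬ S c → Σ[ k ∈ ℕ ] (Run a t₀ k × k ≤ Φ c)
    home ic (→R {x} {y} r) s ¬s with home-right s ¬s (t₀-free r)
      where
      t₀-free : Right x y → ¬ (x ≡ q × y ≡ y₀)
      t₀-free (inj₁ (l , _)) = contradiction (proj₁ (S-left s)) (<⇒≱ l)
      t₀-free (inj₂ (_ , ne , _)) = ne
    ... | k , run , k≤ = k , run , ≤-trans k≤ (bound (suc x ≤? q))
      where
      bound : Dec (suc x ≤ q) → suc (2 * gap y y₀) ≤ Φ (suc x , y)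
      bound (yes l) = ≤-trans (m≤n+m _ (q ∸ x)) (≤-reflexive (sym (Φ-left {suc x} {y} l)))
      bound (no ¬l) = ≤-trans (s≤s (m≤m+n _ _)) (≤-reflexive (sym (Φ-right {suc x} {y} (≰⇒> ¬l))))
    home ic (←L {x} _) s ¬s = contradiction (≤-trans s (anti (n≤1+n x))) ¬s
    home ic (↑U {x} {y} _) s ¬s with home-top s ¬s (proj₂ ic)
    ... | k , run , k≤ = k , run , ≤-trans k≤ (≤-trans (s≤s (*-monoʳ-≤ 2 (gap-up (≤-trans (n≤1+n y₀) (≤-pred (y₀+2≤ x≤ ¬s))))))
      (≤-trans (m≤n+m _ (suc q ∸ x)) (≤-reflexive (sym (Φ-left {x} {suc y} x≤)))))
      where x≤ = proj₁ (S-left s)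
    home ic (↓D _) s ¬s = contradiction (<-trans ≤-refl s) ¬s

    -- All faces below the staircase are cyclic and linked to the one at `t₀` and `κ`. A vertex
    -- above the staircase is on a monotone run from the top of its column, up and then right into
    -- the part already filled.
    fill-left : ∀ {T} (hull : Hull T) → T t₀ → T κ → T γ → (∀ {x y} → InB (x , y) → q < x → T (x , y)) →
                ∀ {x y} → InB (x , y) → x ≤ q → T (x , y)
    fill-left {T} hull Tt Tκ _ TR {x} {y} i x≤ = all (y <? h x)
      where
      1<h : ∀ {x} → x ≤ q → 1 < h x
      1<h x≤ = base x≤ (s≤s z≤n)
      cyclic-below : ∀ {x y} → 0 ≤ x → x < q → y < pred (h (suc x)) → Cyclic x y × InB (suc x , suc y)
      cyclic-below {x} _ l y< = let s = <pred⇒suc< y<; s′ = ≤-trans s (anti (n≤1+n x)) in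
        cyclic-S (<-trans ≤-refl s′) (<-trans ≤-refl s) s′ s , S-in s
      module F = Faces hull 0 q (λ x → pred (h (suc x))) (λ _ l → suc<⇒<pred (1<h l)) cyclic-below
      y₀<h : y₀ < pred (h q)
      y₀<h = suc<⇒<pred (base ≤-refl ≤-refl)
      κ-face : Corners hull p y₀
      κ-face = from-east hull (cyclic-S (base (n≤1+n p) (n≤1+n y₀)) (base ≤-refl (n≤1+n y₀)) (base (n≤1+n p) ≤-refl) (base ≤-refl ≤-refl))
        (S-in (base ≤-refl ≤-refl)) Tt Tκ
      face-at : ∀ {x y} → x < q → suc y < h (suc x) → Corners hull x y
      face-at l l′ = F.spread z≤n ≤-refl y₀<h κ-face z≤n l (suc<⇒<pred l′)
      below : ∀ x y → S (x , y) → T (x , y)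
      below zero    zero    s = Corners.sw (face-at (s≤s z≤n) (1<h (s≤s z≤n)))
      below zero    (suc y) s = Corners.nw (face-at (s≤s z≤n) (≤-trans s (≤-reflexive h₀≡h₁)))
      below (suc x) zero    s = Corners.se (face-at (proj₁ (S-left s)) (1<h (proj₁ (S-left s))))
      below (suc x) (suc y) s = Corners.ne (face-at (proj₁ (S-left s)) s)
      all : Dec (S (x , y)) → T (x , y)
      all (yes s) = below x y s
      all (no ¬s) = between hull RU (below x (pred (h x)) top) (TR (in-R (proj₂ i)) ≤-refl)
        (up-run (inj₁ refl) (<⇒≤ top<y) (λ j l _ → inj₂ (x≤ , inj₂ (λ s → <⇒≱ s (≤-trans (≤-reflexive (sym h≡)) (s≤s l))))) i)
        (right-run (inj₁ refl) (m≤n⇒m≤1+n x≤)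
          (λ j l l′ → inj₂ (≤-pred l′ , (λ { (refl , refl) → ¬s (base x≤ (n≤1+n y₀)) }) ,
            inj₂ (λ s → ¬s (≤-trans s (anti (m≤n⇒m≤1+n l)))))) (in-R (proj₂ i)))
        where
        h≡ : suc (pred (h x)) ≡ h x
        h≡ = suc-pred (h x) ⦃ >-nonZero (<-trans (s≤s z≤n) (1<h x≤)) ⦄
        top : S (x , pred (h x))
        top = ≤-reflexive h≡
        top<y : pred (h x) < y
        top<y = ≤-trans (≤-reflexive h≡) (≮⇒≥ ¬s)
        in-R : ∀ {y} → y < m → InB (suc q , y)
        in-R l = <-trans ≤-refl p+3<n , l

    spectrum-low : StrongConvexitySpectrum (P n □ P m) (sum n h)
    spectrum-low = subst (StrongConvexitySpectrum _)
      (∣sub∣ {n} {m} S? (λ _ → 0) h (λ x _ → z≤n , ≤-trans (anti z≤n) h≤m) (λ _ _ s → s) (λ _ _ s → z≤n , s))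
      (Conclusion.two-phase-spectrum home fill-left)

  module _ (k H j y₀ e m : ℕ) (β≤j : suc (suc y₀) ≤ j) (j≤H : j ≤ H) (H≤m : H ≤ m) (y₀≤1 : y₀ ≤ 1)
           (y₀+2<m : suc (suc y₀) < m) where
    private
      h₂ h : ℕ → ℕ
      h₂ = 1 times j then 1 times suc (suc y₀) then (λ _ → 0)
      h  = k times H then h₂

    low-staircase : H ≡ m ⊎ (k ≤ 1 × H ≡ j) → h 0 ≡ h 1 →
      StrongConvexitySpectrum (P (k + suc (suc (suc (suc e)))) □ P m) (k * H + (j + suc (suc y₀)))
    low-staircase H-cond h₀≡h₁ = subst (StrongConvexitySpectrum _) total
      (LowStair.spectrum-low k y₀ (k + suc (suc (suc (suc e)))) m h
        (then-antitone k j≤H (then-antitone 1 β≤j (then-antitone 1 z≤n (λ _ → z≤n))))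
        (trans (cong h (+-comm 1 k)) (then-skip k 1))
        (trans (cong h (+-comm 2 k)) (then-skip k 2))
        y₀≤1 y₀+2<m (≤-trans (then-head k {H} {h₂} j≤H) H≤m) h₀≡h₁
        (λ {x} l → trans (then-< k (<-trans ≤-refl (≤-pred l))) (sym (then-< k {H} {h₂} (≤-pred l))))
        (tops H-cond)
        (≤-trans (≤-reflexive (+-comm 4 k)) (+-monoʳ-≤ k (s≤s (s≤s (s≤s (s≤s z≤n)))))))
      where
      tops : H ≡ m ⊎ (k ≤ 1 × H ≡ j) → ∀ {x} → x < k → h x ≡ m ⊎ (suc x ≡ k × h x ≡ h k)
      tops (inj₁ H≡m) x< = inj₁ (trans (then-< k x<) H≡m)
      tops (inj₂ (k≤1 , H≡j)) x< = inj₂ (≤-antisym x< (≤-trans k≤1 (s≤s z≤n)) ,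
        trans (then-< k x<) (trans H≡j (sym (trans (cong h (sym (+-identityʳ k))) (then-skip k 0)))))
      total : sum (k + suc (suc (suc (suc e)))) h ≡ k * H + (j + suc (suc y₀))
      total = trans (sum-then k _ {H} {h₂}) (cong (λ i → k * H + (j + i))
        (trans (cong (suc (suc y₀) +_) (trans (sum-const (suc (suc e)) {λ _ → 0} (λ _ _ → refl)) (*-zeroʳ (suc (suc e))))) (+-identityʳ _)))

-- The value 7 for n at least 5.

module Psi7 where

  open Core
  open GridD
  open Count
  open Psi
  open import Data.Nat.Base using (ℕ; zero; suc; _+_; _≤_; _<_; z≤n; s≤s)
  open import Data.Nat.Properties
  open import Data.Product.Base using (Σ-syntax; ∃-syntax; _×_; _,_; proj₁; proj₂)
  open import Data.Sum.Base using (inj₁; inj₂)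
  open import Function.Base using (_∘_)
  open import Relation.Binary.PropositionalEquality using (_≢_; refl; trans; cong; subst)
  open import Relation.Nullary using (¬_; Dec; yes; no; contradiction)

  -- S consists of two faces that share a vertex.
  module TwoFaces (ν μ : ℕ) where

    lo hi : ℕ → ℕ
    lo 2 = 1
    lo _ = 0
    hi 0 = 2
    hi 1 = 3
    hi 2 = 3
    hi _ = 0

    S : Pt → Set
    S (x , y) = lo x ≤ y × y < hi x

    S? : ∀ a → Dec (S a)
    S? (x , y) with lo x ≤? y | y <? hi x
    ... | yes p | yes q = yes (p , q)
    ... | no ¬p | _     = no (¬p ∘ proj₁)
    ... | _     | no ¬q = no (¬q ∘ proj₂)

    n m : ℕ
    n = 5 + ν
    m = 4 + μ

    pattern ≤0 = z≤n
    pattern ≤1 = s≤s ≤0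
    pattern ≤2 = s≤s ≤1
    pattern ≤3 = s≤s ≤2

    S-left : ∀ {x y} → S (x , y) → x ≤ 2 × y < m
    S-left {0} (_ , l) = z≤n , ≤-trans l ≤2
    S-left {1} (_ , l) = ≤1 , ≤-trans l ≤3
    S-left {2} (_ , l) = ≤2 , ≤-trans l ≤3
    S-left {suc (suc (suc x))} (_ , ())

    low : ∀ {x y} → x ≤ 2 → ¬ S (x , y) → ¬ S (x , suc y) → 1 ≤ y
    low {y = suc y} _ _ _ = ≤1
    low {0} {zero} _ ¬s _ = contradiction (z≤n , ≤1) ¬s
    low {1} {zero} _ ¬s _ = contradiction (z≤n , ≤1) ¬s
    low {2} {zero} _ _ ¬s = contradiction (≤1 , ≤2) ¬s
    low {suc (suc (suc x))} {zero} (s≤s (s≤s ())) _ _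

    below-top : ¬ S (2 , 3)
    below-top (_ , s≤s (s≤s (s≤s ())))

    open TwoPhase 2 1 n m S? S-left (≤1 , ≤2) (≤1 , ≤3) below-top (s≤s (s≤s (s≤s (s≤s (s≤s z≤n))))) (s≤s (s≤s (s≤s (s≤s z≤n)))) low

    in₀ : ∀ {x} → x ≤ 4 → InB (x , 0)
    in₀ l = s≤s (≤-trans l (m≤m+n 4 ν)) , ≤1
    in₁ : ∀ {x} → x ≤ 4 → InB (x , 1)
    in₁ l = s≤s (≤-trans l (m≤m+n 4 ν)) , ≤2
    in₂ : ∀ {x} → x ≤ 4 → InB (x , 2)
    in₂ l = s≤s (≤-trans l (m≤m+n 4 ν)) , ≤3
    in₃ : ∀ {x} → x ≤ 4 → InB (x , 3)
    in₃ l = s≤s (≤-trans l (m≤m+n 4 ν)) , s≤s ≤3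

    s00 : S (0 , 0)
    s00 = ≤0 , ≤1
    s01 : S (0 , 1)
    s01 = ≤0 , ≤2
    s10 : S (1 , 0)
    s10 = ≤0 , ≤1
    s11 : S (1 , 1)
    s11 = ≤0 , ≤2
    s12 : S (1 , 2)
    s12 = ≤0 , ≤3
    s21 : S (2 , 1)
    s21 = ≤1 , ≤2
    s22 : S (2 , 2)
    s22 = ≤1 , ≤3
    ¬s20 : ¬ S (2 , 0)
    ¬s20 (() , _)
    ¬s02 : ¬ S (0 , 2)
    ¬s02 (_ , s≤s (s≤s ()))
    ¬s3 : ∀ {x} → x ≤ 2 → ¬ S (x , 3)
    ¬s3 {0} _ (_ , s≤s (s≤s ()))
    ¬s3 {1} _ (_ , s≤s (s≤s (s≤s ())))
    ¬s3 {2} _ (_ , s≤s (s≤s (s≤s ())))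
    ¬s3 {suc (suc (suc x))} (s≤s (s≤s ())) _

    11→21 : Run (1 , 1) t₀ 1
    11→21 = →R (Right-S ≤1 s11 s21 (λ ())) ∷⟨ in₁ ≤2 ⟩ []
    10→11 : Step (1 , 0) (1 , 1)
    10→11 = ↑U (Up-S ≤1 s10 s11 refl)
    00→10 : Step (0 , 0) (1 , 0)
    00→10 = →R (Right-S ≤0 s00 s10 (λ ()))
    01→00 : Step (0 , 1) (0 , 0)
    01→00 = ↓D (¬Up-S ≤0 s01 (λ ()))
    11→01 : Step (1 , 1) (0 , 1)
    11→01 = ←L (¬Right-S ≤0 s11 refl)
    22→12 : Step (2 , 2) (1 , 2)
    22→12 = ←L (¬Right-S ≤1 s22 refl)
    12→11 : Step (1 , 2) (1 , 1)
    12→11 = ↓D (¬Up-S ≤1 s12 (λ ()))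

    from11 : Run (1 , 1) t₀ 1
    from11 = 11→21
    from12 : Run (1 , 2) t₀ 2
    from12 = 12→11 ∷⟨ in₁ ≤1 ⟩ from11
    from22 : Run (2 , 2) t₀ 3
    from22 = 22→12 ∷⟨ in₂ ≤1 ⟩ from12
    from10 : Run (1 , 0) t₀ 2
    from10 = 10→11 ∷⟨ in₁ ≤1 ⟩ from11
    from01 : Run (0 , 1) t₀ 4
    from01 = 01→00 ∷⟨ in₀ ≤0 ⟩ (00→10 ∷⟨ in₀ ≤1 ⟩ from10)

    home : ∀ {a c} → InB c → Step a c → S a → ¬ S c → Σ[ k ∈ ℕ ] (Run a t₀ k × k ≤ Φ c)
    home _ (→R {0} {0} _) _ ¬s = contradiction s10 ¬s
    home _ (→R {0} {1} _) _ ¬s = contradiction s11 ¬s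
    home _ (→R {0} {suc (suc y)} _) (_ , s≤s (s≤s ())) _
    home _ (→R {1} {0} _) _ _ = _ , from10 , ≤2
    home _ (→R {1} {1} _) _ ¬s = contradiction s21 ¬s
    home _ (→R {1} {2} _) _ ¬s = contradiction s22 ¬s
    home _ (→R {1} {suc (suc (suc y))} _) (_ , s≤s (s≤s (s≤s ()))) _
    home _ (→R {2} {0} _) (() , _) _
    home _ (→R {2} {1} (inj₁ (s≤s (s≤s ()) , _))) _ _
    home _ (→R {2} {1} (inj₂ (_ , ne , _))) _ _ = contradiction (refl , refl) ne
    home _ (→R {2} {2} _) _ _ = _ , from22 , ≤3
    home _ (→R {2} {suc (suc (suc y))} _) (_ , s≤s (s≤s (s≤s ()))) _
    home _ (→R {suc (suc (suc x))} _) (_ , ()) _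
    home _ (←L {0} {0} _) _ ¬s = contradiction s00 ¬s
    home _ (←L {0} {1} _) _ ¬s = contradiction s01 ¬s
    home _ (←L {0} {2} _) _ _ = _ , from12 , ≤2
    home _ (←L {0} {suc (suc (suc y))} _) (_ , s≤s (s≤s (s≤s ()))) _
    home _ (←L {1} {0} _) (() , _) _
    home _ (←L {1} {1} _) _ ¬s = contradiction s11 ¬s
    home _ (←L {1} {2} _) _ ¬s = contradiction s12 ¬s
    home _ (←L {1} {suc (suc (suc y))} _) (_ , s≤s (s≤s (s≤s ()))) _
    home _ (←L {suc (suc x)} _) (_ , ()) _
    home _ (↑U {0} {0} _) _ ¬s = contradiction s01 ¬s
    home _ (↑U {0} {1} _) _ _ = _ , from01 , s≤s ≤3
    home _ (↑U {0} {suc (suc y)} _) (_ , s≤s (s≤s ())) _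
    home _ (↑U {1} {0} _) _ ¬s = contradiction s11 ¬s
    home _ (↑U {1} {1} _) _ ¬s = contradiction s12 ¬s
    home _ (↑U {1} {2} _) _ _ = _ , from12 , ≤2
    home _ (↑U {1} {suc (suc (suc y))} _) (_ , s≤s (s≤s (s≤s ()))) _
    home _ (↑U {2} {0} _) (() , _) _
    home _ (↑U {2} {1} _) _ ¬s = contradiction s22 ¬s
    home _ (↑U {2} {2} _) _ _ = _ , from22 , ≤3
    home _ (↑U {2} {suc (suc (suc y))} _) (_ , s≤s (s≤s (s≤s ()))) _
    home _ (↑U {suc (suc (suc x))} _) (_ , ()) _
    home _ (↓D {0} _) (_ , l) ¬s = contradiction (z≤n , <-trans ≤-refl l) ¬s
    home _ (↓D {1} _) (_ , l) ¬s = contradiction (z≤n , <-trans ≤-refl l) ¬s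
    home _ (↓D {2} {0} _) _ _ = 0 , [] , z≤n
    home _ (↓D {2} {1} _) _ ¬s = contradiction s21 ¬s
    home _ (↓D {2} {suc (suc y)} _) (_ , s≤s (s≤s (s≤s ()))) _
    home _ (↓D {suc (suc (suc x))} _) (_ , ()) _

    ¬S-high : ∀ {x y} → 3 ≤ y → ¬ S (x , y)
    ¬S-high {0} l (_ , l′) = <⇒≱ (≤-trans l′ ≤2) l
    ¬S-high {1} l (_ , l′) = <⇒≱ l′ l
    ¬S-high {2} l (_ , l′) = <⇒≱ l′ l
    ¬S-high {suc (suc (suc x))} _ (_ , ())

    Right-out : ∀ {x y} → x ≤ 2 → (y ≢ 1) → ¬ S (suc x , y) → Right x y
    Right-out l ne ¬s = inj₂ (l , (λ { (_ , e) → ne e }) , inj₂ ¬s)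

    Up-out : ∀ {x y} → x ≤ 2 → ¬ S (x , suc y) → Up x y
    Up-out l ¬s = inj₂ (l , inj₂ ¬s)

    -- `t₀` and `κ` give the upper face. The edge between (1 , 1) and (1 , 2) points down, so the
    -- way from (1 , 1) to (1 , 3) around the left side is a geodesic. It contains (0 , 1), which
    -- gives the lower face.
    fill-left : ∀ {T} (hull : Hull T) → T t₀ → T κ → T γ → (∀ {x y} → InB (x , y) → 2 < x → T (x , y)) →
                ∀ {x y} → InB (x , y) → x ≤ 2 → T (x , y)
    fill-left {T} hull Tt Tκ Tγ TR = all
      where
      F₂ : Corners hull 1 1
      F₂ = from-east hull (cyclic-S s11 s21 s12 s22) (in₂ ≤2) Tt Tκ
      T13 : T (1 , 3)
      T13 = middle hull (Corners.nw F₂) Tγ (λ ()) (↑U (Up-out ≤1 (¬s3 ≤1))) (in₃ ≤1) (→R (Right-out ≤1 (λ ()) (¬s3 ≤2))) (in₃ ≤2)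
      side : T (0 , 1) × T (0 , 2) × T (0 , 3)
      side = detour hull (Corners.sw F₂) T13 (λ ()) no-shortcut 11→01 (in₁ ≤0)
        (↑U (Up-out ≤0 ¬s02)) (in₂ ≤0) (↑U (Up-out ≤0 (¬s3 ≤0))) (in₃ ≤0) (→R (Right-out ≤0 (λ ()) (¬s3 ≤1)))
        where
        no-shortcut : ∀ {a} → Step (1 , 1) a → ¬ Step a (1 , 3)
        no-shortcut (↑U (inj₁ (s≤s () , _))) (↑U _)
        no-shortcut (↑U (inj₂ (_ , inj₁ (_ , _ , ())))) (↑U _)
        no-shortcut (↑U (inj₂ (_ , inj₂ ¬s))) (↑U _) = ¬s s12
      F₁ : Corners hull 0 0
      F₁ = from-north hull (cyclic-S s00 s10 s01 s11) (in₁ ≤1) (proj₁ side) (Corners.sw F₂)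
      T20 : T (2 , 0)
      T20 = middle hull Tt (TR (in₀ ≤3) ≤3) (λ ())
        (↓D λ { (inj₁ (s≤s (s≤s ()) , _)) ; (inj₂ (_ , inj₁ (s , _))) → ¬s20 s ; (inj₂ (_ , inj₂ ¬s)) → ¬s s21 }) (in₀ ≤2)
        (→R (Right-out ≤2 (λ ()) (λ { (_ , ()) }))) (in₀ ≤3)
      T3 : ∀ {x} → x ≤ 2 → T (x , 3)
      T3 {0} _ = proj₂ (proj₂ side)
      T3 {1} _ = T13
      T3 {2} _ = Tγ
      T3 {suc (suc (suc x))} (s≤s (s≤s ()))
      all : ∀ {x y} → InB (x , y) → x ≤ 2 → T (x , y)
      all {0} {0} _ _ = Corners.sw F₁
      all {0} {1} _ _ = Corners.nw F₁
      all {0} {2} _ _ = proj₁ (proj₂ side)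
      all {1} {0} _ _ = Corners.se F₁
      all {1} {1} _ _ = Corners.ne F₁
      all {1} {2} _ _ = Corners.nw F₂
      all {2} {0} _ _ = T20
      all {2} {1} _ _ = Tt
      all {2} {2} _ _ = Tκ
      all {suc (suc (suc x))} {0} _ (s≤s (s≤s ()))
      all {suc (suc (suc x))} {1} _ (s≤s (s≤s ()))
      all {suc (suc (suc x))} {2} _ (s≤s (s≤s ()))
      all {x} {y@(suc (suc (suc _)))} (x< , y<) x≤ = between hull RU (T3 x≤) (TR (proj₁ (in₀ {3} ≤3) , y<) ≤-refl)
        (up-run (inj₁ refl) ≤3 (λ j l _ → Up-out x≤ (¬S-high (m≤n⇒m≤1+n l))) (x< , y<))
        (right-run (inj₁ refl) (m≤n⇒m≤1+n x≤) (λ j _ l → Right-out (≤-pred l) (λ ()) (¬S-high ≤3)) (proj₁ (in₀ {3} ≤3) , y<))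

    -- The low staircases that satisfy all conditions have 4, 6 or at least 8 vertices, so 7
    -- requires a shape of its own.
    two-faces-spectrum : StrongConvexitySpectrum (P n □ P m) 7
    two-faces-spectrum = subst (StrongConvexitySpectrum _) total (Conclusion.two-phase-spectrum home fill-left)
      where
      bounds : ∀ x → lo x ≤ hi x × hi x ≤ m
      bounds 0 = z≤n , ≤2
      bounds 1 = z≤n , ≤3
      bounds 2 = ≤1 , ≤3
      bounds (suc (suc (suc x))) = z≤n , z≤n
      total = trans (∣sub∣ {n} {m} S? lo hi (λ x _ → bounds x) (λ _ p q → p , q) (λ _ _ s → s))
        (cong (7 +_) (trans (sum-const (2 + ν) {λ _ → 0} (λ _ _ → refl)) (*-zeroʳ (2 + ν))))

-- The value 1.

module Cyc where

  open Core
  open GridD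
  open Count
  open import Data.Bool.Base using (not)
  open import Data.Bool.Properties using (not-involutive; not-¬; ¬-not) renaming (_≟_ to _≟ᵇ_)
  open import Data.Nat.Base using (ℕ; zero; suc; _≤_; _<_; z≤n; s≤s)
  open import Data.Nat.Properties
  open import Data.Product.Base using (Σ-syntax; ∃-syntax; _×_; _,_; proj₁; proj₂)
  open import Data.Product.Properties using (≡-dec)
  open import Data.Sum.Base using (inj₁)
  open import Relation.Binary.PropositionalEquality using (_≡_; _≢_; refl; sym; trans; cong; subst)
  open import Relation.Nullary using (Dec; yes; no; contradiction)
  open import Relation.Nullary.Decidable using (¬?)

  -- Every face is a directed cycle.
  module AllCyclic (ν μ : ℕ) where

    Right Up : ℕ → ℕ → Set
    Right x y = isEven x ≡ isEven y
    Up x y    = isEven x ≢ isEven y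

    right? : ∀ x y → Dec (Right x y)
    right? x y = isEven x ≟ᵇ isEven y

    up? : ∀ x y → Dec (Up x y)
    up? x y = ¬? (isEven x ≟ᵇ isEven y)

    n m : ℕ
    n = suc (suc ν)
    m = suc (suc μ)

    open OrientedGrid n m right? up?

    cyclic : ∀ x y → Cyclic x y
    cyclic x y with isEven x ≟ᵇ isEven y
    ... | yes e = ccw e (λ e′ → not-¬ (sym e) (sym e′)) (λ e′ → not-¬ e e′) (λ ne → ne e)
    ... | no ne = cw ne (λ f → f (trans (cong not (¬-not ne)) (not-involutive _))) (¬-not ne) ne

    S : Pt → Set
    S a = a ≡ (0 , 0)

    S? : ∀ a → Dec (S a)
    S? a = ≡-dec _≟_ _≟_ a (0 , 0)

    -- Two adjacent vertices lie on a common face, and neighbouring cyclic faces pass on a common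
    -- edge. So only single vertices are proper convex sets.
    fill : ∀ {T} (hull : Hull T) {a c} → T a → T c → Step a c → ∀ a → InB a → T a
    fill {T} hull Ta Tc s = all
      where
      open Hull hull
      cyclic-in : ∀ {x y} → 0 ≤ x → x < suc ν → y < suc μ → Cyclic x y × InB (suc x , suc y)
      cyclic-in {x} {y} _ l l′ = cyclic x y , (s≤s l , s≤s l′)
      module F = Faces hull 0 (suc ν) (λ _ → suc μ) (λ _ _ → s≤s z≤n) cyclic-in
      Face : Set
      Face = Σ[ x ∈ ℕ ] Σ[ y ∈ ℕ ] (x < suc ν × y < suc μ × Corners hull x y)
      horizontal : ∀ {x} y → T (x , y) → T (suc x , y) → Face
      horizontal {x} zero t u = x , 0 , ≤-pred (proj₁ (inb u)) , s≤s z≤n , from-south hull (cyclic x 0) (proj₁ (inb u) , s≤s (s≤s z≤n)) t u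
      horizontal {x} (suc y) t u = x , y , ≤-pred (proj₁ (inb u)) , ≤-pred (proj₂ (inb u)) , from-north hull (cyclic x y) (inb u) t u
      vertical : ∀ x {y} → T (x , y) → T (x , suc y) → Face
      vertical zero {y} t u = 0 , y , s≤s z≤n , ≤-pred (proj₂ (inb u)) , from-west hull (cyclic 0 y) (s≤s (s≤s z≤n) , proj₂ (inb u)) t u
      vertical (suc x) {y} t u = x , y , ≤-pred (proj₁ (inb u)) , ≤-pred (proj₂ (inb u)) , from-east hull (cyclic x y) (inb u) t u
      start : ∀ {a c} → T a → T c → Step a c → Face
      start t u (→R {x} {y} _) = horizontal y t u
      start t u (←L {x} {y} _) = horizontal y u t
      start t u (↑U {x} {y} _) = vertical x t u
      start t u (↓D {x} {y} _) = vertical x u t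
      face-at : ∀ {x y} → x < suc ν → y < suc μ → Corners hull x y
      face-at l l′ with start Ta Tc s
      ... | _ , _ , p , q , c = F.spread z≤n p q c z≤n l l′
      all : ∀ a → InB a → T a
      all (zero , zero) _ = Corners.sw (face-at (s≤s z≤n) (s≤s z≤n))
      all (zero , suc y) (_ , l) = Corners.nw (face-at (s≤s z≤n) (≤-pred l))
      all (suc x , zero) (l , _) = Corners.se (face-at (≤-pred l) (s≤s z≤n))
      all (suc x , suc y) (l , l′) = Corners.ne (face-at (≤-pred l) (≤-pred l′))

    strong : Strong D
    strong = hull⇒strong {0 , 0} {1 , 0} (s≤s z≤n , s≤s z≤n)
      (_ , →R refl ∷⟨ s≤s (s≤s z≤n) , s≤s z≤n ⟩ [])
      (_ , ↑U (λ ()) ∷⟨ s≤s (s≤s z≤n) , s≤s (s≤s z≤n) ⟩ (←L (λ ()) ∷⟨ s≤s z≤n , s≤s (s≤s z≤n) ⟩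
        (↓D (λ ne → ne refl) ∷⟨ s≤s z≤n , s≤s z≤n ⟩ [])))
      (λ hull To Tc → fill hull To Tc (→R refl))

    cyclic-spectrum : StrongConvexitySpectrum (P n □ P m) 1
    cyclic-spectrum = subst (StrongConvexitySpectrum _) total
      (spectrum S? strong (λ { _ refl ¬Sb refl [] _ → contradiction refl ¬Sb ; _ refl _ refl (_ ∷⟨ _ ⟩ _) _ → 0 , [] , s≤s z≤n })
        ((0 , 0) , (s≤s z≤n , s≤s z≤n) , refl) ((1 , 0) , (s≤s (s≤s z≤n) , s≤s z≤n) , λ ())
        (λ hull _ Tc _ Td ne → let e , Te , s , _ = successor ne (Hull.conn hull Tc Td) in inj₁ (fill hull Tc Te s)))
      where
      hi : ℕ → ℕ
      hi zero    = 1
      hi (suc _) = 0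
      total = trans (∣sub∣ {n} {m} S? (λ _ → 0) hi (λ { zero _ → z≤n , s≤s z≤n ; (suc _) _ → z≤n , z≤n })
          (λ { {zero} {zero} _ _ _ → refl ; {zero} {suc y} _ _ (s≤s ()) ; {suc x} _ _ () })
          (λ { _ _ refl → z≤n , s≤s z≤n }))
        (cong suc (trans (sum-const (suc ν) {λ _ → 0} (λ _ _ → refl)) (*-zeroʳ (suc ν))))

-- Search trees over local facts, and their soundness.

module Window where

  open Core
  open import Data.Fin.Base using (Fin; toℕ; zero; suc)
  open import Data.Fin.Properties using (toℕ-injective) renaming (_≟_ to _≟ᶠ_; any? to any?ᶠ)
  open import Data.Fin.Subset using (Subset; ∁; ∣_∣; ⁅_⁆) renaming (_∈_ to _∈ˢ_; _∉_ to _∉ˢ_; _-_ to _without_)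
  open import Data.Fin.Subset.Properties using (_∈?_; x∈p⇒∣p-x∣<∣p∣; x∈p∧x≢y⇒x∈p-y; x∉p⇒x∈∁p; p─⊥≡p; p─q⊆p; nonempty?; Empty-unique; ∣⊥∣≡0)
  open import Data.Vec.Base using ([]; _∷_; here; there)
  open import Data.Bool.Base using (Bool; true; false)
  import Data.Bool.Properties as Bool
  open import Data.List.Base using (List; []; _∷_; map; filter; deduplicate) renaming (length to count)
  open import Data.List.Membership.Propositional using (_∈_; find)
  open import Data.List.Membership.Propositional.Properties using (∈-map⁻; ∈-filter⁻; ∈-deduplicate⁻)
  open import Data.List.Relation.Unary.All as All using (All; []; _∷_)
  open import Data.List.Relation.Unary.Any using (Any; here; there; any?)
  open import Data.List.Relation.Unary.AllPairs using ([]; _∷_)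
  open import Data.List.Relation.Unary.Unique.Propositional using (Unique)
  open import Data.List.Relation.Unary.Unique.DecPropositional.Properties using (deduplicate-!)
  import Data.List.Membership.DecPropositional as DecMembership
  open import Data.Nat.Base using (ℕ; zero; suc; pred; _+_; _*_; _∸_; _⊓_; _⊔_; _≤_; _<_; z≤n; s≤s; ∣_-_∣)
  open import Data.Nat.Properties
  open import Data.Product.Base using (Σ-syntax; ∃-syntax; _×_; _,_; proj₁; proj₂)
  open import Data.Product.Properties using (≡-dec)
  open import Data.Sum.Base using (_⊎_; inj₁; inj₂; [_,_]; [_,_]′)
  open import Data.Empty using (⊥)
  open import Function.Base using (_∘_)
  open import Relation.Binary.Construct.Closure.ReflexiveTransitive using (ε; _◅_)
  open import Relation.Binary.Definitions using (DecidableEquality)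
  open import Relation.Binary.PropositionalEquality using (_≡_; _≢_; refl; sym; trans; cong; cong₂; subst; subst₂)
  open import Relation.Nullary using (¬_; Dec; yes; no; contradiction)
  open import Relation.Nullary.Decidable using (_×-dec_; _⊎-dec_; map′)

  data Move : Set where
    l r d u : Move

  -- The part of one axis known to lie on the grid. A flag says that the grid is known to end there;
  -- `false` means that nothing is known.
  record Interval : Set where
    constructor interval
    field
      lo hi : ℕ
      loWall hiWall : Bool

  open Interval

  -- Neither an absolute position nor the size of the grid occurs, so one search serves all n and m.
  -- `limit` bounds the number of outside vertices on the paths already excluded.
  record Facts : Set where
    constructor facts
    field
      limit     : ℕ
      cols rows : Interval
      cells     : List (Pt × Bool)
      arcs      : List (Pt × Pt)

  open Facts

  -- `wall`, `cell` and `edge` branch; the other constructors close a branch. The numbers and moves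
  -- they carry locate the contradiction, so that checking a tree involves no search for it.
  data Tree : Set where
    wall : Move → Tree → Tree → Tree
    cell : ℕ → ℕ → Tree → Tree → Tree
    edge : ℕ → ℕ → Move → Tree → Tree → Tree
    detour : ℕ → ℕ → List Move → List Move → Tree
    short : ℕ → ℕ → List Move → Tree
    trap source : List Pt → Tree
    stuck unreached : ℕ → ℕ → Tree
    crowd clash : Tree

  _≟ᵖ_ : DecidableEquality Pt
  _≟ᵖ_ = ≡-dec _≟_ _≟_

  infix 4 _∈cells?_ _∈arcs?_

  _∈cells?_ = DecMembership._∈?_ (≡-dec _≟ᵖ_ Bool._≟_)
  _∈arcs?_ = DecMembership._∈?_ (≡-dec _≟ᵖ_ _≟ᵖ_)

  go : Move → Pt → Pt
  go l (x , y) = pred x , y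
  go r (x , y) = suc x , y
  go d (x , y) = x , pred y
  go u (x , y) = x , suc y

  gos : List Move → Pt → Pt
  gos []       p = p
  gos (μ ∷ μs) p = gos μs (go μ p)

  dist : Pt → Pt → ℕ
  dist (x , y) (x′ , y′) = ∣ x - x′ ∣ + ∣ y - y′ ∣

  lowWall highWall lower higher : Interval → Interval
  lowWall  i = record i { loWall = true }
  highWall i = record i { hiWall = true }
  lower  (interval lo hi _ b) = interval (pred lo) hi false b
  higher (interval lo hi b _) = interval lo (suc hi) b false

  closed opened : Move → Facts → Facts
  closed l  s = record s { cols = lowWall (cols s) }
  closed r  s = record s { cols = highWall (cols s) }
  closed d s = record s { rows = lowWall (rows s) }
  closed u s = record s { rows = highWall (rows s) }
  opened l  s = record s { cols = lower (cols s) }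
  opened r  s = record s { cols = higher (cols s) }
  opened d s = record s { rows = lower (rows s) }
  opened u s = record s { rows = higher (rows s) }

  -- `pred` stops at 0, so a window grows to the left or downwards only while its lower index is
  -- positive. In the other directions 0 ≤ 0 serves as a decidable truth.
  HasRoom : Move → Facts → Set
  HasRoom l  s = 0 < lo (cols s)
  HasRoom d s = 0 < lo (rows s)
  HasRoom r  s = 0 ≤ 0
  HasRoom u s = 0 ≤ 0

  hasRoom? : ∀ w s → Dec (HasRoom w s)
  hasRoom? l  s = 0 <? lo (cols s)
  hasRoom? d s = 0 <? lo (rows s)
  hasRoom? r  s = 0 ≤? 0
  hasRoom? u s = 0 ≤? 0

  Within Beyond Below : Interval → ℕ → Set
  Within i x = lo i ≤ x × x ≤ hi i
  Beyond i x = hiWall i ≡ true × hi i < x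
  Below  i x = loWall i ≡ true × x < lo i

  On : Facts → Pt → Set
  On s (x , y) = Within (cols s) x × Within (rows s) y

  on? : ∀ s p → Dec (On s p)
  on? s (x , y) = within? (cols s) x ×-dec within? (rows s) y
    where
    within? : ∀ i x → Dec (Within i x)
    within? i x = (lo i ≤? x) ×-dec (x ≤? hi i)

  Inner : Pt → Set
  Inner (x , y) = 0 < x × 0 < y

  inner? : ∀ p → Dec (Inner p)
  inner? (x , y) = (0 <? x) ×-dec (0 <? y)

  Trail : List (Pt × Pt) → Pt → List Move → Set
  Trail as p []       = 0 ≤ 0
  Trail as p (μ ∷ μs) = (p , go μ p) ∈ as × Trail as (go μ p) μs

  trail? : ∀ as p μs → Dec (Trail as p μs)
  trail? as p []       = 0 ≤? 0
  trail? as p (μ ∷ μs) = ((p , go μ p) ∈arcs? as) ×-dec trail? as (go μ p) μs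

  Escape : Facts → Pt → List Move → Set
  Escape s p []       = (p , true) ∈ cells s
  Escape s p (μ ∷ μs) = (p , false) ∈ cells s × (p , go μ p) ∈ arcs s × Escape s (go μ p) μs

  escape? : ∀ s p μs → Dec (Escape s p μs)
  escape? s p []       = (p , true) ∈cells? cells s
  escape? s p (μ ∷ μs) = ((p , false) ∈cells? cells s) ×-dec ((p , go μ p) ∈arcs? arcs s) ×-dec escape? s (go μ p) μs

  -- Both coordinates are successors, so that the left and the lower neighbour are not distorted by
  -- truncation.
  data Blocked (s : Facts) (Q : Pt → Set) : Pt → Set where
    blocked : ∀ {x y} →
              Beyond (cols s) (suc (suc x)) ⊎ Q (suc (suc x) , suc y) → Below (cols s) x ⊎ Q (x , suc y) →
              Beyond (rows s) (suc (suc y)) ⊎ Q (suc x , suc (suc y)) → Below (rows s) y ⊎ Q (suc x , y) →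
              Blocked s Q (suc x , suc y)

  blocked? : ∀ s {Q : Pt → Set} → (∀ p → Dec (Q p)) → ∀ p → Dec (Blocked s Q p)
  blocked? s Q? (zero , y) = no λ ()
  blocked? s Q? (suc x , zero) = no λ ()
  blocked? s Q? (suc x , suc y) =
    map′ (λ (e , w , n , s) → blocked e w n s) (λ { (blocked e w n s) → e , w , n , s })
      ((beyond? (cols s) (suc (suc x)) ⊎-dec Q? _) ×-dec (below? (cols s) x ⊎-dec Q? _) ×-dec
       (beyond? (rows s) (suc (suc y)) ⊎-dec Q? _) ×-dec (below? (rows s) y ⊎-dec Q? _))
    where
    beyond? : ∀ i x → Dec (Beyond i x)
    beyond? i x = (hiWall i Bool.≟ true) ×-dec (hi i <? x)
    below? : ∀ i x → Dec (Below i x)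
    below? i x = (loWall i Bool.≟ true) ×-dec (x <? lo i)

  _∈?ᵖ_ = DecMembership._∈?_ _≟ᵖ_

  exterior : Facts → List Pt
  exterior s = deduplicate _≟ᵖ_ (map proj₁ (filter (λ (p , c) → (c Bool.≟ false) ×-dec on? s p) (cells s)))

  -- Both walls are known and at most k vertices fit between them. With k outside vertices this
  -- contradicts that the complement is smaller than either side of the grid; here the bounds for m
  -- = 4 and m = 5 enter.
  Narrow : Interval → ℕ → Set
  Narrow i k = loWall i ≡ true × hiWall i ≡ true × hi i < k + lo i

  narrow? : ∀ i k → Dec (Narrow i k)
  narrow? i k = (loWall i Bool.≟ true) ×-dec (hiWall i Bool.≟ true) ×-dec (hi i <? k + lo i)

  include : ℕ → Interval → Interval
  include x (interval lo hi b c) = interval (lo ⊓ x) (hi ⊔ x) b c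

  around : Pt → Facts → Facts
  around (x , y) s = record s { cols = include x (cols s) ; rows = include y (rows s) }

  known : Pt → Bool → Facts → Facts
  known p c s = record s { cells = (p , c) ∷ cells s }

  _⟶_∣_ : Pt → Pt → Facts → Facts
  p ⟶ q ∣ s = record s { arcs = (p , q) ∷ arcs s }

  Valid : Tree → Facts → Set
  Valid (wall w t t′)    s = HasRoom w s × Valid t (closed w s) × Valid t′ (opened w s)
  -- Only the first branch enlarges the window: a vertex of `S` is on the grid, a point not in `S`
  -- need not be.
  Valid (cell x y t t′)  s = Valid t (around (x , y) (known (x , y) true s)) × Valid t′ (known (x , y) false s)
  Valid (edge x y μ t t′) s = let p = x , y; q = go μ p in
    On s p × On s q × Inner p × Valid t (p ⟶ q ∣ s) × Valid t′ (q ⟶ p ∣ s)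
  -- A directed walk whose length is the distance of its ends in the undirected grid is a geodesic.
  Valid (detour x y μs νs) s = let p = x , y; q = gos μs p in
    (p , true) ∈ cells s × (q , false) ∈ cells s × (gos νs q , true) ∈ cells s ×
    Trail (arcs s) p μs × Trail (arcs s) q νs × count μs + count νs ≡ dist p (gos νs q)
  Valid (short x y [])   s = ⊥
  Valid (short x y (μ ∷ μs)) s = let p = x , y in
    (p , true) ∈ cells s × (p , go μ p) ∈ arcs s × (go μ p , false) ∈ cells s × Escape s (go μ p) μs × count μs ≤ limit s
  Valid (trap [])        s = ⊥
  -- Each neighbour of a listed point is off the grid, listed, or known to send its arc into the
  -- list. The first point witnesses that the list contains a vertex.
  Valid (trap (p ∷ ps))  s = On s p ×
    All (λ q → (q , false) ∈ cells s × Blocked s (λ q′ → q′ ∈ p ∷ ps ⊎ (q′ , q) ∈ arcs s) q) (p ∷ ps)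
  Valid (source [])      s = ⊥
  Valid (source (p ∷ ps)) s = On s p ×
    All (λ q → (q , false) ∈ cells s × Blocked s (λ q′ → q′ ∈ p ∷ ps ⊎ (q , q′) ∈ arcs s) q) (p ∷ ps)
  Valid (stuck x y)      s = let p = x , y in
    (p , true) ∈ cells s × Blocked s (λ q → (q , false) ∈ cells s ⊎ (q , p) ∈ arcs s) p
  Valid (unreached x y)  s = let p = x , y in
    (p , true) ∈ cells s × Blocked s (λ q → (q , false) ∈ cells s ⊎ (p , q) ∈ arcs s) p
  Valid crowd            s =
    5 < count (exterior s) ⊎ Narrow (cols s) (count (exterior s)) ⊎ Narrow (rows s) (count (exterior s))
  Valid clash            s =
    Any (λ (p , c) → c ≡ true × (p , false) ∈ cells s) (cells s) ⊎ Any (λ (p , q) → (q , p) ∈ arcs s) (arcs s)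

  valid? : ∀ t s → Dec (Valid t s)
  valid? (wall w t t′)    s = hasRoom? w s ×-dec valid? t (closed w s) ×-dec valid? t′ (opened w s)
  valid? (cell x y t t′)  s = valid? t (around (x , y) (known (x , y) true s)) ×-dec valid? t′ (known (x , y) false s)
  valid? (edge x y μ t t′) s = let p = x , y; q = go μ p in
    on? s p ×-dec on? s q ×-dec inner? p ×-dec valid? t (p ⟶ q ∣ s) ×-dec valid? t′ (q ⟶ p ∣ s)
  valid? (detour x y μs νs) s = let p = x , y; q = gos μs p in
    ((p , true) ∈cells? cells s) ×-dec ((q , false) ∈cells? cells s) ×-dec ((gos νs q , true) ∈cells? cells s) ×-dec
    trail? (arcs s) p μs ×-dec trail? (arcs s) q νs ×-dec (count μs + count νs ≟ dist p (gos νs q))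
  valid? (short x y [])   s = no λ ()
  valid? (short x y (μ ∷ μs)) s = let p = x , y in
    ((p , true) ∈cells? cells s) ×-dec ((p , go μ p) ∈arcs? arcs s) ×-dec ((go μ p , false) ∈cells? cells s) ×-dec
    escape? s (go μ p) μs ×-dec (count μs ≤? limit s)
  valid? (trap [])        s = no λ ()
  valid? (trap (p ∷ ps))  s = on? s p ×-dec All.all? (λ q → ((q , false) ∈cells? cells s) ×-dec
    blocked? s (λ q′ → (q′ ∈?ᵖ (p ∷ ps)) ⊎-dec ((q′ , q) ∈arcs? arcs s)) q) (p ∷ ps)
  valid? (source [])      s = no λ ()
  valid? (source (p ∷ ps)) s = on? s p ×-dec All.all? (λ q → ((q , false) ∈cells? cells s) ×-dec
    blocked? s (λ q′ → (q′ ∈?ᵖ (p ∷ ps)) ⊎-dec ((q , q′) ∈arcs? arcs s)) q) (p ∷ ps)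
  valid? (stuck x y)      s = let p = x , y in ((p , true) ∈cells? cells s) ×-dec
    blocked? s (λ q → ((q , false) ∈cells? cells s) ⊎-dec ((q , p) ∈arcs? arcs s)) p
  valid? (unreached x y)  s = let p = x , y in ((p , true) ∈cells? cells s) ×-dec
    blocked? s (λ q → ((q , false) ∈cells? cells s) ⊎-dec ((p , q) ∈arcs? arcs s)) p
  valid? crowd            s =
    (5 <? count (exterior s)) ⊎-dec narrow? (cols s) (count (exterior s)) ⊎-dec narrow? (rows s) (count (exterior s))
  valid? clash            s =
    any? (λ (p , c) → (c Bool.≟ true) ×-dec ((p , false) ∈cells? cells s)) (cells s) ⊎-dec
    any? (λ (p , q) → (q , p) ∈arcs? arcs s) (arcs s)

  data Leg : Set where
    enter pass leave : Leg

  -- The neighbours of a point through which a path passes are outside.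
  shield : Pt → Facts → Facts
  shield p s = known (go l p) false (known (go r p) false (known (go d p) false (known (go u p) false s)))

  follow : Leg → Pt → Move → Facts → Facts
  follow ℓ p μ s = around (go μ p) (target ℓ (p ⟶ go μ p ∣ s))
    where
    target : Leg → Facts → Facts
    target enter = known (go μ p) false
    target pass  = known (go μ p) false ∘ shield p
    target leave = known (go μ p) true

  -- The moves of the path are enumerated before anything else is branched on, so the tree can be
  -- chosen by the shape of the path.
  Explored : List Leg → Pt → Facts → (List Move → Tree) → Set
  Explored []       p s cert = Valid (cert []) s
  Explored (ℓ ∷ ℓs) p s cert =
    Inner p × All (λ μ → Explored ℓs (go μ p) (follow ℓ p μ s) (cert ∘ (μ ∷_))) (l ∷ r ∷ d ∷ u ∷ [])

  explored? : ∀ ℓs p s cert → Dec (Explored ℓs p s cert)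
  explored? []       p s cert = valid? (cert []) s
  explored? (ℓ ∷ ℓs) p s cert =
    inner? p ×-dec All.all? (λ μ → explored? ℓs (go μ p) (follow ℓ p μ s) (cert ∘ (μ ∷_))) (l ∷ r ∷ d ∷ u ∷ [])

  Unique⇒count≤ : ∀ {N} {S : Subset N} (vs : List (Fin N)) → Unique vs → All (_∈ˢ S) vs → count vs ≤ ∣ S ∣
  Unique⇒count≤ []       _        _        = z≤n
  Unique⇒count≤ {S = S} (v ∷ vs) (v∉ ∷ un) (v∈ ∷ vs∈) =
    ≤-trans (s≤s (Unique⇒count≤ vs un (shrink vs v∉ vs∈))) (x∈p⇒∣p-x∣<∣p∣ v∈)
    where
    shrink : ∀ ws → All (v ≢_) ws → All (_∈ˢ S) ws → All (_∈ˢ S without v) ws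
    shrink []       _          _           = []
    shrink (w ∷ ws) (ne ∷ nes) (w∈ ∷ ws∈) = x∈p∧x≢y⇒x∈p-y w∈ (ne ∘ sym) ∷ shrink ws nes ws∈

  ∣S∣≤1+∣S-v∣ : ∀ {N} (S : Subset N) v → ∣ S ∣ ≤ suc ∣ S without v ∣
  ∣S∣≤1+∣S-v∣ (true  ∷ S) zero    = s≤s (≤-reflexive (cong ∣_∣ (sym (p─⊥≡p S))))
  ∣S∣≤1+∣S-v∣ (false ∷ S) zero    = m≤n⇒m≤1+n (≤-reflexive (cong ∣_∣ (sym (p─⊥≡p S))))
  ∣S∣≤1+∣S-v∣ (true  ∷ S) (suc v) = s≤s (∣S∣≤1+∣S-v∣ S v)
  ∣S∣≤1+∣S-v∣ (false ∷ S) (suc v) = ∣S∣≤1+∣S-v∣ S v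

  v∉S-v : ∀ {N} (S : Subset N) v → v ∉ˢ S without v
  v∉S-v (_ ∷ S) zero    ()
  v∉S-v (_ ∷ S) (suc v) (there v∈) = v∉S-v S v v∈

  another : ∀ {N} {S : Subset N} (vs : List (Fin N)) → count vs < ∣ S ∣ → ∃[ w ] (w ∈ˢ S × All (w ≢_) vs)
  another {N} {S} [] lt with nonempty? S
  ... | yes (w , w∈) = w , w∈ , []
  ... | no empty = contradiction (subst (λ T → 0 < ∣ T ∣) (Empty-unique empty) lt) (<⇒≱ (s≤s (≤-reflexive (∣⊥∣≡0 N))))
  another {S = S} (v ∷ vs) lt with another {S = S without v} vs (≤-pred (≤-trans lt (∣S∣≤1+∣S-v∣ S v)))
  ... | w , w∈ , ne = w , p─q⊆p S ⁅ v ⁆ w∈ , (λ { refl → v∉S-v S v w∈ }) ∷ ne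

  module _ {n m : ℕ} (D : Orientation (P n □ P m)) where

    open Coordinates n m
    open Digraph D

    Beside : Pt → Pt → Set
    Beside (x , y) (x′ , y′) = (x ≡ x′ × (suc y ≡ y′ ⊎ suc y′ ≡ y)) ⊎ ((suc x ≡ x′ ⊎ suc x′ ≡ x) × y ≡ y′)

    arc⇒beside : ∀ {v w} → Arc v w → Beside (co v) (co w)
    arc⇒beside a with arc⇒adj a
    ... | inj₁ (e , b) = inj₁ (cong toℕ e , b)
    ... | inj₂ (b , e) = inj₂ (b , cong toℕ e)

    beside-sym : ∀ {p q} → Beside p q → Beside q p
    beside-sym (inj₁ (e , inj₁ f)) = inj₁ (sym e , inj₂ f)
    beside-sym (inj₁ (e , inj₂ f)) = inj₁ (sym e , inj₁ f)
    beside-sym (inj₂ (inj₁ f , e)) = inj₂ (inj₂ f , sym e)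
    beside-sym (inj₂ (inj₂ f , e)) = inj₂ (inj₁ f , sym e)

    beside⇒arc : ∀ {v w} → Beside (co v) (co w) → Arc v w ⊎ Arc w v
    beside⇒arc (inj₁ (e , b)) = adj⇒arc (inj₁ (toℕ-injective e , b))
    beside⇒arc (inj₂ (b , e)) = adj⇒arc (inj₂ (b , toℕ-injective e))

    dist≤len : ∀ {v w} (p : Walk D v w) → dist (co v) (co w) ≤ len p
    dist≤len {v} ε = ≤-reflexive (cong₂ _+_ (∣n-n∣≡0 (proj₁ (co v))) (∣n-n∣≡0 (proj₂ (co v))))
    dist≤len {v} {w} (_◅_ {j = j} a p) =
      ≤-trans (triangle (co v) (co j) (co w)) (+-mono-≤ (one (co v) (co j) (arc⇒beside a)) (dist≤len p))
      where
      triangle : ∀ a b c → dist a c ≤ dist a b + dist b c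
      triangle (x , y) (x′ , y′) (x″ , y″) =
        ≤-trans (+-mono-≤ (∣-∣-triangle x x′ x″) (∣-∣-triangle y y′ y″))
                (≤-reflexive (exchange (∣ x - x′ ∣) _ _ _))
        where
        exchange : ∀ a b c e → (a + b) + (c + e) ≡ (a + c) + (b + e)
        exchange a b c e = trans (+-assoc a b _) (trans (cong (a +_) (trans (sym (+-assoc b c e))
          (trans (cong (_+ e) (+-comm b c)) (+-assoc c b e)))) (sym (+-assoc a c _)))
      step : ∀ x → ∣ x - suc x ∣ ≤ 1
      step x = ≤-reflexive (trans (∣-∣-comm x (suc x)) (trans (cong (λ k → ∣ k - x ∣) (+-comm 1 x)) (∣m+n-m∣≡n x 1)))
        where
        ∣m+n-m∣≡n : ∀ a b → ∣ a + b - a ∣ ≡ b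
        ∣m+n-m∣≡n a b = trans (∣-∣-comm (a + b) a) (∣m-m+n∣≡n a b)
      one : ∀ a b → Beside a b → dist a b ≤ 1
      one (x , y) (.x , .(suc y)) (inj₁ (refl , inj₁ refl)) rewrite ∣n-n∣≡0 x = step y
      one (x , .(suc y)) (.x , y) (inj₁ (refl , inj₂ refl)) rewrite ∣n-n∣≡0 x | ∣-∣-comm (suc y) y = step y
      one (x , y) (.(suc x) , .y) (inj₂ (inj₁ refl , refl)) rewrite ∣n-n∣≡0 y | +-identityʳ ∣ x - suc x ∣ = step x
      one (.(suc x) , y) (x , .y) (inj₂ (inj₂ refl , refl)) rewrite ∣n-n∣≡0 y | +-identityʳ ∣ suc x - x ∣ | ∣-∣-comm (suc x) x = step x

    module Inhabited {S : Subset (n * m)} (st : Strong D) (cx : Convex D S)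
                     {s₀ s₁} (s₀∈ : s₀ ∈ˢ S) (s₁∈ : s₁ ∈ˢ S) (s₀≢s₁ : s₀ ≢ s₁) where

      other : ∀ v → ∃[ s ] (s ∈ˢ S × s ≢ v)
      other v with v ≟ᶠ s₀
      ... | yes refl = s₁ , s₁∈ , s₀≢s₁ ∘ sym
      ... | no ne    = s₀ , s₀∈ , ne ∘ sym

      out-neighbour : ∀ {v} → v ∈ˢ S → ∃[ w ] (w ∈ˢ S × Arc v w)
      out-neighbour {v} v∈ with other v
      ... | s , s∈ , ne with convex⇒walkIn st cx v∈ s∈
      ...   | []             = contradiction refl ne
      ...   | (arc , w∈) ∷ _ = _ , w∈ , arc

      in-neighbour : ∀ {v} → v ∈ˢ S → ∃[ w ] (w ∈ˢ S × Arc w v)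
      in-neighbour {v} v∈ with other v
      ... | s , s∈ , ne = last s∈ ne (convex⇒walkIn st cx s∈ v∈)
        where
        last : ∀ {s} → s ∈ˢ S → s ≢ v → WalkIn (_∈ˢ S) s v → ∃[ w ] (w ∈ˢ S × Arc w v)
        last s∈ ne [] = contradiction refl ne
        last s∈ ne (_∷_ {v = w} (arc , w∈) p) with w ≟ᶠ v
        ... | yes refl = _ , s∈ , arc
        ... | no ne′   = last w∈ ne′ p

    -- The index counts the vertices outside `S` from `v` on until the return to `S`.
    data Out (S : Subset (n * m)) : ℕ → Fin (n * m) → Set where
      here  : ∀ {v} → v ∈ˢ S → Out S 0 v
      there : ∀ {v w k} → v ∉ˢ S → Arc v w → Out S k w → Out S (suc k) v

    Unescaped : Subset (n * m) → ℕ → Set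
    Unescaped S k = ∀ {v w j} → v ∈ˢ S → Arc v w → w ∉ˢ S → Out S j w → ¬ j ≤ k

    data Legs (S : Subset (n * m)) : List Leg → Fin (n * m) → Set where
      []    : ∀ {v} → Legs S [] v
      enter : ∀ {v w ℓs} → Arc v w → w ∉ˢ S → Legs S ℓs w → Legs S (enter ∷ ℓs) v
      pass  : ∀ {v w ℓs} → (∀ z → Beside (co v) (co z) → z ∉ˢ S) → Arc v w → Legs S ℓs w → Legs S (pass ∷ ℓs) v
      leave : ∀ {v w ℓs} → Arc v w → w ∈ˢ S → Legs S ℓs w → Legs S (leave ∷ ℓs) v

    -- The point (i , j) of the window stands for the vertex with coordinates (a + i ∸ K , b + j ∸ K).
    module Refutation (K a b : ℕ) {S : Subset (n * m)} (st : Strong D) (cx : Convex D S)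
                      {s₀ s₁} (s₀∈ : s₀ ∈ˢ S) (s₁∈ : s₁ ∈ˢ S) (s₀≢s₁ : s₀ ≢ s₁)
                      (few : ∣ ∁ S ∣ ≤ 5) (few-n : ∣ ∁ S ∣ < n) (few-m : ∣ ∁ S ∣ < m)
                      {k} (unescaped : Unescaped S k) where

      open Inhabited st cx s₀∈ s₁∈ s₀≢s₁

      -- Adding `K` on one side avoids truncated subtraction for points to the left of and below the
      -- start.
      At : Pt → Fin (n * m) → Set
      At (i , j) v = proj₁ (co v) + K ≡ a + i × proj₂ (co v) + K ≡ b + j

      at-unique : ∀ {p v w} → At p v → At p w → v ≡ w
      at-unique (e , f) (e′ , f′) = co-injective
        (cong₂ _,_ (+-cancelʳ-≡ K _ _ (trans e (sym e′))) (+-cancelʳ-≡ K _ _ (trans f (sym f′))))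

      at-injective : ∀ {p q v} → At p v → At q v → p ≡ q
      at-injective (e , f) (e′ , f′) = cong₂ _,_ (+-cancelˡ-≡ a _ _ (trans (sym e) e′)) (+-cancelˡ-≡ b _ _ (trans (sym f) f′))

      record Holds-in (n a : ℕ) (i : Interval) : Set where
        field
          above : K ≤ a + lo i
          under : a + hi i < n + K
          low   : loWall i ≡ true → a + lo i ≡ K
          high  : hiWall i ≡ true → suc (a + hi i) ≡ n + K

      -- A point known to be outside may lie off the grid.
      HoldsCell : Pt × Bool → Set
      HoldsCell (p , true)  = ∃[ v ] (At p v × v ∈ˢ S)
      HoldsCell (p , false) = ∀ {v} → At p v → v ∉ˢ S

      HoldsArc : Pt × Pt → Set
      HoldsArc (p , q) = ∃[ v ] ∃[ w ] (At p v × At q w × Arc v w)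

      record Holds (s : Facts) : Set where
        constructor holds
        field
          limit-hold : limit s ≤ k
          cols-hold  : Holds-in n a (cols s)
          rows-hold  : Holds-in m b (rows s)
          cells-hold : All HoldsCell (cells s)
          arcs-hold  : All HoldsArc (arcs s)

      open Holds

      in-at : ∀ {s p v} → Holds s → (p , true) ∈ cells s → At p v → v ∈ˢ S
      in-at h p∈ at with All.lookup (cells-hold h) p∈
      ... | w , at′ , w∈ = subst (_∈ˢ S) (at-unique at′ at) w∈

      out-at : ∀ {s p v} → Holds s → (p , false) ∈ cells s → At p v → v ∉ˢ S
      out-at h p∈ = All.lookup (cells-hold h) p∈

      arc-at : ∀ {s p q v w} → Holds s → (p , q) ∈ arcs s → At p v → At q w → Arc v w
      arc-at h pq∈ atv atw with All.lookup (arcs-hold h) pq∈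
      ... | v , w , atv′ , atw′ , arc = subst₂ Arc (at-unique atv′ atv) (at-unique atw′ atw) arc

      private
        lowWall-holds : ∀ {n a i} → Holds-in n a i → a + lo i ≡ K → Holds-in n a (lowWall i)
        lowWall-holds h e = record { Holds-in h ; low = λ _ → e }

        highWall-holds : ∀ {n a i} → Holds-in n a i → suc (a + hi i) ≡ n + K → Holds-in n a (highWall i)
        highWall-holds h e = record { Holds-in h ; high = λ _ → e }

        lower-holds : ∀ {n a i} → 0 < lo i → Holds-in n a i → a + lo i ≢ K → Holds-in n a (lower i)
        lower-holds {a = a} {interval (suc k) _ _ _} _ h ne = record
          { above = ≤-pred (subst (suc K ≤_) (+-suc a k) (≤∧≢⇒< (Holds-in.above h) (ne ∘ sym)))
          ; under = Holds-in.under h ; low = λ () ; high = Holds-in.high h }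

        higher-holds : ∀ {n a i} → Holds-in n a i → suc (a + hi i) ≢ n + K → Holds-in n a (higher i)
        higher-holds {n} {a} {i} h ne = record
          { above = Holds-in.above h
          ; under = subst (_< n + K) (sym (+-suc a (hi i))) (≤∧≢⇒< (Holds-in.under h) ne)
          ; low = Holds-in.low h ; high = λ () }

        wall-cases : ∀ w s → HasRoom w s → Holds s → Holds (closed w s) ⊎ Holds (opened w s)
        wall-cases l s room h with a + lo (cols s) ≟ K
        ... | yes e = inj₁ (record { Holds h ; cols-hold = lowWall-holds (cols-hold h) e })
        ... | no ne = inj₂ (record { Holds h ; cols-hold = lower-holds room (cols-hold h) ne })
        wall-cases r s _ h with suc (a + hi (cols s)) ≟ n + K
        ... | yes e = inj₁ (record { Holds h ; cols-hold = highWall-holds (cols-hold h) e })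
        ... | no ne = inj₂ (record { Holds h ; cols-hold = higher-holds (cols-hold h) ne })
        wall-cases d s room h with b + lo (rows s) ≟ K
        ... | yes e = inj₁ (record { Holds h ; rows-hold = lowWall-holds (rows-hold h) e })
        ... | no ne = inj₂ (record { Holds h ; rows-hold = lower-holds room (rows-hold h) ne })
        wall-cases u s _ h with suc (b + hi (rows s)) ≟ m + K
        ... | yes e = inj₁ (record { Holds h ; rows-hold = highWall-holds (rows-hold h) e })
        ... | no ne = inj₂ (record { Holds h ; rows-hold = higher-holds (rows-hold h) ne })

        coordinate : ∀ {n a i x} → Holds-in n a i → Within i x → Σ[ z ∈ ℕ ] (z < n × z + K ≡ a + x)
        coordinate {n} {a} {i} {x} h (lo≤ , ≤hi) =
          a + x ∸ K , +-cancelʳ-< K _ _ (subst (_< n + K) (sym e) (≤-<-trans (+-monoʳ-≤ a ≤hi) (Holds-in.under h))) , e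
          where e = m∸n+n≡m (≤-trans (Holds-in.above h) (+-monoʳ-≤ a lo≤))

        on-at : ∀ {s} p → Holds s → On s p → ∃[ v ] At p v
        on-at p h (cx , cy) =
          let x , x< , ex = coordinate (cols-hold h) cx
              y , y< , ey = coordinate (rows-hold h) cy
              e = co-at (x< , y<)
          in at (x< , y<) , trans (cong (λ q → proj₁ q + K) e) ex , trans (cong (λ q → proj₂ q + K) e) ey

        go-beside : ∀ {p v w} μ → Inner p → At p v → At (go μ p) w → Beside (co v) (co w)
        go-beside {suc x , y} l _ (e , f) (e′ , f′) = inj₂
          (inj₂ (+-cancelʳ-≡ K _ _ (trans (cong suc e′) (trans (sym (+-suc a x)) (sym e)))) , +-cancelʳ-≡ K _ _ (trans f (sym f′)))
        go-beside {x , y} r _ (e , f) (e′ , f′) = inj₂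
          (inj₁ (+-cancelʳ-≡ K _ _ (trans (cong suc e) (trans (sym (+-suc a x)) (sym e′)))) , +-cancelʳ-≡ K _ _ (trans f (sym f′)))
        go-beside {x , suc y} d _ (e , f) (e′ , f′) = inj₁
          (+-cancelʳ-≡ K _ _ (trans e (sym e′)) , inj₂ (+-cancelʳ-≡ K _ _ (trans (cong suc f′) (trans (sym (+-suc b y)) (sym f)))))
        go-beside {x , y} u _ (e , f) (e′ , f′) = inj₁
          (+-cancelʳ-≡ K _ _ (trans e (sym e′)) , inj₁ (+-cancelʳ-≡ K _ _ (trans (cong suc f) (trans (sym (+-suc b y)) (sym f′)))))

        beside-go : ∀ {p v w} → Inner p → At p v → Beside (co v) (co w) → Σ[ μ ∈ Move ] At (go μ p) w
        beside-go {p} (s≤s _ , s≤s _) (e , f) (inj₁ (g , inj₁ g′)) = u , trans (cong (_+ K) (sym g)) e ,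
          trans (cong (_+ K) (sym g′)) (trans (cong suc f) (sym (+-suc b _)))
        beside-go {p} (s≤s _ , s≤s _) (e , f) (inj₁ (g , inj₂ g′)) = d , trans (cong (_+ K) (sym g)) e ,
          suc-injective (trans (cong (_+ K) g′) (trans f (+-suc b _)))
        beside-go {p} (s≤s _ , s≤s _) (e , f) (inj₂ (inj₁ g′ , g)) = r ,
          trans (cong (_+ K) (sym g′)) (trans (cong suc e) (sym (+-suc a _))) , trans (cong (_+ K) (sym g)) f
        beside-go {p} (s≤s _ , s≤s _) (e , f) (inj₂ (inj₂ g′ , g)) = l ,
          suc-injective (trans (cong (_+ K) g′) (trans e (+-suc a _))) , trans (cong (_+ K) (sym g)) f

        trail-walk : ∀ {s v} p μs → Holds s → At p v → Trail (arcs s) p μs →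
                     ∃[ w ] (At (gos μs p) w × Σ[ q ∈ Walk D v w ] len q ≡ count μs)
        trail-walk p []       h at _ = _ , at , ε , refl
        trail-walk p (μ ∷ μs) h at (pq∈ , tr) with All.lookup (arcs-hold h) pq∈
        ... | v , w , atv , atw , arc with trail-walk (go μ p) μs h atw tr
        ...   | z , atz , q , e = z , atz , subst (λ v → Arc v w) (at-unique atv at) arc ◅ q , cong suc e

        dist-at : ∀ {p q v w} → At p v → At q w → dist (co v) (co w) ≡ dist p q
        dist-at {i , j} {i′ , j′} {v} {w} (e , f) (e′ , f′) = cong₂ _+_ (side a e e′) (side b f f′)
          where
          side : ∀ a {x x′ i i′} → x + K ≡ a + i → x′ + K ≡ a + i′ → ∣ x - x′ ∣ ≡ ∣ i - i′ ∣
          side a {x} {x′} {i} {i′} e e′ = trans (sym (∣m+n-m+o∣≡∣n-o∣ K x x′))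
            (trans (cong₂ ∣_-_∣ (trans (+-comm K x) e) (trans (+-comm K x′) e′)) (∣m+n-m+o∣≡∣n-o∣ a i i′))

        beyond : ∀ {n a i x z} → Holds-in n a i → Beyond i x → z < n → z + K ≢ a + x
        beyond {n} {a} {i} {x} h (c , hi<) z< eq = <-irrefl refl (<-≤-trans (+-monoˡ-< K z<)
          (≤-trans (≤-reflexive (sym (Holds-in.high h c))) (≤-trans (≤-reflexive (sym (+-suc a (hi i))))
            (≤-trans (+-monoʳ-≤ a hi<) (≤-reflexive (sym eq))))))

        below : ∀ {n a i x z} → Holds-in n a i → Below i x → z + K ≢ a + x
        below {n} {a} {i} {x} {z} h (c , <lo) eq = <-irrefl {z + K} refl
          (<-≤-trans (subst (_< a + lo i) (sym eq) (+-monoʳ-< a <lo))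
            (≤-trans (≤-reflexive (Holds-in.low {n} {a} {i} h c)) (m≤n+m K z)))

        blocked-arc : ∀ {s p v w} {Q : Pt → Set} → Holds s → Blocked s Q p → At p v → Beside (co v) (co w) →
                      Σ[ q ∈ Pt ] (Q q × At q w)
        blocked-arc {w = w} h (blocked E W N S) at nb with beside-go (s≤s z≤n , s≤s z≤n) at nb
        ... | r , at′ = [ (λ c → contradiction (proj₁ at′) (beyond (cols-hold h) c (proj₁ (co-in w)))) , (λ c → _ , c , at′) ] E
        ... | l , at′ = [ (λ c → contradiction (proj₁ at′) (below (cols-hold h) c)) , (λ c → _ , c , at′) ] W
        ... | u , at′ = [ (λ c → contradiction (proj₂ at′) (beyond (rows-hold h) c (proj₂ (co-in w)))) , (λ c → _ , c , at′) ] N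
        ... | d , at′ = [ (λ c → contradiction (proj₂ at′) (below (rows-hold h) c)) , (λ c → _ , c , at′) ] S

        Marked : List Pt → Fin (n * m) → Set
        Marked ps v = ∃[ p ] (p ∈ ps × At p v)

        listed : ∀ ps → Unique ps → All (λ p → ∃[ v ] (At p v × v ∉ˢ S)) ps →
                 ∃[ vs ] (count vs ≡ count ps × Unique vs × All (_∉ˢ S) vs × All (Marked ps) vs)
        listed []       _         _                      = [] , refl , [] , [] , []
        listed (p ∷ ps) (p∉ ∷ un) ((v , at , v∉) ∷ all) =
          let vs , e , un′ , out , marks = listed ps un all in
          v ∷ vs , cong suc e ,
          All.map (λ { (q , q∈ , at′) refl → All.lookup p∉ q∈ (at-injective at at′) }) marks ∷ un′ ,
          v∉ ∷ out , (p , here refl , at) ∷ All.map (λ (q , q∈ , at′) → q , there q∈ , at′) marks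

        crowded : ∀ {s} → Holds s → count (exterior s) ≤ ∣ ∁ S ∣
        crowded {s} h =
          let vs , e , un , out , _ = listed (exterior s) (deduplicate-! _≟ᵖ_ _) (All.tabulate outside) in
          subst (_≤ ∣ ∁ S ∣) e (Unique⇒count≤ vs un (All.map x∉p⇒x∈∁p out))
          where
          outside : ∀ {p} → p ∈ exterior s → ∃[ v ] (At p v × v ∉ˢ S)
          outside p∈ with ∈-map⁻ proj₁ (∈-deduplicate⁻ _≟ᵖ_ _ p∈)
          ... | (p , c) , pc∈ , refl with ∈-filter⁻ (λ (p , c) → (c Bool.≟ false) ×-dec on? s p) {xs = cells s} pc∈
          ...   | pc∈′ , refl , on = let v , at = on-at p h on in v , at , out-at h pc∈′ at

        narrow : ∀ {n a i} k → Holds-in n a i → Narrow i k → k < n → ⊥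
        narrow {n} {a} {i} k h (lw , hw , lt) k< = <-irrefl refl (<-≤-trans (+-monoˡ-< K k<)
          (≤-trans (≤-reflexive (sym (Holds-in.high h hw))) (≤-trans (≤-reflexive (sym (+-suc a (hi i))))
            (≤-trans (+-monoʳ-≤ a lt) (≤-reflexive (trans (sym (+-assoc a k (lo i)))
              (trans (cong (_+ lo i) (+-comm a k)) (trans (+-assoc k a (lo i)) (cong (k +_) (Holds-in.low h lw)))))))))) 

        include-holds : ∀ {n a i x z} → Holds-in n a i → z < n → z + K ≡ a + x → Holds-in n a (include x i)
        include-holds {n} {a} {interval lo hi lw hw} {x} {z} h z< e = record
          { above = [ (λ le → subst (λ q → K ≤ a + q) (sym (m≤n⇒m⊓n≡m le)) (Holds-in.above h))
                    , (λ le → subst (λ q → K ≤ a + q) (sym (m≥n⇒m⊓n≡n le)) K≤) ]′ (≤-total lo x)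
          ; under = [ (λ le → subst (λ q → a + q < n + K) (sym (m≤n⇒m⊔n≡n le)) <n)
                    , (λ le → subst (λ q → a + q < n + K) (sym (m≥n⇒m⊔n≡m le)) (Holds-in.under h)) ]′ (≤-total hi x)
          ; low   = λ w → trans (cong (a +_) (m≤n⇒m⊓n≡m
                      (+-cancelˡ-≤ a lo x (≤-trans (≤-reflexive (Holds-in.low h w)) K≤)))) (Holds-in.low h w)
          ; high  = λ w → trans (cong (λ q → suc (a + q)) (m≥n⇒m⊔n≡m
                      (+-cancelˡ-≤ a x hi (≤-pred (≤-trans <n (≤-reflexive (sym (Holds-in.high h w)))))))) (Holds-in.high h w)
          }
          where
          K≤ : K ≤ a + x
          K≤ = subst (K ≤_) e (m≤n+m K z)
          <n : a + x < n + K
          <n = subst (_< n + K) e (+-monoˡ-< K z<)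

        around-holds : ∀ {s p v} → Holds s → At p v → Holds (around p s)
        around-holds {v = v} h (e , f) = record
          { Holds h
          ; cols-hold = include-holds (cols-hold h) (proj₁ (co-in v)) e
          ; rows-hold = include-holds (rows-hold h) (proj₂ (co-in v)) f
          }

        known-in : ∀ {s p v} → Holds s → At p v → v ∈ˢ S → Holds (known p true s)
        known-in h at v∈ = record { Holds h ; cells-hold = (_ , at , v∈) ∷ cells-hold h }

        known-out : ∀ {s p} → Holds s → (∀ {v} → At p v → v ∉ˢ S) → Holds (known p false s)
        known-out h out = record { Holds h ; cells-hold = out ∷ cells-hold h }

        known-arc : ∀ {s p q v w} → Holds s → At p v → At q w → Arc v w → Holds (p ⟶ q ∣ s)
        known-arc h atv atw arc = record { Holds h ; arcs-hold = (_ , _ , atv , atw , arc) ∷ arcs-hold h }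

        escape-out : ∀ {s v} p μs → Holds s → At p v → Escape s p μs → Out S (count μs) v
        escape-out p []       h at p∈ = here (in-at h p∈ at)
        escape-out p (μ ∷ μs) h at (p∉ , pq∈ , esc) with All.lookup (arcs-hold h) pq∈
        ... | v , w , atv , atw , arc =
          there (out-at h p∉ at) (subst (λ v → Arc v w) (at-unique atv at) arc) (escape-out (go μ p) μs h atw esc)

      refute : ∀ t {s} → Holds s → ¬ Valid t s
      refute (wall w t t′) h (room , v , v′) with wall-cases w _ room h
      ... | inj₁ h′ = refute t h′ v
      ... | inj₂ h′ = refute t′ h′ v′
      refute (cell x y t t′) {s} h (v , v′) with any?ᶠ (λ w → at? w ×-dec (w ∈? S))
        where
        at? : ∀ w → Dec (At (x , y) w)
        at? w = (proj₁ (co w) + K ≟ a + x) ×-dec (proj₂ (co w) + K ≟ b + y)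
      ... | yes (w , at , w∈) = refute t (around-holds (known-in h at w∈) at) v
      ... | no none = refute t′ (known-out h λ at w∈ → none (_ , at , w∈)) v′
      refute (edge x y μ t t′) h (onp , onq , inner , v , v′) with on-at (x , y) h onp | on-at (go μ (x , y)) h onq
      ... | w , atw | z , atz with beside⇒arc (go-beside μ inner atw atz)
      ...   | inj₁ arc = refute t (known-arc h atw atz arc) v
      ...   | inj₂ arc = refute t′ (known-arc h atz atw arc) v′
      refute (detour x y μs νs) h (p∈ , c∉ , q∈ , tr , tr′ , e) with All.lookup (cells-hold h) p∈
      ... | v , atv , v∈ with trail-walk (x , y) μs h atv tr
      ...   | c , atc , P₁ , e₁ with trail-walk (gos μs (x , y)) νs h atc tr′
      ...     | w , atw , P₂ , e₂ = out-at h c∉ atc (convex-closed cx v∈ (in-at h q∈ atw) P₁ P₂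
        (λ z → ≤-trans (≤-reflexive (trans (cong₂ _+_ e₁ e₂) (trans e (sym (dist-at atv atw))))) (dist≤len z)))
      refute (short x y (μ ∷ μs)) h (p∈ , pq∈ , q∉ , esc , le) with All.lookup (arcs-hold h) pq∈
      ... | v , w , atv , atw , arc =
        unescaped (in-at h p∈ atv) arc (out-at h q∉ atw) (escape-out _ μs h atw esc) (≤-trans le (limit-hold h))
      -- A walk leads from `v` to `s₀` in `S`, and its step off the list would run against a known
      -- arc.
      refute (trap (p ∷ ps)) h (on , all) with on-at p h on
      ... | v , atv = run (proj₁ (st v s₀)) (p , here refl , atv)
        where
        run : ∀ {v} → Walk D v s₀ → ¬ Marked (p ∷ ps) v
        run ε (q , q∈ , atq) = out-at h (proj₁ (All.lookup all q∈)) atq s₀∈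
        run (arc ◅ w) (q , q∈ , atq) with blocked-arc h (proj₂ (All.lookup all q∈)) atq (arc⇒beside arc)
        ... | z , inj₁ z∈ , atz = run w (z , z∈ , atz)
        ... | z , inj₂ a∈ , atz = arc-asym arc (arc-at h a∈ atz atq)
      -- The mirror image: a walk from `s₀` would have to step onto the list against a known arc.
      refute (source (p ∷ ps)) {s} h (on , all) with on-at p h on
      ... | v , atv = contradiction (p , here refl , atv) (run (proj₁ (st s₀ v)) s₀-free)
        where
        s₀-free : ¬ Marked (p ∷ ps) s₀
        s₀-free (q , q∈ , atq) = out-at h (proj₁ (All.lookup all q∈)) atq s₀∈
        run : ∀ {v w} → Walk D v w → ¬ Marked (p ∷ ps) v → ¬ Marked (p ∷ ps) w
        run ε ¬mv = ¬mv
        run {v} (_◅_ {j = j} arc w) ¬mv = run w λ { (q , q∈ , atq) →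
          entered q q∈ atq (blocked-arc h (proj₂ (All.lookup all q∈)) atq (beside-sym (arc⇒beside arc))) }
          where
          entered : ∀ q → q ∈ p ∷ ps → At q j → ¬ (Σ[ z ∈ Pt ] ((z ∈ p ∷ ps ⊎ (q , z) ∈ arcs s) × At z v))
          entered q q∈ atq (z , inj₁ z∈ , atz) = ¬mv (z , z∈ , atz)
          entered q q∈ atq (z , inj₂ a∈ , atz) = arc-asym arc (arc-at h a∈ atq atz)
      refute (stuck x y) h (p∈ , bl) with All.lookup (cells-hold h) p∈
      ... | v , atv , v∈ with out-neighbour v∈
      ...   | w , w∈ , arc with blocked-arc h bl atv (arc⇒beside arc)
      ...     | z , inj₁ z∉ , atz = out-at h z∉ atz w∈
      ...     | z , inj₂ a∈ , atz = arc-asym arc (arc-at h a∈ atz atv)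
      refute (unreached x y) h (p∈ , bl) with All.lookup (cells-hold h) p∈
      ... | v , atv , v∈ with in-neighbour v∈
      ...   | w , w∈ , arc with blocked-arc h bl atv (beside-sym (arc⇒beside arc))
      ...     | z , inj₁ z∉ , atz = out-at h z∉ atz w∈
      ...     | z , inj₂ a∈ , atz = arc-asym arc (arc-at h a∈ atv atz)
      refute crowd {s} h (inj₁ lt) = <⇒≱ lt (≤-trans (crowded h) few)
      refute crowd {s} h (inj₂ (inj₁ nw)) =
        narrow (count (exterior s)) (cols-hold h) nw (≤-<-trans (crowded h) few-n)
      refute crowd {s} h (inj₂ (inj₂ nw)) =
        narrow (count (exterior s)) (rows-hold h) nw (≤-<-trans (crowded h) few-m)
      refute clash h (inj₁ c) with find c
      ... | (p , _) , p∈ , refl , p∉ = let v , at , v∈ = All.lookup (cells-hold h) p∈ in out-at h p∉ at v∈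
      refute clash h (inj₂ c) with find c
      ... | (p , q) , pq∈ , qp∈ with All.lookup (arcs-hold h) pq∈
      ...   | v , w , atv , atw , arc = arc-asym arc (arc-at h qp∈ atw atv)

      shield-holds : ∀ {s p v} → Holds s → Inner p → At p v → (∀ z → Beside (co v) (co z) → z ∉ˢ S) → Holds (shield p s)
      shield-holds h inner at alone =
        known-out (known-out (known-out (known-out h (out u)) (out d)) (out r)) (out l)
        where
        out : ∀ μ {z} → At (go μ _) z → z ∉ˢ S
        out μ at′ = alone _ (go-beside μ inner at at′)

      move∈ : ∀ μ → μ ∈ l ∷ r ∷ d ∷ u ∷ []
      move∈ l = here refl
      move∈ r = there (here refl)
      move∈ d = there (there (here refl))
      move∈ u = there (there (there (here refl)))

      explore : ∀ ℓs {p s v cert} → Holds s → At p v → Legs S ℓs v → ¬ Explored ℓs p s cert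
      explore []       h at []                  val           = refute _ h val
      explore (_ ∷ ℓs) h at (enter arc w∉ legs) (inner , all) with beside-go inner at (arc⇒beside arc)
      ... | μ , at′ = explore ℓs (around-holds (known-out (known-arc h at at′ arc) λ at″ → subst (_∉ˢ S) (at-unique at′ at″) w∉) at′)
                        at′ legs (All.lookup all (move∈ μ))
      explore (_ ∷ ℓs) h at (leave arc w∈ legs) (inner , all) with beside-go inner at (arc⇒beside arc)
      ... | μ , at′ = explore ℓs (around-holds (known-in (known-arc h at at′ arc) at′ w∈) at′) at′ legs (All.lookup all (move∈ μ))
      explore (_ ∷ ℓs) h at (pass alone arc legs) (inner , all) with beside-go inner at (arc⇒beside arc)
      ... | μ , at′ = explore ℓs (around-holds (known-out (shield-holds (known-arc h at at′ arc) inner at alone)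
                        λ at″ → subst (_∉ˢ S) (at-unique at′ at″) (alone _ (arc⇒beside arc))) at′)
                        at′ legs (All.lookup all (move∈ μ))

-- The 4 × 4 grid: three orientations checked by evaluation.

module Small where

  open Core
  open Window using (another)
  open GridD
  open import Data.Fin.Base using (Fin)
  open import Data.Fin.Subset using (Subset; ∣_∣) renaming (_∈_ to _∈ˢ_)
  open import Data.List.Base using (List; []; _∷_; filter; upTo; cartesianProduct; map) renaming (length to count)
  open import Data.List.Membership.Propositional using (_∈_)
  open import Data.List.Membership.Propositional.Properties using (∈-cartesianProduct⁺; ∈-upTo⁺; ∈-filter⁻; ∈-cartesianProduct⁻; ∈-upTo⁻)
  import Data.List.Membership.DecPropositional as DecMembership
  open import Data.List.Relation.Unary.All as All using (All; []; _∷_)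
  open import Data.List.Relation.Unary.Any as Any using (Any; here; there; any?)
  open import Data.List.Membership.Propositional using (find)
  open import Data.Nat.Base using (ℕ; zero; suc; _+_; _*_; _/_; _%_; _≤_; _<_; z≤n; s≤s)
  open import Data.Nat.Properties
  open import Data.Product.Base using (Σ-syntax; ∃-syntax; _×_; _,_; proj₁; proj₂)
  open import Data.Product.Properties using (≡-dec)
  open import Data.Sum.Base using (_⊎_; inj₁; inj₂)
  open import Relation.Binary.PropositionalEquality using (_≡_; _≢_; refl; sym; trans; cong; subst)
  open import Relation.Nullary using (¬_; Dec; yes; no; contradiction)
  open import Relation.Nullary.Decidable using (_×-dec_; _⊎-dec_; ¬?; map′; toWitness; toWitnessFalse)

  private
    _≟ᵖ_ = ≡-dec _≟_ _≟_

  open DecMembership _≟ᵖ_ using (_∈?_)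

  module Tabulated (n m : ℕ) {Right Up : ℕ → ℕ → Set} (right? : ∀ x y → Dec (Right x y)) (up? : ∀ x y → Dec (Up x y))
                   {S : Pt → Set} (S? : ∀ a → Dec (S a)) (d : Pt → Pt → ℕ) (rounds : ℕ)
                   (grid : List Pt) (∈grid : ∀ {a} → Coordinates.InB n m a → a ∈ grid)
                   (grid-in : ∀ {a} → a ∈ grid → Coordinates.InB n m a) where

    open OrientedGrid n m right? up?

    step? : ∀ a b → Dec (Step a b)
    step? a@(x , y) b@(x′ , y′) = map′
      (λ { (inj₁ (refl , p)) → →R p ; (inj₂ (inj₁ (refl , p))) → ←L p
         ; (inj₂ (inj₂ (inj₁ (refl , p)))) → ↑U p ; (inj₂ (inj₂ (inj₂ (refl , p)))) → ↓D p })
      (λ { (→R p) → inj₁ (refl , p) ; (←L p) → inj₂ (inj₁ (refl , p))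
         ; (↑U p) → inj₂ (inj₂ (inj₁ (refl , p))) ; (↓D p) → inj₂ (inj₂ (inj₂ (refl , p))) })
      (((b ≟ᵖ (suc x , y)) ×-dec right? x y) ⊎-dec ((a ≟ᵖ (suc x′ , y′)) ×-dec ¬? (right? x′ y′)) ⊎-dec
       ((b ≟ᵖ (x , suc y)) ×-dec up? x y) ⊎-dec ((a ≟ᵖ (x′ , suc y′)) ×-dec ¬? (up? x′ y′)))

    -- Together with a zero diagonal these conditions characterize the directed distance: the first
    -- makes `d` a lower bound for all runs, the second supplies a run of this length.
    Lipschitz Descending : Pt → Pt → Set
    Lipschitz a b  = ¬ Step a b ⊎ All (λ c → d a c ≤ suc (d b c)) grid
    Descending a b = a ≡ b ⊎ Any (λ c → Step a c × d a b ≡ suc (d c b)) grid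

    Exact : Set
    Exact = All (λ a → d a a ≡ 0 × All (λ b → Lipschitz a b × Descending a b) grid) grid

    exact? : Dec Exact
    exact? = All.all? (λ a → (d a a ≟ 0) ×-dec All.all? (λ b → lipschitz? a b ×-dec descending? a b) grid) grid
      where
      lipschitz? : ∀ a b → Dec (Lipschitz a b)
      lipschitz? a b = ¬? (step? a b) ⊎-dec All.all? (λ c → d a c ≤? suc (d b c)) grid
      descending? : ∀ a b → Dec (Descending a b)
      descending? a b = (a ≟ᵖ b) ⊎-dec any? (λ c → step? a c ×-dec (d a b ≟ suc (d c b))) grid

    Apart : Pt → Pt → Pt → Set
    Apart a c b = S b ⊎ d a c < d a b + d b c

    Isolated : Set
    Isolated = All (λ a → ¬ S a ⊎ All (λ c → ¬ S c ⊎ All (Apart a c) grid) grid) grid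

    isolated? : Dec Isolated
    isolated? = All.all? (λ a → ¬? (S? a) ⊎-dec All.all? (λ c → ¬? (S? c) ⊎-dec
      All.all? (λ b → S? b ⊎-dec (d a c <? d a b + d b c)) grid) grid) grid

    Between : List Pt → Pt → Set
    Between as b = Any (λ a → Any (λ c → d a b + d b c ≡ d a c) as) as

    between? : ∀ as b → Dec (Between as b)
    between? as b = any? (λ a → any? (λ c → d a b + d b c ≟ d a c) as) as

    layer : List Pt → List Pt
    layer as = filter (between? as) grid

    ∈layer : ∀ as {b} → b ∈ layer as → b ∈ grid × Between as b
    ∈layer as b∈ = ∈-filter⁻ (between? as) {xs = grid} b∈

    grow : ℕ → List Pt → List Pt
    grow zero    as = as
    grow (suc k) as = grow k (layer as)

    Full : List Pt → Set
    Full as = All (_∈ as) grid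

    full? : ∀ as → Dec (Full as)
    full? as = All.all? (_∈? as) grid

    -- In the second case a convex set that contains `as` and is larger than `S` has a vertex not in
    -- `as`, and adding any such vertex generates the grid.
    Settled : List Pt → Set
    Settled as = Full as ⊎ (count as ≤ ∣ sub S? ∣ × All (λ a → a ∈ as ⊎ Full (grow rounds (a ∷ as))) grid)

    settled? : ∀ as → Dec (Settled as)
    settled? as = full? as ⊎-dec ((count as ≤? ∣ sub S? ∣) ×-dec
      All.all? (λ a → (a ∈? as) ⊎-dec full? (grow rounds (a ∷ as))) grid)

    -- Starting from arcs is enough, since a convex set with two vertices contains an out-neighbour
    -- of each of its vertices.
    Spreads : Pt → Pt → Set
    Spreads a b = ¬ Step a b ⊎ Settled (grow rounds (a ∷ b ∷ []))

    Generated : Set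
    Generated = All (λ a → S a ⊎ All (Spreads a) grid) grid

    generated? : Dec Generated
    generated? = All.all? (λ a → S? a ⊎-dec All.all? (λ b → ¬? (step? a b) ⊎-dec settled? (grow rounds (a ∷ b ∷ []))) grid) grid

    module _ (exact : Exact) (isolated : Isolated) (generated : Generated)
             {s c} (s∈ : S s) (s-in : InB s) (c∉ : ¬ S c) (c-in : InB c) where

      private
        d-self : ∀ {a} → InB a → d a a ≡ 0
        d-self ia = proj₁ (All.lookup exact (∈grid ia))

        exact-at : ∀ {a b} → InB a → InB b → Lipschitz a b × Descending a b
        exact-at ia ib = All.lookup (proj₂ (All.lookup exact (∈grid ia))) (∈grid ib)

        d-step : ∀ {a b c} → InB a → InB b → InB c → Step a b → d a c ≤ suc (d b c)
        d-step {a} {b} {c} ia ib ic s = from (proj₁ (exact-at ia ib))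
          where
          from : Lipschitz a b → d a c ≤ suc (d b c)
          from (inj₁ ¬s) = contradiction s ¬s
          from (inj₂ le) = All.lookup le (∈grid ic)

        d≤ : ∀ {a b k} → InB a → Run a b k → d a b ≤ k
        d≤ ia [] = ≤-reflexive (d-self ia)
        d≤ ia (s ∷⟨ ib ⟩ p) = ≤-trans (d-step ia ib (run-in ib p) s) (s≤s (d≤ ib p))

        reach : ∀ k {a b} → InB a → InB b → d a b ≡ k → Run a b k
        reach k {a} {b} ia ib e = from k e (proj₂ (exact-at ia ib))
          where
          from : ∀ k → d a b ≡ k → Descending a b → Run a b k
          from k e (inj₁ refl) = subst (Run a a) (trans (sym (d-self ia)) e) []
          from k e (inj₂ some) = descend k e (find some)
            where
            descend : ∀ k → d a b ≡ k → ∃[ c ] (c ∈ grid × Step a c × d a b ≡ suc (d c b)) → Run a b k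
            descend zero    e (c , c∈ , s , e′) = contradiction (trans (sym e) e′) λ ()
            descend (suc k) e (c , c∈ , s , e′) = s ∷⟨ grid-in c∈ ⟩ reach k (grid-in c∈) ib (suc-injective (trans (sym e′) e))

        strong : Strong D
        strong v w = let p , _ = run⇒walk (reach _ (co-in v) (co-in w) refl) v w refl refl in
          proj₁ (toPath p) , proj₁ (proj₂ (toPath p))

        shortcuts : Shortcuts S?
        shortcuts {a} {b} {c} ia Sa ¬Sb Sc p q = d a c , reach _ ia ic refl ,
          ≤-trans (first (All.lookup isolated (∈grid ia))) (+-mono-≤ (d≤ ia p) (d≤ ib q))
          where
          ib = run-in ia p
          ic = run-in ib q
          third : Apart a c b → d a c < d a b + d b c
          third (inj₁ Sb) = contradiction Sb ¬Sb
          third (inj₂ lt) = lt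
          second : ¬ S c ⊎ All (Apart a c) grid → d a c < d a b + d b c
          second (inj₁ ¬Sc) = contradiction Sc ¬Sc
          second (inj₂ all) = third (All.lookup all (∈grid ib))
          first : ¬ S a ⊎ All (λ c → ¬ S c ⊎ All (Apart a c) grid) grid → d a c < d a b + d b c
          first (inj₁ ¬Sa) = contradiction Sa ¬Sa
          first (inj₂ all) = second (All.lookup all (∈grid ic))

        module _ {T : Pt → Set} (hull : Hull T) where

          within : ∀ {a b c} → T a → InB b → T c → d a b + d b c ≡ d a c → T b
          within Ta ib Tc e = Hull.closed hull Ta Tc (reach _ (Hull.inb hull Ta) ib refl) (reach _ ib (Hull.inb hull Tc) refl)
            (λ r → ≤-trans (≤-reflexive e) (d≤ (Hull.inb hull Ta) r))

          spanned : ∀ {as a b c} → All T as → a ∈ as → c ∈ as → b ∈ grid → d a b + d b c ≡ d a c → T b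
          spanned {as} {a} {b} {c} all a∈ c∈ b∈ e = within {a} {b} {c} (All.lookup all a∈) (grid-in b∈) (All.lookup all c∈) e

          spanned₁ : ∀ {as a b} → All T as → b ∈ grid → a ∈ as → Any (λ c → d a b + d b c ≡ d a c) as → T b
          spanned₁ {as} {a} {b} all b∈ a∈ some = let c , c∈ , e = find some in spanned {as} {a} {b} {c} all a∈ c∈ b∈ e

          spanned₂ : ∀ {as b} → All T as → b ∈ grid → Between as b → T b
          spanned₂ {as} {b} all b∈ btw = let a , a∈ , some = find btw in spanned₁ {as} {a} {b} all b∈ a∈ some

          layered : ∀ {as} → All T as → All T (layer as)
          layered {as} all = All.tabulate (λ {b} b∈ → spanned₂ {as} {b} all (proj₁ (∈layer as b∈)) (proj₂ (∈layer as b∈)))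

          grown : ∀ k {as} → All T as → All T (grow k as)
          grown zero    all = all
          grown (suc k) all = grown k (layered all)

          full-hull : ∀ {as} → All T as → Full as → ∀ a → InB a → T a
          full-hull all full a ia = All.lookup all (All.lookup full (∈grid ia))

        vertices-at : ∀ {as} → All InB as → List (Fin (n * m))
        vertices-at []       = []
        vertices-at (i ∷ is) = at i ∷ vertices-at is

        count-at : ∀ {as} (is : All InB as) → count (vertices-at is) ≡ count as
        count-at []       = refl
        count-at (i ∷ is) = cong suc (count-at is)

        co-at∉ : ∀ {as v} (is : All InB as) → All (v ≢_) (vertices-at is) → ¬ co v ∈ as
        co-at∉ (i ∷ is) (ne ∷ nes) (here refl) = ne (co-injective (sym (co-at i)))
        co-at∉ (i ∷ is) (ne ∷ nes) (there v∈)  = co-at∉ is nes v∈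

        module _ (T : Subset (n * m)) (hull : Hull (Points S? T)) where

          Whole : Set
          Whole = ∀ a → InB a → Points S? T a

          added : ∀ {as} v → v ∈ˢ T → All (Points S? T) as → ¬ co v ∈ as →
                  co v ∈ as ⊎ Full (grow rounds (co v ∷ as)) → Whole
          added      v v∈ Tas v∉ (inj₁ v∈as) = contradiction v∈as v∉
          added {as} v v∈ Tas v∉ (inj₂ full) =
            full-hull {Points S? T} hull {grow rounds (co v ∷ as)} (grown {Points S? T} hull rounds {co v ∷ as} ((v , refl , v∈) ∷ Tas)) full

          larger : ∀ {as} → All (Points S? T) as → count as ≤ ∣ sub S? ∣ →
                   All (λ a → a ∈ as ⊎ Full (grow rounds (a ∷ as))) grid → Dec (∣ T ∣ ≤ ∣ sub S? ∣) → Whole ⊎ ∣ T ∣ ≤ ∣ sub S? ∣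
          larger      Tas small all (yes le) = inj₂ le
          larger {as} Tas small all (no ≰)   =
            inj₁ (added {as} v v∈ Tas (co-at∉ ins new) (All.lookup all (∈grid (co-in v))))
            where
            ins : All InB as
            ins = All.map (Hull.inb hull) Tas
            fresh : ∃[ v ] (v ∈ˢ T × All (v ≢_) (vertices-at ins))
            fresh = another (vertices-at ins) (≤-<-trans (≤-trans (≤-reflexive (count-at ins)) small) (≰⇒> ≰))
            v = proj₁ fresh
            v∈ = proj₁ (proj₂ fresh)
            new = proj₂ (proj₂ fresh)

          settle : ∀ {as} → All (Points S? T) as → Settled as → Whole ⊎ ∣ T ∣ ≤ ∣ sub S? ∣
          settle {as} Tas (inj₁ full)          = inj₁ (full-hull {Points S? T} hull {as} Tas full)
          settle {as} Tas (inj₂ (small , all)) = larger {as} Tas small all (∣ T ∣ ≤? ∣ sub S? ∣)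

          spread : ∀ {a b} → Points S? T a → Points S? T b → Step a b → Spreads a b → Whole ⊎ ∣ T ∣ ≤ ∣ sub S? ∣
          spread         Ta Tb s (inj₁ ¬s) = contradiction s ¬s
          spread {a} {b} Ta Tb s (inj₂ st) = settle {grow rounds (a ∷ b ∷ [])} (grown {Points S? T} hull rounds {a ∷ b ∷ []} (Ta ∷ Tb ∷ [])) st

          generate : ∀ {c e} → Points S? T c → ¬ S c → Points S? T e → c ≢ e → Whole ⊎ ∣ T ∣ ≤ ∣ sub S? ∣
          generate {c} Tc ¬Sc Te ne =
            let b , Tb , s , ib = successor ne (Hull.conn hull Tc Te) in from {b} Tb s ib (All.lookup generated (∈grid (Hull.inb hull Tc)))
            where
            from : ∀ {b} → Points S? T b → Step c b → InB b → S c ⊎ All (Spreads c) grid → Whole ⊎ ∣ T ∣ ≤ ∣ sub S? ∣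
            from     Tb s ib (inj₁ Sc)  = contradiction Sc ¬Sc
            from {b} Tb s ib (inj₂ all) = spread {c} {b} Tc Tb s (All.lookup all (∈grid ib))

      tabulated-spectrum : StrongConvexitySpectrum (P n □ P m) ∣ sub S? ∣
      tabulated-spectrum = spectrum-by S? strong shortcuts (s , s-in , s∈) (c , c-in , c∉) (λ T hull → generate T hull)

  -- The distances from the i-th vertex of the 4 × 4 grid are the hexadecimal digits of the i-th number of the table.
  distance : List ℕ → Pt → Pt → ℕ
  distance table (x , y) (x′ , y′) = digit (row table (x * 4 + y)) (x′ * 4 + y′)
    where
    row : List ℕ → ℕ → ℕ
    row []       _       = 0
    row (k ∷ _)  zero    = k
    row (_ ∷ ks) (suc i) = row ks i
    digit : ℕ → ℕ → ℕ
    digit k zero    = k % 16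
    digit k (suc i) = digit (k / 16) i

  grid : List Pt
  grid = cartesianProduct (upTo 4) (upTo 4)

  ∈grid : ∀ {a} → Coordinates.InB 4 4 a → a ∈ grid
  ∈grid (x< , y<) = ∈-cartesianProduct⁺ (∈-upTo⁺ x<) (∈-upTo⁺ y<)

  grid-in : ∀ {a} → a ∈ grid → Coordinates.InB 4 4 a
  grid-in a∈ = let x∈ , y∈ = ∈-cartesianProduct⁻ (upTo 4) (upTo 4) a∈ in ∈-upTo⁻ x∈ , ∈-upTo⁻ y∈

  module Listed (rights ups inside : List Pt) (table : List ℕ) = Tabulated 4 4
    {λ x y → (x , y) ∈ rights} {λ x y → (x , y) ∈ ups} (λ x y → (x , y) ∈? rights) (λ x y → (x , y) ∈? ups)
    {_∈ inside} (_∈? inside) (distance table) 5 grid ∈grid grid-in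

  -- Two faces that share a vertex, two full rows, and a 3 × 3 block. For n = m = 4 the other
  -- constructions give 1, 4, 6 and the values from 10 to 12.
  inside₇ inside₈ inside₉ : List Pt
  inside₇ = (0 , 0) ∷ (1 , 0) ∷ (0 , 1) ∷ (1 , 1) ∷ (2 , 1) ∷ (1 , 2) ∷ (2 , 2) ∷ []
  inside₈ = (0 , 0) ∷ (0 , 1) ∷ (1 , 0) ∷ (1 , 1) ∷ (2 , 0) ∷ (2 , 1) ∷ (3 , 0) ∷ (3 , 1) ∷ []
  inside₉ = (1 , 1) ∷ (1 , 2) ∷ (1 , 3) ∷ (2 , 1) ∷ (2 , 2) ∷ (2 , 3) ∷ (3 , 1) ∷ (3 , 2) ∷ (3 , 3) ∷ []

  module Grid7 = Listed
    ((0 , 0) ∷ (0 , 3) ∷ (1 , 0) ∷ (1 , 1) ∷ (1 , 3) ∷ (2 , 0) ∷ (2 , 1) ∷ (2 , 3) ∷ [])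
    ((0 , 1) ∷ (0 , 2) ∷ (1 , 0) ∷ (1 , 2) ∷ (2 , 1) ∷ (2 , 2) ∷ (3 , 0) ∷ (3 , 1) ∷ [])
    inside₇
    (0x6543543265215430 ∷ 0x5654454336322101 ∷ 0x45ab369a278b109a ∷ 0x349a2589167a0789 ∷ 0x5432432154104323 ∷ 0x4323321243033212 ∷ 0x3434232310142123 ∷ 0x2389147805697678 ∷ 0x6321547065697678 ∷ 0x3212210132364345 ∷ 0x2345103421253234 ∷ 0x1278036754586567 ∷ 0x5210436754586567 ∷ 0x4107325643475456 ∷ 0x3056214532364345 ∷ 0x0167325643475456 ∷ [])

  module Grid8 = Listed
    ((0 , 1) ∷ (0 , 2) ∷ (0 , 3) ∷ (1 , 0) ∷ (1 , 3) ∷ (2 , 1) ∷ (2 , 2) ∷ (2 , 3) ∷ [])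
    ((0 , 0) ∷ (0 , 1) ∷ (0 , 2) ∷ (1 , 1) ∷ (1 , 2) ∷ (2 , 0) ∷ (2 , 1) ∷ (2 , 2) ∷ [])
    inside₈
    (0x6767565443233210 ∷ 0x5656454332122103 ∷ 0x45673a9821ab10dc ∷ 0x345629871a9a0dcb ∷ 0x5434432154304321 ∷ 0x4545343221015432 ∷ 0x34562987109aedcb ∷ 0x234518760989dcba ∷ 0x4323321043237654 ∷ 0x3212210332126543 ∷ 0x212310542167ba98 ∷ 0x123407659878cba9 ∷ 0x5430432154348765 ∷ 0x6501543265459876 ∷ 0x701265437656a987 ∷ 0x012376548767ba98 ∷ [])

  module Grid9 = Listed
    ((0 , 1) ∷ (0 , 2) ∷ (0 , 3) ∷ (1 , 2) ∷ (2 , 2) ∷ (2 , 3) ∷ [])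
    ((0 , 0) ∷ (0 , 1) ∷ (0 , 2) ∷ (1 , 0) ∷ (1 , 1) ∷ (2 , 0) ∷ (2 , 2) ∷ [])
    inside₉
    (0x6567545843293210 ∷ 0x5456434732182109 ∷ 0x4345323621471098 ∷ 0x5456434712580ba9 ∷ 0x5456434752104321 ∷ 0x434532364107ba98 ∷ 0x323421253036a987 ∷ 0x434532360147ba98 ∷ 0x6567541063215432 ∷ 0x545643075218cba9 ∷ 0x2123101423259876 ∷ 0x123403451256a987 ∷ 0x7670652174326543 ∷ 0x6501541263237654 ∷ 0x7012652374348765 ∷ 0x0123763485459876 ∷ [])

  spectrum-7 : StrongConvexitySpectrum (P 4 □ P 4) 7
  spectrum-7 = Grid7.tabulated-spectrum (toWitness {a? = Grid7.exact?} _) (toWitness {a? = Grid7.isolated?} _)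
    (toWitness {a? = Grid7.generated?} _) (toWitness {a? = (0 , 0) ∈? inside₇} _) (s≤s z≤n , s≤s z≤n)
    (toWitnessFalse {a? = (3 , 3) ∈? inside₇} _) (≤-refl , ≤-refl)

  spectrum-8 : StrongConvexitySpectrum (P 4 □ P 4) 8
  spectrum-8 = Grid8.tabulated-spectrum (toWitness {a? = Grid8.exact?} _) (toWitness {a? = Grid8.isolated?} _)
    (toWitness {a? = Grid8.generated?} _) (toWitness {a? = (0 , 0) ∈? inside₈} _) (s≤s z≤n , s≤s z≤n)
    (toWitnessFalse {a? = (3 , 3) ∈? inside₈} _) (≤-refl , ≤-refl)

  spectrum-9 : StrongConvexitySpectrum (P 4 □ P 4) 9
  spectrum-9 = Grid9.tabulated-spectrum (toWitness {a? = Grid9.exact?} _) (toWitness {a? = Grid9.isolated?} _)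
    (toWitness {a? = Grid9.generated?} _) (toWitness {a? = (3 , 3) ∈? inside₉} _) (≤-refl , ≤-refl)
    (toWitnessFalse {a? = (0 , 0) ∈? inside₉} _) (s≤s z≤n , s≤s z≤n)

-- The search trees.

module Cert where

  open Window
  open Core
  open import Data.Bool.Base using (Bool; true; false; if_then_else_)
  open import Data.List.Base using (List; []; _∷_; map)
  open import Data.Nat.Base using (ℕ; _∸_)
  open import Data.Product.Base using (_,_)
  open import Relation.Nullary.Decidable using (toWitness)

  -- A path that starts at (6 , 6) by a move down and whose first horizontal move, if any, is to the left.
  straight : List Move → Tree
  straight []       = clash
  straight (μ ∷ μs) = if descending (μ ∷ μs) then detour 6 6 (μ ∷ []) μs else clash
    where
    descending : List Move → Bool
    descending []       = true
    descending (l ∷ μs) = descending μs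
    descending (d ∷ μs) = descending μs
    descending (_ ∷ μs) = false

  -- Down, left, up is the only shape of three moves that turns back without reversing its previous
  -- move. The others are monotone or traverse an edge in both directions.
  u-turn : List Move → Tree
  u-turn (d ∷ l ∷ u ∷ []) =
    cell 5 4 (edge 5 4 u (detour 5 4 (u ∷ []) (u ∷ [])) (detour 6 6 (d ∷ []) (l ∷ d ∷ []))) (cell 7 5 (edge 6 5 r (detour 6 6 (d ∷ []) (r ∷ []))
    (detour 7 5 (l ∷ []) (l ∷ u ∷ []))) (cell 4 5 (edge 4 5 r (detour 4 5 (r ∷ []) (u ∷ [])) (detour 6 6 (d ∷ []) (l ∷ l ∷ []))) (cell 6 4 (edge 6 4 u
    (detour 6 4 (u ∷ []) (l ∷ u ∷ [])) (detour 6 6 (d ∷ []) (d ∷ []))) (wall r (wall l crowd (cell 4 4 (cell 4 6 (cell 3 5 (edge 4 4 u (edge 4 5 u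
    (detour 4 4 (u ∷ []) (u ∷ [])) (edge 3 5 r (edge 4 5 r (detour 3 5 (r ∷ r ∷ []) (u ∷ [])) (trap ((4 , 5) ∷ []))) (detour 4 4 (u ∷ []) (l ∷ []))))
    (edge 4 5 u (edge 3 5 r (detour 3 5 (r ∷ []) (u ∷ [])) (edge 4 5 r (source ((4 , 5) ∷ [])) (detour 6 6 (d ∷ []) (l ∷ l ∷ l ∷ [])))) (detour 4 6 (d
    ∷ []) (d ∷ [])))) (wall l crowd crowd)) crowd) (wall d (cell 3 5 (edge 3 5 r (edge 4 5 r (detour 3 5 (r ∷ r ∷ []) (u ∷ [])) (cell 4 6 (edge 4 5 u
    (detour 3 5 (r ∷ []) (u ∷ [])) (trap ((4 , 5) ∷ []))) (edge 4 5 u (edge 4 6 r (detour 3 5 (r ∷ []) (u ∷ r ∷ [])) (cell 3 6 (edge 3 6 r (cell 4 7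
    (edge 4 6 u (detour 3 6 (r ∷ []) (u ∷ [])) (trap ((4 , 6) ∷ []))) (wall u crowd (edge 4 6 u (cell 5 7 (edge 4 7 r (detour 3 6 (r ∷ []) (u ∷ r ∷
    [])) (cell 3 7 (edge 3 7 r (cell 4 8 (edge 4 7 u (detour 3 7 (r ∷ []) (u ∷ [])) (trap ((4 , 7) ∷ []))) (wall u crowd crowd)) (detour 5 7 (l ∷ [])
    (l ∷ []))) crowd)) crowd) (trap ((4 , 6) ∷ []))))) (detour 5 6 (l ∷ []) (l ∷ []))) (cell 2 5 (edge 2 5 r (stuck 3 5) (unreached 3 5)) (stuck 3
    5)))) (trap ((4 , 5) ∷ []))))) (edge 4 5 r (cell 4 6 (edge 4 5 u (source ((4 , 5) ∷ [])) (detour 4 6 (d ∷ []) (l ∷ []))) (edge 4 5 u (source ((4 ,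
    5) ∷ [])) (edge 4 6 r (cell 3 6 (edge 3 6 r (detour 3 6 (r ∷ []) (r ∷ [])) (cell 4 7 (edge 4 6 u (source ((4 , 6) ∷ [])) (detour 4 7 (d ∷ []) (r ∷
    []))) (wall u crowd (edge 4 6 u (source ((4 , 6) ∷ [])) (cell 3 7 (edge 3 7 r (detour 3 7 (r ∷ d ∷ []) (r ∷ [])) (cell 5 7 (edge 4 7 r (cell 4 8
    (edge 4 7 u (source ((4 , 7) ∷ [])) (detour 4 8 (d ∷ []) (r ∷ []))) (wall u crowd crowd)) (detour 5 7 (l ∷ []) (l ∷ []))) crowd)) crowd))))) (cell
    2 5 (edge 2 5 r (stuck 3 5) (unreached 3 5)) (stuck 3 5))) (detour 5 6 (l ∷ d ∷ []) (l ∷ []))))) (detour 6 6 (d ∷ []) (l ∷ l ∷ l ∷ [])))) (wall l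
    crowd (cell 3 6 (cell 2 5 (edge 2 5 r (edge 3 5 u (detour 2 5 (r ∷ []) (u ∷ [])) (edge 3 5 r (edge 4 5 r (detour 2 5 (r ∷ r ∷ r ∷ []) (u ∷ []))
    (cell 4 6 (edge 4 5 u (detour 2 5 (r ∷ r ∷ []) (u ∷ [])) (trap ((4 , 5) ∷ []))) (edge 4 5 u (edge 4 6 r (detour 2 5 (r ∷ r ∷ []) (u ∷ r ∷ []))
    (edge 3 6 r (cell 4 7 (edge 4 6 u (detour 3 6 (r ∷ []) (u ∷ [])) (trap ((4 , 6) ∷ []))) (wall u crowd crowd)) (detour 5 6 (l ∷ []) (l ∷ []))))
    (trap ((4 , 5) ∷ []))))) (trap ((3 , 5) ∷ [])))) (edge 3 5 u (edge 3 5 r (source ((3 , 5) ∷ [])) (edge 4 5 r (cell 4 6 (edge 4 5 u (source ((4 , 5)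
    ∷ [])) (detour 4 6 (d ∷ []) (l ∷ l ∷ []))) (edge 4 5 u (source ((4 , 5) ∷ [])) (edge 4 6 r (edge 3 6 r (detour 3 6 (r ∷ []) (r ∷ [])) (cell 4 7
    (edge 4 6 u (source ((4 , 6) ∷ [])) (detour 4 7 (d ∷ []) (r ∷ []))) (wall u crowd crowd))) (detour 5 6 (l ∷ d ∷ []) (l ∷ l ∷ []))))) (detour 6 6 (d
    ∷ []) (l ∷ l ∷ l ∷ l ∷ [])))) (detour 3 6 (d ∷ []) (l ∷ [])))) (wall l crowd (cell 2 6 (cell 4 6 (cell 1 5 (edge 1 5 r (edge 2 5 u (detour 1 5 (r ∷
    []) (u ∷ [])) (edge 2 5 r (edge 3 5 u (detour 1 5 (r ∷ r ∷ []) (u ∷ [])) (edge 3 5 r (edge 4 5 u (detour 1 5 (r ∷ r ∷ r ∷ []) (u ∷ [])) (edge 4 5 r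
    (detour 1 5 (r ∷ r ∷ r ∷ r ∷ []) (u ∷ [])) (trap ((4 , 5) ∷ [])))) (trap ((3 , 5) ∷ [])))) (trap ((2 , 5) ∷ [])))) (edge 2 5 u (edge 2 5 r (source
    ((2 , 5) ∷ [])) (edge 3 5 u (edge 3 5 r (source ((3 , 5) ∷ [])) (edge 4 5 u (edge 4 5 r (source ((4 , 5) ∷ [])) (detour 6 6 (d ∷ []) (l ∷ l ∷ l ∷ l
    ∷ l ∷ []))) (detour 4 6 (d ∷ []) (l ∷ l ∷ l ∷ [])))) (detour 3 6 (d ∷ []) (l ∷ l ∷ [])))) (detour 2 6 (d ∷ []) (l ∷ [])))) (wall l crowd crowd))
    crowd) crowd))) (cell 4 6 (cell 3 7 (cell 2 6 (cell 2 5 (edge 3 6 u (edge 2 6 r (detour 2 6 (r ∷ []) (u ∷ [])) (edge 3 6 r (edge 3 5 u (edge 2 5 r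
    (detour 2 5 (r ∷ []) (u ∷ r ∷ [])) (edge 3 5 r (source ((3 , 5) ∷ [])) (edge 4 5 r (edge 4 5 u (source ((4 , 5) ∷ [])) (detour 4 6 (d ∷ []) (l ∷ l
    ∷ []))) (detour 6 6 (d ∷ []) (l ∷ l ∷ l ∷ l ∷ []))))) (source ((3 , 6) ∷ []))) (detour 4 6 (l ∷ []) (l ∷ [])))) (edge 2 6 r (edge 3 6 r (detour 2 6
    (r ∷ []) (r ∷ [])) (edge 3 5 u (trap ((3 , 6) ∷ [])) (edge 2 5 r (edge 3 5 r (edge 4 5 r (detour 2 5 (r ∷ r ∷ r ∷ []) (u ∷ [])) (edge 4 5 u (detour
    2 5 (r ∷ r ∷ []) (u ∷ [])) (trap ((4 , 5) ∷ [])))) (trap ((3 , 5) ∷ []))) (detour 4 6 (l ∷ d ∷ []) (l ∷ []))))) (detour 3 7 (d ∷ []) (l ∷ []))))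
    crowd) (wall l crowd crowd)) (wall u crowd crowd)) crowd)))) crowd))) (wall d (wall l (cell 8 5 (edge 7 5 r (edge 6 5 r (detour 6 6 (d ∷ []) (r ∷ r
    ∷ [])) (cell 7 6 (edge 7 5 u (source ((7 , 5) ∷ [])) (detour 7 6 (d ∷ []) (r ∷ []))) (edge 7 5 u (source ((7 , 5) ∷ [])) (edge 6 6 r (detour 6 6 (r
    ∷ d ∷ []) (r ∷ [])) (cell 8 6 (edge 7 6 r (cell 7 7 (edge 7 6 u (source ((7 , 6) ∷ [])) (detour 7 7 (d ∷ []) (r ∷ []))) (wall u crowd (edge 7 6 u
    (source ((7 , 6) ∷ [])) (cell 8 7 (edge 7 7 r (cell 6 7 (edge 6 7 r (detour 6 7 (r ∷ []) (r ∷ [])) (cell 7 8 (edge 7 7 u (source ((7 , 7) ∷ []))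
    (detour 7 8 (d ∷ []) (r ∷ []))) (wall u crowd crowd))) crowd) (detour 8 7 (l ∷ d ∷ []) (l ∷ []))) crowd)))) (detour 8 6 (l ∷ []) (l ∷ []))) (cell 9
    5 (edge 8 5 r (unreached 8 5) (stuck 8 5)) (stuck 8 5))))))) (edge 6 5 r (cell 7 6 (edge 7 5 u (detour 8 5 (l ∷ []) (u ∷ [])) (trap ((7 , 5) ∷
    []))) (edge 7 5 u (edge 6 6 r (cell 8 6 (edge 7 6 r (detour 6 6 (r ∷ []) (r ∷ [])) (cell 7 7 (edge 7 6 u (detour 6 6 (r ∷ []) (u ∷ [])) (trap ((7 ,
    6) ∷ []))) (wall u crowd (edge 7 6 u (cell 6 7 (edge 6 7 r (cell 8 7 (edge 7 7 r (detour 6 7 (r ∷ []) (r ∷ [])) (cell 7 8 (edge 7 7 u (detour 6 7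
    (r ∷ []) (u ∷ [])) (trap ((7 , 7) ∷ []))) (wall u crowd crowd))) crowd) (detour 8 6 (l ∷ []) (u ∷ l ∷ []))) crowd) (trap ((7 , 6) ∷ [])))))) (cell
    9 5 (edge 8 5 r (unreached 8 5) (stuck 8 5)) (stuck 8 5))) (detour 8 5 (l ∷ []) (u ∷ l ∷ []))) (trap ((7 , 5) ∷ [])))) (detour 8 5 (l ∷ l ∷ []) (l
    ∷ u ∷ [])))) (wall r crowd (cell 9 5 (cell 8 6 (edge 8 5 r (edge 8 5 u (edge 7 5 r (edge 6 5 r (detour 6 6 (d ∷ []) (r ∷ r ∷ r ∷ [])) (cell 7 6
    (edge 7 5 u (source ((7 , 5) ∷ [])) (detour 7 6 (d ∷ []) (r ∷ r ∷ []))) (edge 7 5 u (source ((7 , 5) ∷ [])) (edge 6 6 r (detour 6 6 (r ∷ d ∷ []) (r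
    ∷ r ∷ [])) (edge 7 6 r (cell 7 7 (edge 7 6 u (source ((7 , 6) ∷ [])) (detour 7 7 (d ∷ []) (r ∷ []))) (wall u crowd crowd)) (detour 8 6 (l ∷ []) (l
    ∷ []))))))) (source ((8 , 5) ∷ []))) (detour 8 6 (d ∷ []) (r ∷ []))) (edge 8 5 u (detour 9 5 (l ∷ []) (u ∷ [])) (edge 7 5 r (trap ((8 , 5) ∷ []))
    (edge 6 5 r (cell 7 6 (edge 7 5 u (detour 9 5 (l ∷ l ∷ []) (u ∷ [])) (trap ((7 , 5) ∷ []))) (edge 7 5 u (edge 6 6 r (edge 7 6 r (detour 6 6 (r ∷
    []) (r ∷ [])) (cell 7 7 (edge 7 6 u (detour 6 6 (r ∷ []) (u ∷ [])) (trap ((7 , 6) ∷ []))) (wall u crowd crowd))) (detour 9 5 (l ∷ l ∷ []) (u ∷ l ∷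
    []))) (trap ((7 , 5) ∷ [])))) (detour 9 5 (l ∷ l ∷ l ∷ []) (l ∷ u ∷ [])))))) (cell 7 6 (cell 9 6 (cell 8 7 (edge 7 6 r (edge 8 6 u (detour 7 6 (r ∷
    []) (u ∷ [])) (edge 8 6 r (detour 7 6 (r ∷ []) (r ∷ [])) (edge 8 5 u (trap ((8 , 6) ∷ [])) (edge 8 5 r (detour 7 6 (r ∷ d ∷ []) (r ∷ [])) (edge 7 5
    r (trap ((8 , 5) ∷ [])) (edge 6 5 r (edge 7 5 u (detour 9 5 (l ∷ l ∷ []) (u ∷ [])) (trap ((7 , 5) ∷ []))) (detour 9 5 (l ∷ l ∷ l ∷ []) (l ∷ u ∷
    [])))))))) (edge 8 6 u (edge 8 6 r (edge 8 5 u (edge 8 5 r (edge 7 5 r (edge 7 5 u (edge 6 5 r (detour 6 6 (d ∷ []) (r ∷ r ∷ r ∷ [])) (source ((7 ,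
    5) ∷ []))) (detour 7 6 (d ∷ []) (r ∷ r ∷ []))) (source ((8 , 5) ∷ []))) (detour 9 5 (l ∷ []) (u ∷ l ∷ []))) (source ((8 , 6) ∷ []))) (detour 9 6 (l
    ∷ []) (l ∷ []))) (detour 8 7 (d ∷ []) (l ∷ [])))) (wall u crowd crowd)) crowd) crowd)) (wall r crowd (cell 9 6 (cell 7 6 (cell 8 6 (cell 10 5 (edge
    9 5 u (edge 9 5 r (edge 8 5 r (edge 8 5 u (edge 7 5 r (edge 6 5 r (detour 6 6 (d ∷ []) (r ∷ r ∷ r ∷ r ∷ [])) (edge 7 5 u (source ((7 , 5) ∷ []))
    (detour 7 6 (d ∷ []) (r ∷ r ∷ r ∷ [])))) (source ((8 , 5) ∷ []))) (detour 8 6 (d ∷ []) (r ∷ r ∷ []))) (source ((9 , 5) ∷ []))) (detour 10 5 (l ∷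
    []) (u ∷ []))) (edge 9 5 r (detour 9 6 (d ∷ []) (r ∷ [])) (edge 8 5 r (trap ((9 , 5) ∷ [])) (edge 8 5 u (detour 10 5 (l ∷ l ∷ []) (u ∷ [])) (edge 7
    5 r (trap ((8 , 5) ∷ [])) (edge 6 5 r (edge 7 5 u (detour 10 5 (l ∷ l ∷ l ∷ []) (u ∷ [])) (trap ((7 , 5) ∷ []))) (detour 10 5 (l ∷ l ∷ l ∷ l ∷ [])
    (l ∷ u ∷ [])))))))) (wall r crowd crowd)) crowd) crowd) crowd))))) (cell 7 6 (edge 4 5 r (cell 3 5 (edge 3 5 r (detour 3 5 (r ∷ r ∷ []) (u ∷ []))
    (cell 4 6 (edge 4 5 u (source ((4 , 5) ∷ [])) (detour 4 6 (d ∷ []) (l ∷ []))) (edge 4 5 u (source ((4 , 5) ∷ [])) (edge 4 6 r (cell 3 6 (edge 3 6 r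
    (detour 3 6 (r ∷ []) (r ∷ [])) (cell 4 7 (edge 4 6 u (source ((4 , 6) ∷ [])) (detour 4 7 (d ∷ []) (r ∷ []))) (wall u crowd crowd))) crowd) (detour
    5 6 (l ∷ d ∷ []) (l ∷ [])))))) (wall l (cell 8 5 (edge 7 5 r (edge 7 5 u (edge 6 5 r (detour 6 6 (d ∷ []) (r ∷ r ∷ [])) (source ((7 , 5) ∷ [])))
    (detour 7 6 (d ∷ []) (r ∷ []))) (edge 6 5 r (edge 7 5 u (detour 8 5 (l ∷ []) (u ∷ [])) (trap ((7 , 5) ∷ []))) (detour 8 5 (l ∷ l ∷ []) (l ∷ u ∷
    [])))) (wall r crowd (cell 8 6 (cell 9 5 (edge 8 5 u (edge 8 5 r (edge 7 5 r (edge 6 5 r (detour 6 6 (d ∷ []) (r ∷ r ∷ r ∷ [])) (edge 7 5 u (source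
    ((7 , 5) ∷ [])) (detour 7 6 (d ∷ []) (r ∷ r ∷ [])))) (source ((8 , 5) ∷ []))) (detour 9 5 (l ∷ []) (u ∷ []))) (edge 8 5 r (detour 8 6 (d ∷ []) (r ∷
    [])) (edge 7 5 r (trap ((8 , 5) ∷ [])) (edge 7 5 u (detour 9 5 (l ∷ l ∷ []) (u ∷ [])) (edge 6 5 r (trap ((7 , 5) ∷ [])) (detour 9 5 (l ∷ l ∷ l ∷
    []) (l ∷ u ∷ []))))))) (wall r crowd crowd)) crowd))) (cell 3 6 (cell 4 6 (cell 2 5 (edge 2 5 r (edge 3 5 r (detour 2 5 (r ∷ r ∷ r ∷ []) (u ∷ []))
    (edge 3 5 u (detour 2 5 (r ∷ []) (u ∷ [])) (trap ((3 , 5) ∷ [])))) (edge 3 5 u (edge 3 5 r (source ((3 , 5) ∷ [])) (edge 4 5 u (source ((4 , 5) ∷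
    [])) (detour 4 6 (d ∷ []) (l ∷ l ∷ [])))) (detour 3 6 (d ∷ []) (l ∷ [])))) (wall l (cell 8 5 (edge 7 5 r (edge 6 5 r (detour 6 6 (d ∷ []) (r ∷ r ∷
    [])) (edge 7 5 u (source ((7 , 5) ∷ [])) (detour 7 6 (d ∷ []) (r ∷ [])))) (edge 6 5 r (edge 7 5 u (detour 8 5 (l ∷ []) (u ∷ [])) (trap ((7 , 5) ∷
    []))) (detour 8 5 (l ∷ l ∷ []) (l ∷ u ∷ [])))) (wall r crowd crowd)) crowd)) crowd) crowd))) (cell 3 5 (edge 3 5 r (cell 4 6 (edge 4 5 u (detour 3
    5 (r ∷ []) (u ∷ [])) (trap ((4 , 5) ∷ []))) (edge 4 5 u (edge 4 6 r (detour 3 5 (r ∷ []) (u ∷ r ∷ [])) (cell 3 6 (edge 3 6 r (cell 4 7 (edge 4 6 u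
    (detour 3 6 (r ∷ []) (u ∷ [])) (trap ((4 , 6) ∷ []))) (wall u crowd crowd)) (detour 5 6 (l ∷ []) (l ∷ []))) crowd)) (trap ((4 , 5) ∷ [])))) (detour
    6 6 (d ∷ []) (l ∷ l ∷ l ∷ []))) (wall l (cell 8 5 (edge 7 5 r (edge 6 5 r (detour 6 6 (d ∷ []) (r ∷ r ∷ [])) (edge 7 5 u (source ((7 , 5) ∷ []))
    (detour 7 6 (d ∷ []) (r ∷ [])))) (edge 7 5 u (detour 8 5 (l ∷ []) (u ∷ [])) (edge 6 5 r (trap ((7 , 5) ∷ [])) (detour 8 5 (l ∷ l ∷ []) (l ∷ u ∷
    []))))) (wall r crowd (cell 8 6 (cell 9 5 (edge 8 5 u (edge 8 5 r (edge 7 5 r (edge 6 5 r (detour 6 6 (d ∷ []) (r ∷ r ∷ r ∷ [])) (edge 7 5 u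
    (source ((7 , 5) ∷ [])) (detour 7 6 (d ∷ []) (r ∷ r ∷ [])))) (source ((8 , 5) ∷ []))) (detour 9 5 (l ∷ []) (u ∷ []))) (edge 8 5 r (detour 8 6 (d ∷
    []) (r ∷ [])) (edge 7 5 r (trap ((8 , 5) ∷ [])) (edge 6 5 r (edge 7 5 u (detour 9 5 (l ∷ l ∷ []) (u ∷ [])) (trap ((7 , 5) ∷ []))) (detour 9 5 (l ∷
    l ∷ l ∷ []) (l ∷ u ∷ [])))))) (wall r crowd crowd)) crowd))) (cell 3 6 (cell 4 6 (cell 8 5 (edge 7 5 r (edge 6 5 r (detour 6 6 (d ∷ []) (r ∷ r ∷
    [])) (edge 7 5 u (source ((7 , 5) ∷ [])) (detour 7 6 (d ∷ []) (r ∷ [])))) (edge 7 5 u (detour 8 5 (l ∷ []) (u ∷ [])) (edge 6 5 r (trap ((7 , 5) ∷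
    [])) (detour 8 5 (l ∷ l ∷ []) (l ∷ u ∷ []))))) (wall r (cell 2 5 (edge 2 5 r (edge 3 5 u (detour 2 5 (r ∷ []) (u ∷ [])) (edge 4 5 u (edge 3 5 r
    (detour 2 5 (r ∷ r ∷ []) (u ∷ [])) (trap ((3 , 5) ∷ []))) (trap ((3 , 5) ∷ (4 , 5) ∷ [])))) (edge 3 5 r (edge 3 5 u (source ((3 , 5) ∷ [])) (detour
    3 6 (d ∷ []) (l ∷ []))) (detour 6 6 (d ∷ []) (l ∷ l ∷ l ∷ l ∷ [])))) (wall l crowd crowd)) crowd)) crowd) crowd)))) (cell 4 6 (cell 7 7 (cell 8 5
    (cell 8 6 (edge 7 6 r (edge 6 6 r (detour 6 6 (r ∷ []) (r ∷ [])) (edge 7 6 u (edge 7 5 u (edge 7 5 r (edge 6 5 r (detour 6 6 (d ∷ []) (r ∷ r ∷ []))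
    (source ((7 , 5) ∷ []))) (detour 8 5 (l ∷ []) (u ∷ l ∷ []))) (source ((7 , 6) ∷ []))) (detour 7 7 (d ∷ []) (r ∷ [])))) (edge 6 6 r (edge 7 6 u
    (detour 6 6 (r ∷ []) (u ∷ [])) (edge 7 5 u (trap ((7 , 6) ∷ [])) (edge 7 5 r (detour 6 6 (r ∷ d ∷ []) (r ∷ [])) (edge 6 5 r (trap ((7 , 5) ∷ []))
    (detour 8 5 (l ∷ l ∷ []) (l ∷ u ∷ [])))))) (detour 8 6 (l ∷ []) (l ∷ [])))) crowd) (wall r (cell 3 5 (edge 3 5 r (edge 4 5 u (detour 3 5 (r ∷ [])
    (u ∷ [])) (edge 4 5 r (detour 3 5 (r ∷ r ∷ []) (u ∷ [])) (trap ((4 , 5) ∷ [])))) (edge 4 5 r (edge 4 5 u (source ((4 , 5) ∷ [])) (detour 4 6 (d ∷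
    []) (l ∷ []))) (detour 6 6 (d ∷ []) (l ∷ l ∷ l ∷ [])))) (wall l crowd crowd)) crowd)) (wall u crowd crowd)) crowd))) (cell 7 4 (cell 7 6 (wall l
    (cell 8 5 (edge 7 5 r (edge 7 5 u (edge 6 5 r (detour 6 6 (d ∷ []) (r ∷ r ∷ [])) (edge 7 4 u (detour 7 4 (u ∷ []) (r ∷ [])) (source ((7 , 5) ∷
    [])))) (detour 7 6 (d ∷ []) (r ∷ []))) (edge 6 5 r (edge 7 4 u (edge 7 5 u (detour 7 4 (u ∷ []) (u ∷ [])) (trap ((7 , 5) ∷ []))) (detour 8 5 (l ∷
    []) (d ∷ []))) (detour 8 5 (l ∷ l ∷ []) (l ∷ u ∷ [])))) (wall r crowd crowd)) crowd) crowd) crowd))))))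
  u-turn μs = straight μs

  -- Six shapes of four moves turn back without an immediate reversal. Paths through at most two
  -- outside vertices are already excluded, which many branches use through `short`.
  three-outside : List Move → Tree
  three-outside (d ∷ d ∷ l ∷ u ∷ []) =
    edge 5 5 r (cell 4 4 (edge 4 4 r (short 4 4 (r ∷ u ∷ [])) (detour 6 6 (d ∷ []) (d ∷ l ∷ l ∷ []))) (cell 5 3 (edge 5 3 u (short 5 3 (u ∷ u ∷ []))
    (detour 6 6 (d ∷ []) (d ∷ l ∷ d ∷ []))) (wall d (wall l (edge 5 5 u (unreached 5 5) (stuck 5 5)) (cell 7 5 (edge 6 5 r (short 6 6 (d ∷ r ∷ []))
    (cell 8 4 (edge 7 4 r (edge 6 4 r (detour 5 5 (r ∷ []) (d ∷ r ∷ r ∷ [])) (edge 7 4 u (source ((7 , 4) ∷ [])) (short 7 5 (d ∷ r ∷ [])))) (edge 6 4 r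
    (edge 7 4 u (short 8 4 (l ∷ u ∷ [])) (trap ((7 , 4) ∷ []))) (detour 8 4 (l ∷ l ∷ []) (l ∷ u ∷ [])))) (cell 8 5 crowd (edge 7 5 u (unreached 7 5)
    (stuck 7 5))))) (wall r (cell 4 5 (edge 4 4 r (edge 4 4 u (cell 3 4 (edge 3 4 r (short 3 4 (r ∷ u ∷ [])) (source ((4 , 4) ∷ []))) (wall l crowd
    (edge 3 4 r (cell 3 5 (edge 3 4 u (cell 2 4 (edge 2 4 r (short 2 4 (r ∷ u ∷ [])) (source ((3 , 4) ∷ []))) (wall l crowd crowd)) (short 3 5 (d ∷ r ∷
    u ∷ []))) crowd) (source ((4 , 4) ∷ []))))) (short 4 5 (d ∷ r ∷ u ∷ []))) (cell 3 4 (edge 3 4 r (edge 4 4 u (short 3 4 (r ∷ u ∷ [])) (trap ((4 , 4)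
    ∷ []))) (detour 6 6 (d ∷ []) (d ∷ l ∷ l ∷ l ∷ []))) (wall l crowd (cell 3 5 (cell 2 4 (edge 2 4 r (edge 3 4 u (short 2 4 (r ∷ u ∷ [])) (edge 3 4 r
    (edge 4 4 u (short 3 5 (d ∷ r ∷ u ∷ [])) (trap ((4 , 4) ∷ []))) (trap ((3 , 4) ∷ [])))) (edge 3 4 r (edge 3 4 u (source ((3 , 4) ∷ [])) (short 3 5
    (d ∷ l ∷ []))) (detour 6 6 (d ∷ []) (d ∷ l ∷ l ∷ l ∷ l ∷ [])))) (wall l crowd crowd)) crowd)))) (edge 5 5 u (unreached 5 5) (stuck 5 5))) crowd)))
    (cell 4 5 crowd (edge 5 5 u (unreached 5 5) (stuck 5 5)))))) (short 6 6 (d ∷ l ∷ []))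
  three-outside (d ∷ l ∷ d ∷ r ∷ []) =
    edge 6 4 u (cell 4 4 (edge 4 4 r (short 4 4 (r ∷ r ∷ [])) (detour 6 6 (d ∷ []) (l ∷ d ∷ l ∷ []))) (wall l (cell 5 3 (edge 5 3 u (short 5 3 (u ∷ r ∷
    [])) (detour 6 6 (d ∷ []) (l ∷ d ∷ d ∷ []))) (wall d (cell 7 4 (edge 6 4 r (unreached 6 4) (stuck 6 4)) (stuck 6 4)) (cell 7 5 (edge 6 5 r (short 6
    6 (d ∷ r ∷ [])) (cell 5 7 (edge 5 6 u (edge 5 5 u (detour 7 5 (l ∷ []) (l ∷ u ∷ u ∷ [])) (edge 5 6 r (source ((5 , 6) ∷ [])) (short 6 6 (l ∷ u ∷
    [])))) (edge 5 5 u (edge 5 6 r (short 5 7 (d ∷ r ∷ [])) (trap ((5 , 6) ∷ []))) (detour 5 7 (d ∷ d ∷ []) (d ∷ r ∷ [])))) (cell 6 7 crowd (edge 6 6 r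
    (unreached 6 6) (stuck 6 6))))) (wall r crowd crowd)))) crowd)) (short 6 6 (d ∷ d ∷ []))
  three-outside (d ∷ l ∷ l ∷ u ∷ []) =
    cell 7 5 (edge 6 5 r (short 6 6 (d ∷ r ∷ [])) (detour 7 5 (l ∷ []) (l ∷ l ∷ u ∷ []))) (cell 3 5 (edge 3 5 r (short 3 5 (r ∷ u ∷ [])) (detour 6 6 (d
    ∷ []) (l ∷ l ∷ l ∷ []))) (wall r (cell 6 7 (edge 6 6 u (unreached 6 6) (stuck 6 6)) (stuck 6 6)) (cell 3 6 crowd (cell 4 7 (edge 4 6 u (unreached 4
    6) (stuck 4 6)) (stuck 4 6)))))
  three-outside (d ∷ l ∷ u ∷ l ∷ []) =
    edge 5 6 r (cell 6 4 (edge 6 4 u (detour 6 4 (u ∷ []) (l ∷ u ∷ l ∷ [])) (short 6 6 (d ∷ d ∷ []))) (wall d (cell 7 5 (edge 6 5 r (short 6 6 (d ∷ r ∷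
    [])) (detour 7 5 (l ∷ []) (l ∷ u ∷ l ∷ []))) (wall r (cell 6 7 (edge 6 6 u (unreached 6 6) (stuck 6 6)) (stuck 6 6)) (cell 5 7 (cell 3 5 (edge 3 5
    r (edge 4 5 r (detour 3 5 (r ∷ r ∷ []) (u ∷ r ∷ [])) (edge 4 5 u (short 3 5 (r ∷ u ∷ [])) (trap ((4 , 5) ∷ [])))) (edge 4 5 r (edge 4 5 u (source
    ((4 , 5) ∷ [])) (short 4 6 (d ∷ l ∷ []))) (detour 6 6 (d ∷ []) (l ∷ l ∷ l ∷ [])))) (cell 3 6 crowd (edge 4 6 u (unreached 4 6) (stuck 4 6)))) (wall
    u crowd crowd)))) crowd)) (short 6 6 (l ∷ l ∷ []))
  three-outside (d ∷ l ∷ u ∷ r ∷ []) =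
    cell 4 6 (edge 4 6 r (short 4 6 (r ∷ r ∷ [])) (cell 6 4 (edge 6 4 u (detour 6 4 (u ∷ []) (l ∷ u ∷ l ∷ [])) (short 6 6 (d ∷ d ∷ []))) (wall d (cell
    7 5 (edge 6 5 r (short 6 6 (d ∷ r ∷ [])) (detour 7 5 (l ∷ []) (l ∷ u ∷ l ∷ []))) (wall r (cell 6 7 (edge 6 6 u (unreached 6 6) (stuck 6 6)) (stuck
    6 6)) (cell 5 7 (cell 3 5 (edge 3 5 r (edge 4 5 r (detour 3 5 (r ∷ r ∷ []) (u ∷ r ∷ [])) (edge 4 5 u (short 3 5 (r ∷ u ∷ [])) (trap ((4 , 5) ∷
    [])))) (edge 4 5 u (edge 4 5 r (source ((4 , 5) ∷ [])) (detour 6 6 (d ∷ []) (l ∷ l ∷ l ∷ []))) (short 4 6 (d ∷ l ∷ [])))) (cell 3 6 crowd (edge 4 6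
    u (unreached 4 6) (stuck 4 6)))) (wall u crowd crowd)))) crowd))) (wall l (cell 7 5 (edge 6 5 r (short 6 6 (d ∷ r ∷ [])) (cell 5 7 (edge 5 6 u
    (detour 7 5 (l ∷ []) (l ∷ u ∷ u ∷ [])) (short 5 7 (d ∷ r ∷ []))) (wall u (edge 6 6 r (unreached 6 6) (stuck 6 6)) (cell 6 4 (edge 6 4 u (cell 5 3
    (edge 5 3 u (edge 5 4 r (short 5 3 (u ∷ r ∷ [])) (edge 5 4 u (detour 5 3 (u ∷ u ∷ []) (u ∷ r ∷ [])) (trap ((5 , 4) ∷ [])))) (edge 5 4 u (edge 5 4 r
    (source ((5 , 4) ∷ [])) (short 6 4 (l ∷ d ∷ []))) (detour 7 5 (l ∷ []) (l ∷ d ∷ d ∷ [])))) (cell 6 3 crowd (edge 6 4 r (unreached 6 4) (stuck 6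
    4)))) (short 6 6 (d ∷ d ∷ []))) (wall d (cell 6 7 (cell 5 8 (edge 5 7 u (edge 5 7 r (edge 5 6 u (detour 7 5 (l ∷ []) (l ∷ u ∷ u ∷ u ∷ [])) (source
    ((5 , 7) ∷ []))) (short 6 7 (l ∷ u ∷ []))) (edge 5 6 u (edge 5 7 r (short 5 8 (d ∷ r ∷ [])) (trap ((5 , 7) ∷ []))) (short 5 8 (d ∷ d ∷ r ∷ []))))
    (wall u crowd (cell 6 8 (cell 5 9 (edge 5 8 u (edge 5 8 r (edge 5 7 u (edge 5 7 r (edge 5 6 u (detour 7 5 (l ∷ []) (l ∷ u ∷ u ∷ u ∷ u ∷ []))
    (source ((5 , 7) ∷ []))) (short 6 7 (l ∷ u ∷ r ∷ []))) (source ((5 , 8) ∷ []))) (short 6 8 (l ∷ u ∷ []))) (edge 5 8 r (short 5 9 (d ∷ r ∷ []))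
    (edge 5 7 u (trap ((5 , 8) ∷ [])) (edge 5 7 r (short 6 8 (l ∷ d ∷ r ∷ [])) (edge 5 6 u (trap ((5 , 7) ∷ [])) (short 6 7 (l ∷ d ∷ r ∷ [])))))))
    (wall u crowd crowd)) crowd))) (edge 6 6 r (unreached 6 6) (stuck 6 6))) crowd))))) (wall r crowd (cell 6 4 (edge 6 4 u (cell 5 7 (edge 5 6 u
    (detour 6 4 (u ∷ []) (l ∷ u ∷ u ∷ [])) (short 5 7 (d ∷ r ∷ []))) (cell 6 7 crowd (edge 6 6 r (unreached 6 6) (stuck 6 6)))) (short 6 6 (d ∷ d ∷
    []))) (wall d (cell 5 7 (edge 5 6 u (cell 7 6 (cell 8 5 (edge 7 5 r (edge 7 5 u (edge 6 5 r (short 6 6 (d ∷ r ∷ r ∷ [])) (source ((7 , 5) ∷ [])))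
    (short 7 6 (d ∷ r ∷ []))) (edge 6 5 r (edge 7 5 u (short 6 6 (d ∷ r ∷ u ∷ [])) (trap ((7 , 5) ∷ []))) (detour 8 5 (l ∷ l ∷ []) (l ∷ u ∷ u ∷ []))))
    (wall r crowd (cell 8 6 (cell 9 5 (edge 8 5 u (edge 8 5 r (edge 7 5 r (edge 6 5 r (detour 6 6 (d ∷ []) (r ∷ r ∷ r ∷ [])) (edge 7 5 u (source ((7 ,
    5) ∷ [])) (short 7 6 (d ∷ r ∷ u ∷ [])))) (source ((8 , 5) ∷ []))) (short 9 5 (l ∷ u ∷ []))) (edge 8 5 r (short 8 6 (d ∷ r ∷ [])) (edge 7 5 r (trap
    ((8 , 5) ∷ [])) (edge 6 5 r (edge 7 5 u (short 6 6 (d ∷ r ∷ u ∷ [])) (trap ((7 , 5) ∷ []))) (detour 9 5 (l ∷ l ∷ l ∷ []) (l ∷ u ∷ u ∷ []))))))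
    (wall r crowd crowd)) crowd))) (edge 6 6 u (unreached 6 6) (stuck 6 6))) (short 5 7 (d ∷ r ∷ []))) (wall u crowd (cell 7 6 (cell 6 7 (cell 8 5
    (cell 5 8 (edge 7 5 u (edge 6 5 r (short 6 6 (d ∷ r ∷ u ∷ [])) (edge 7 5 r (source ((7 , 5) ∷ [])) (short 8 5 (l ∷ u ∷ [])))) (edge 7 5 r (short 7
    6 (d ∷ r ∷ [])) (edge 6 5 r (trap ((7 , 5) ∷ [])) (edge 5 6 u (edge 5 7 u (detour 8 5 (l ∷ l ∷ []) (l ∷ u ∷ u ∷ u ∷ [])) (edge 5 7 r (short 5 8 (d
    ∷ r ∷ [])) (trap ((5 , 7) ∷ [])))) (edge 5 7 r (edge 5 7 u (source ((5 , 7) ∷ [])) (short 5 8 (d ∷ r ∷ []))) (short 6 7 (l ∷ d ∷ r ∷ [])))))))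
    (wall u crowd crowd)) (wall r crowd crowd)) crowd) crowd))) crowd)))) (wall d (cell 5 7 (edge 5 6 u (cell 7 5 (edge 6 5 r (short 6 6 (d ∷ r ∷ []))
    (detour 7 5 (l ∷ []) (l ∷ u ∷ u ∷ []))) (cell 7 6 crowd (edge 6 6 u (unreached 6 6) (stuck 6 6)))) (short 5 7 (d ∷ r ∷ []))) (wall u crowd crowd))
    crowd))
  three-outside (d ∷ l ∷ u ∷ u ∷ []) =
    edge 5 6 r (cell 7 5 (edge 6 5 r (short 6 6 (d ∷ r ∷ [])) (detour 7 5 (l ∷ []) (l ∷ u ∷ u ∷ []))) (cell 6 4 (edge 6 4 u (detour 6 4 (u ∷ []) (l ∷ u
    ∷ u ∷ [])) (short 6 6 (d ∷ d ∷ []))) (wall d (wall r (edge 6 6 u (unreached 6 6) (stuck 6 6)) (cell 4 6 (edge 4 6 r (short 4 6 (r ∷ u ∷ [])) (cell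
    3 5 (edge 3 5 r (edge 4 5 r (detour 3 5 (r ∷ r ∷ []) (u ∷ r ∷ [])) (edge 4 5 u (short 3 5 (r ∷ u ∷ [])) (trap ((4 , 5) ∷ [])))) (edge 4 5 r (edge 4
    5 u (source ((4 , 5) ∷ [])) (short 4 6 (d ∷ l ∷ []))) (detour 6 6 (d ∷ []) (l ∷ l ∷ l ∷ [])))) (cell 3 6 crowd (edge 4 6 u (unreached 4 6) (stuck 4
    6))))) (wall l (cell 7 6 (edge 6 5 r (edge 7 5 u (short 6 6 (d ∷ r ∷ u ∷ [])) (cell 8 5 (edge 7 5 r (short 6 6 (d ∷ r ∷ r ∷ [])) (trap ((7 , 5) ∷
    []))) (wall r crowd (edge 7 5 r (cell 8 6 (edge 8 5 u (short 7 6 (d ∷ r ∷ u ∷ [])) (cell 9 5 (edge 8 5 r (short 7 6 (d ∷ r ∷ r ∷ [])) (trap ((8 ,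
    5) ∷ []))) (wall r crowd crowd))) crowd) (trap ((7 , 5) ∷ [])))))) (cell 8 5 (edge 7 5 r (edge 7 5 u (source ((7 , 5) ∷ [])) (short 7 6 (d ∷ r ∷
    []))) (detour 8 5 (l ∷ l ∷ []) (l ∷ u ∷ u ∷ []))) (wall r crowd (cell 8 6 (cell 9 5 (edge 8 5 r (edge 8 5 u (edge 7 5 r (edge 7 5 u (source ((7 ,
    5) ∷ [])) (short 7 6 (d ∷ r ∷ u ∷ []))) (source ((8 , 5) ∷ []))) (short 8 6 (d ∷ r ∷ []))) (edge 7 5 r (edge 8 5 u (short 9 5 (l ∷ u ∷ [])) (trap
    ((8 , 5) ∷ []))) (detour 9 5 (l ∷ l ∷ l ∷ []) (l ∷ u ∷ u ∷ [])))) (wall r crowd crowd)) crowd)))) (edge 6 6 u (unreached 6 6) (stuck 6 6)))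
    crowd))) (cell 7 6 crowd (edge 6 6 u (unreached 6 6) (stuck 6 6)))))) (short 6 6 (l ∷ u ∷ []))
  three-outside μs = straight μs

  -- The end of these four moves is outside `S`, so monotone shapes are not refuted by a geodesic at
  -- once. Instead the shielded neighbours exhaust the complement. After down, left, up the third
  -- vertex would be next to the start, which is in `S`; this contradicts the shielding.
  two-shielded : List Move → Tree
  two-shielded (d ∷ d ∷ d ∷ d ∷ []) =
    cell 7 6 crowd (cell 5 6 crowd (cell 6 7 (edge 6 6 u (unreached 6 6) (stuck 6 6)) (stuck 6 6)))
  two-shielded (d ∷ d ∷ d ∷ l ∷ []) =
    cell 5 5 (wall r (wall d (cell 4 3 (edge 4 3 r (edge 5 3 u (edge 5 4 u (short 4 3 (r ∷ u ∷ u ∷ [])) (cell 4 4 (edge 4 4 r (trap ((6 , 3) ∷ (5 , 3)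
    ∷ (5 , 4) ∷ (6 , 4) ∷ [])) (short 5 5 (d ∷ l ∷ []))) crowd)) (trap ((5 , 3) ∷ []))) (detour 6 6 (d ∷ []) (d ∷ d ∷ l ∷ l ∷ []))) (wall l crowd
    crowd)) crowd) crowd) crowd
  two-shielded (d ∷ d ∷ l ∷ d ∷ []) =
    crowd
  two-shielded (d ∷ d ∷ l ∷ l ∷ []) =
    cell 4 5 (wall r (wall d (cell 3 4 (edge 3 4 r (edge 4 4 u (short 3 4 (r ∷ u ∷ [])) (trap ((4 , 4) ∷ []))) (detour 6 6 (d ∷ []) (d ∷ l ∷ l ∷ l ∷
    []))) (wall l crowd crowd)) crowd) crowd) crowd
  two-shielded (d ∷ d ∷ l ∷ u ∷ []) =
    wall d (cell 7 5 (edge 6 5 r (short 6 6 (d ∷ r ∷ [])) (cell 5 6 (wall l (cell 8 4 (edge 5 5 r (edge 6 4 r (edge 7 4 r (short 6 6 (d ∷ d ∷ r ∷ r ∷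
    [])) (edge 7 4 u (short 6 6 (d ∷ d ∷ r ∷ u ∷ [])) (trap ((7 , 4) ∷ [])))) (edge 5 5 u (edge 7 4 r (edge 7 4 u (source ((7 , 4) ∷ [])) (short 7 5 (d
    ∷ r ∷ []))) (detour 8 4 (l ∷ l ∷ []) (l ∷ u ∷ u ∷ []))) (trap ((5 , 4) ∷ (5 , 5) ∷ (6 , 5) ∷ (6 , 4) ∷ [])))) (edge 5 5 u (short 6 6 (d ∷ l ∷ u ∷
    [])) (trap ((5 , 5) ∷ [])))) (wall r crowd crowd)) crowd) crowd)) (wall r (wall l crowd (cell 4 5 (cell 5 6 (cell 3 4 (edge 4 5 r (edge 5 5 u
    (short 4 5 (r ∷ u ∷ [])) (edge 5 5 r (edge 4 4 r (trap ((5 , 4) ∷ (5 , 5) ∷ (6 , 5) ∷ (6 , 4) ∷ [])) (edge 3 4 r (edge 4 4 u (short 3 4 (r ∷ u ∷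
    [])) (trap ((4 , 4) ∷ []))) (detour 6 6 (d ∷ []) (d ∷ l ∷ l ∷ l ∷ [])))) (trap ((5 , 5) ∷ [])))) (edge 5 5 u (edge 3 4 r (edge 4 4 r (short 3 4 (r
    ∷ r ∷ u ∷ u ∷ [])) (edge 4 4 u (short 3 4 (r ∷ u ∷ [])) (trap ((4 , 4) ∷ [])))) (edge 4 4 r (edge 4 4 u (source ((4 , 4) ∷ [])) (short 4 5 (d ∷ l ∷
    []))) (detour 6 6 (d ∷ []) (d ∷ l ∷ l ∷ l ∷ [])))) (short 5 6 (d ∷ l ∷ [])))) (wall l crowd crowd)) crowd) crowd)) crowd)) crowd
  two-shielded (d ∷ l ∷ d ∷ d ∷ []) =
    crowd
  two-shielded (d ∷ l ∷ d ∷ l ∷ []) =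
    crowd
  two-shielded (d ∷ l ∷ d ∷ r ∷ []) =
    wall d (wall l (cell 7 5 (edge 6 5 r (short 6 6 (d ∷ r ∷ [])) (cell 7 4 (cell 5 7 (edge 6 4 u (edge 5 5 u (edge 5 6 r (short 6 6 (d ∷ l ∷ u ∷ r ∷
    [])) (edge 5 6 u (short 6 6 (l ∷ u ∷ [])) (trap ((5 , 6) ∷ [])))) (edge 6 4 r (edge 5 6 u (edge 5 6 r (source ((5 , 6) ∷ [])) (short 6 6 (l ∷ u ∷
    []))) (detour 5 7 (d ∷ d ∷ []) (d ∷ r ∷ r ∷ []))) (trap ((5 , 4) ∷ (6 , 4) ∷ (6 , 5) ∷ (5 , 5) ∷ [])))) (edge 6 4 r (short 6 6 (d ∷ d ∷ r ∷ []))
    (trap ((6 , 4) ∷ [])))) (wall u crowd crowd)) crowd)) (wall r crowd crowd)) crowd) crowd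
  two-shielded (d ∷ l ∷ l ∷ d ∷ []) =
    crowd
  two-shielded (d ∷ l ∷ l ∷ l ∷ []) =
    crowd
  two-shielded (d ∷ l ∷ l ∷ u ∷ []) =
    wall d (wall l (cell 7 5 (edge 6 5 r (short 6 6 (d ∷ r ∷ [])) (cell 4 7 (edge 4 6 u (detour 7 5 (l ∷ []) (l ∷ l ∷ u ∷ u ∷ [])) (edge 4 6 r (edge 5
    6 r (short 4 7 (d ∷ r ∷ r ∷ [])) (cell 5 7 (edge 5 6 u (short 6 6 (l ∷ u ∷ [])) (trap ((4 , 5) ∷ (4 , 6) ∷ (5 , 6) ∷ (5 , 5) ∷ []))) crowd)) (trap
    ((4 , 6) ∷ [])))) (wall u crowd crowd))) (wall r crowd crowd)) crowd) crowd
  two-shielded μs = clash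

  transform : (Move → Move) → (Pt → Pt) → Tree → Tree
  transform σ π = τ
    where
    at : (ℕ → ℕ → Tree) → ℕ → ℕ → Tree
    at f x y = let x′ , y′ = π (x , y) in f x′ y′
    τ : Tree → Tree
    τ (wall μ t t′)      = wall (σ μ) (τ t) (τ t′)
    τ (cell x y t t′)    = at (λ x y → cell x y (τ t) (τ t′)) x y
    τ (edge x y μ t t′)  = at (λ x y → edge x y (σ μ) (τ t) (τ t′)) x y
    τ (detour x y μs νs) = at (λ x y → detour x y (map σ μs) (map σ νs)) x y
    τ (short x y μs)     = at (λ x y → short x y (map σ μs)) x y
    τ (trap ps)          = trap (map π ps)
    τ (source ps)        = source (map π ps)
    τ (stuck x y)        = at stuck x y
    τ (unreached x y)    = at unreached x y
    τ crowd              = crowd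
    τ clash              = clash

  -- Rotations and reflections about (6 , 6) reduce to paths that start by a move down and
  -- whose first horizontal move is to the left.
  symmetric : (List Move → Tree) → List Move → Tree
  symmetric f μs = steep μs
    where
    swap mirror flip : Move → Move
    swap l = d
    swap r = u
    swap d = l
    swap u = r
    mirror l = r
    mirror r = l
    mirror μ = μ
    flip d = u
    flip u = d
    flip μ = μ
    rightish : List Move → Bool
    rightish []       = false
    rightish (r ∷ μs) = true
    rightish (l ∷ μs) = false
    rightish (_ ∷ μs) = rightish μs
    leftwards downwards steep : List Move → Tree
    leftwards μs = if rightish μs then transform mirror (λ (x , y) → 12 ∸ x , y) (f (map mirror μs)) else f μs
    downwards (u ∷ μs) = transform flip (λ (x , y) → x , 12 ∸ y) (leftwards (map flip (u ∷ μs)))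
    downwards μs       = leftwards μs
    steep (d ∷ μs) = downwards (d ∷ μs)
    steep (u ∷ μs) = downwards (u ∷ μs)
    steep μs       = transform swap (λ (x , y) → y , x) (downwards (map swap μs))

  -- The index 6 leaves room to the left and below for all points that the trees visit, and
  -- reflection in the start becomes subtraction from 12.
  start : ℕ → Facts
  start k = facts k (interval 6 6 false false) (interval 6 6 false false) (((6 , 6) , true) ∷ []) []

  explored₁ : Explored (enter ∷ leave ∷ []) (6 , 6) (start 0) (symmetric straight)
  explored₁ = toWitness {a? = explored? (enter ∷ leave ∷ []) (6 , 6) (start 0) (symmetric straight)} _

  explored₂ : Explored (enter ∷ enter ∷ leave ∷ []) (6 , 6) (start 1) (symmetric u-turn)
  explored₂ = toWitness {a? = explored? (enter ∷ enter ∷ leave ∷ []) (6 , 6) (start 1) (symmetric u-turn)} _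

  explored₃ : Explored (enter ∷ enter ∷ pass ∷ leave ∷ []) (6 , 6) (start 2) (symmetric three-outside)
  explored₃ = toWitness {a? = explored? (enter ∷ enter ∷ pass ∷ leave ∷ []) (6 , 6) (start 2) (symmetric three-outside)} _

  explored₄ : Explored (enter ∷ enter ∷ pass ∷ pass ∷ []) (6 , 6) (start 3) (symmetric two-shielded)
  explored₄ = toWitness {a? = explored? (enter ∷ enter ∷ pass ∷ pass ∷ []) (6 , 6) (start 3) (symmetric two-shielded)} _

-- The least size of a complement, and the excluded values 2, 3 and 5.

module Upper where

  open Core
  open Window
  open Cert
  open import Data.Fin.Base using (Fin)
  open import Data.Fin.Properties using () renaming (_≟_ to _≟ᶠ_; any? to any?ᶠ)
  open import Data.Fin.Subset using (Subset; ∁; ∣_∣) renaming (_∈_ to _∈ˢ_; _∉_ to _∉ˢ_)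
  open import Data.Fin.Subset.Properties using (_∈?_; ∣∁p∣≡n∸∣p∣; ∣p∣≤n; ⊆⊤; ⊆-antisym)
  open import Data.List.Base using ([]; _∷_)
  open import Data.List.Relation.Unary.All as All using (All; []; _∷_)
  open import Data.List.Relation.Unary.AllPairs using ([]; _∷_)
  open import Data.Nat.Base using (ℕ; zero; suc; _+_; _*_; _≤_; _<_; z≤n; s≤s)
  open import Data.Nat.Properties
  open import Data.Product.Base using (Σ-syntax; ∃-syntax; _×_; _,_; proj₁; proj₂)
  open import Data.Sum.Base using (_⊎_; inj₁; inj₂; [_,_])
  open import Data.Empty using (⊥; ⊥-elim)
  open import Data.Bool.Base using (Bool; true; false; not; _xor_)
  open import Data.Bool.Properties using (not-involutive; not-¬)
  open import Function.Base using (_∘_)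
  open import Relation.Binary.Construct.Closure.ReflexiveTransitive using (ε; _◅_)
  open import Relation.Binary.PropositionalEquality using (_≡_; _≢_; refl; sym; trans; cong; cong₂; subst)
  open import Relation.Nullary using (¬_; yes; no; contradiction)
  open import Relation.Nullary.Decidable using (¬?; decidable-stable)

  Next : ℕ → ℕ → Set
  Next y z = suc y ≡ z ⊎ suc z ≡ y

  next-unique : ∀ {a b y z} → a ≢ b → Next a y → Next b y → Next a z → Next b z → y ≡ z
  next-unique ne (inj₁ p) (inj₁ q) _ _ = contradiction (suc-injective (trans p (sym q))) ne
  next-unique ne (inj₂ p) (inj₂ q) _ _ = contradiction (trans (sym p) q) ne
  next-unique ne (inj₁ p) _ (inj₁ f) _ = trans (sym p) f
  next-unique ne (inj₂ p) _ (inj₂ f) _ = suc-injective (trans p (sym f))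
  next-unique ne _ (inj₁ q) _ (inj₁ g) = trans (sym q) g
  next-unique ne _ (inj₂ q) _ (inj₂ g) = suc-injective (trans q (sym g))
  next-unique ne (inj₁ refl) (inj₂ refl) (inj₂ f) (inj₁ refl) = contradiction f (m≢1+n+m _ {3} ∘ sym)
  next-unique ne (inj₂ refl) (inj₁ refl) (inj₁ refl) (inj₂ g) = contradiction g (m≢1+n+m _ {3} ∘ sym)

  module _ {n m : ℕ} (D : Orientation (P n □ P m)) where

    open Coordinates n m
    open Digraph D

    private
      Near : Pt → Pt → Set
      Near = Beside D

    -- Distinct vertices of a row or column can share only the vertex between them; any others can
    -- share only the two remaining corners of their rectangle.
    no-three-common-neighbours : ∀ {p q x y z} → p ≢ q → Near p x → Near q x → Near p y → Near q y → Near p z → Near q z →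
             x ≢ y → y ≢ z → x ≢ z → ⊥
    no-three-common-neighbours {p₁ , p₂} {q₁ , q₂} {x} {y} {z} ne a a′ b b′ c c′ xy yz xz with p₁ ≟ q₁ | p₂ ≟ q₂
    ... | yes refl | yes refl = ne refl
    ... | yes refl | no ne₂ = xy (trans (proj₁ (vertical a a′)) (trans (cong (p₁ ,_)
          (next-unique ne₂ (proj₁ (proj₂ (vertical a a′))) (proj₂ (proj₂ (vertical a a′)))
                           (proj₁ (proj₂ (vertical b b′))) (proj₂ (proj₂ (vertical b b′))))) (sym (proj₁ (vertical b b′)))))
      where
      vertical : ∀ {x} → Near (p₁ , p₂) x → Near (p₁ , q₂) x → x ≡ (p₁ , proj₂ x) × Next p₂ (proj₂ x) × Next q₂ (proj₂ x)
      vertical (inj₁ (refl , e₁)) (inj₁ (_ , e₂)) = refl , e₁ , e₂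
      vertical (inj₁ (refl , e₁)) (inj₂ (e₂ , _)) = ⊥-elim ([ 1+n≢n , 1+n≢n ] e₂)
      vertical (inj₂ (e₁ , refl)) (inj₁ (refl , e₂)) = ⊥-elim ([ 1+n≢n , 1+n≢n ] e₁)
      vertical (inj₂ (e₁ , refl)) (inj₂ (_ , e)) = contradiction (sym e) ne₂
    ... | no ne₁ | yes refl = xy (trans (proj₁ (horizontal a a′)) (trans (cong (_, p₂)
          (next-unique ne₁ (proj₁ (proj₂ (horizontal a a′))) (proj₂ (proj₂ (horizontal a a′)))
                           (proj₁ (proj₂ (horizontal b b′))) (proj₂ (proj₂ (horizontal b b′))))) (sym (proj₁ (horizontal b b′)))))
      where
      horizontal : ∀ {x} → Near (p₁ , p₂) x → Near (q₁ , p₂) x → x ≡ (proj₁ x , p₂) × Next p₁ (proj₁ x) × Next q₁ (proj₁ x)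
      horizontal (inj₂ (e₁ , refl)) (inj₂ (e₂ , _)) = refl , e₁ , e₂
      horizontal (inj₂ (e₁ , refl)) (inj₁ (_ , e₂)) = ⊥-elim ([ 1+n≢n , 1+n≢n ] e₂)
      horizontal (inj₁ (refl , e₁)) (inj₂ (_ , refl)) = ⊥-elim ([ 1+n≢n , 1+n≢n ] e₁)
      horizontal (inj₁ (refl , e₁)) (inj₁ (e , _)) = contradiction (sym e) ne₁
    ... | no ne₁ | no ne₂ with corner a a′ | corner b b′ | corner c c′
      where
      corner : ∀ {x} → Near (p₁ , p₂) x → Near (q₁ , q₂) x → x ≡ (p₁ , q₂) ⊎ x ≡ (q₁ , p₂)
      corner (inj₁ (e , _)) (inj₁ (f , _)) = contradiction (trans e (sym f)) ne₁
      corner (inj₂ (_ , e)) (inj₂ (_ , f)) = contradiction (trans e (sym f)) ne₂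
      corner (inj₁ (e , _)) (inj₂ (_ , f)) = inj₁ (cong₂ _,_ (sym e) (sym f))
      corner (inj₂ (_ , e)) (inj₁ (f , _)) = inj₂ (cong₂ _,_ (sym f) (sym e))
    ... | inj₁ e | inj₁ f | _      = xy (trans e (sym f))
    ... | inj₂ e | inj₂ f | _      = xy (trans e (sym f))
    ... | inj₁ e | inj₂ _ | inj₁ g = xz (trans e (sym g))
    ... | inj₂ e | inj₁ _ | inj₂ g = xz (trans e (sym g))
    ... | inj₁ _ | inj₂ f | inj₂ g = yz (trans f (sym g))
    ... | inj₂ _ | inj₁ f | inj₁ g = yz (trans f (sym g))

    private
      parity : Fin (n * m) → Bool
      parity v = isEven (proj₁ (co v)) xor isEven (proj₂ (co v))

      near-parity : ∀ {x y x′ y′} → Near (x , y) (x′ , y′) → isEven x′ xor isEven y′ ≡ not (isEven x xor isEven y)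
      near-parity {x} {y} (inj₁ (refl , inj₁ refl)) with isEven x
      ... | true  = refl
      ... | false = refl
      near-parity {x} {_} {_} {y} (inj₁ (refl , inj₂ refl)) with isEven x
      ... | true  = sym (not-involutive _)
      ... | false = sym (not-involutive _)
      near-parity {x} {y} (inj₂ (inj₁ refl , refl)) with isEven x
      ... | true  = sym (not-involutive _)
      ... | false = refl
      near-parity {_} {y} {x} (inj₂ (inj₂ refl , refl)) with isEven x
      ... | true  = refl
      ... | false = sym (not-involutive _)

      arc-parity : ∀ {v w} → Arc v w → parity w ≡ not (parity v)
      arc-parity a = near-parity (arc⇒beside D a)

      2-apart : ∀ {u v w} → Arc u v → Arc v w → u ≢ w
      2-apart a b refl = arc-asym a b

      1-apart : ∀ {u v} → Arc u v → u ≢ v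
      1-apart a refl = arc-asym a a

      3-apart : ∀ {u v w z} → Arc u v → Arc v w → Arc w z → u ≢ z
      3-apart a b c refl = not-¬ refl (trans (arc-parity c) (cong not
        (trans (arc-parity b) (trans (cong not (arc-parity a)) (not-involutive _)))))

    module _ (st : Strong D) {S : Subset (n * m)} (cx : Convex D S)
             {s₀ s₁} (s₀∈ : s₀ ∈ˢ S) (s₁∈ : s₁ ∈ˢ S) (s₀≢s₁ : s₀ ≢ s₁) where

      open Inhabited D st cx s₀∈ s₁∈ s₀≢s₁

      -- Three steps along out-neighbours inside `S` never return: not after two by asymmetry, not
      -- after three by parity.
      4≤∣S∣ : 4 ≤ ∣ S ∣
      4≤∣S∣ with out-neighbour s₀∈
      ... | v₁ , v₁∈ , a₀ with out-neighbour v₁∈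
      ...   | v₂ , v₂∈ , a₁ with out-neighbour v₂∈
      ...     | v₃ , v₃∈ , a₂ = Unique⇒count≤ (s₀ ∷ v₁ ∷ v₂ ∷ v₃ ∷ [])
        ((1-apart a₀ ∷ 2-apart a₀ a₁ ∷ 3-apart a₀ a₁ a₂ ∷ []) ∷ (1-apart a₁ ∷ 2-apart a₁ a₂ ∷ []) ∷ (1-apart a₂ ∷ []) ∷ [] ∷ [])
        (s₀∈ ∷ v₁∈ ∷ v₂∈ ∷ v₃∈ ∷ [])

      -- A fifth vertex has an in- and an out-neighbour on the 4-cycle, which are opposite
      -- corners of it and thus have three common neighbours.
      pendant : ∀ {c₀ c₁ c₂ c₃ e} → All (_∈ˢ S) (e ∷ c₀ ∷ c₁ ∷ c₂ ∷ c₃ ∷ []) → Arc c₀ c₁ → Arc c₁ c₂ → Arc c₂ c₃ → Arc c₃ c₀ →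
                All (e ≢_) (c₀ ∷ c₁ ∷ c₂ ∷ c₃ ∷ []) → ∣ S ∣ ≢ 5
      pendant {c₀} {c₁} {c₂} {c₃} {e} mem@(e∈ ∷ _) a₀ a₁ a₂ a₃ ne@(n₀ ∷ n₁ ∷ n₂ ∷ n₃ ∷ []) ∣S∣≡5
        with out-neighbour e∈ | in-neighbour e∈
      ... | o , o∈ , ao | i , i∈ , ai = meet (on-cycle o∈ (1-apart ao ∘ sym)) (on-cycle i∈ (1-apart ai))
        where
        on-cycle : ∀ {w} → w ∈ˢ S → w ≢ e → w ≡ c₀ ⊎ w ≡ c₁ ⊎ w ≡ c₂ ⊎ w ≡ c₃
        on-cycle {w} w∈ w≢e with w ≟ᶠ c₀ | w ≟ᶠ c₁ | w ≟ᶠ c₂ | w ≟ᶠ c₃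
        ... | yes p | _ | _ | _ = inj₁ p
        ... | _ | yes p | _ | _ = inj₂ (inj₁ p)
        ... | _ | _ | yes p | _ = inj₂ (inj₂ (inj₁ p))
        ... | _ | _ | _ | yes p = inj₂ (inj₂ (inj₂ p))
        ... | no p₀ | no p₁ | no p₂ | no p₃ = contradiction
          (Unique⇒count≤ (w ∷ e ∷ c₀ ∷ c₁ ∷ c₂ ∷ c₃ ∷ [])
            ((w≢e ∷ p₀ ∷ p₁ ∷ p₂ ∷ p₃ ∷ []) ∷ ne ∷ (1-apart a₀ ∷ 2-apart a₀ a₁ ∷ (1-apart a₃ ∘ sym) ∷ []) ∷
             (1-apart a₁ ∷ 2-apart a₁ a₂ ∷ []) ∷ (1-apart a₂ ∷ []) ∷ [] ∷ []) (w∈ ∷ mem))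
          (<⇒≱ (≤-reflexive (cong suc ∣S∣≡5)))
        out : ∀ {v w} → Arc v w → Near (co v) (co w)
        out = arc⇒beside D
        into : ∀ {v w} → Arc w v → Near (co v) (co w)
        into = beside-sym D ∘ arc⇒beside D
        co≢ : ∀ {v w} → v ≢ w → co v ≢ co w
        co≢ ne = ne ∘ co-injective
        opposite : ∀ {p q c d} → p ≢ q → Near (co p) (co c) → Near (co q) (co c) → Near (co p) (co d) → Near (co q) (co d) →
                   Near (co p) (co e) → Near (co q) (co e) → c ≢ d → e ≢ c → e ≢ d → ⊥
        opposite pq a a′ b b′ c c′ cd ec ed = no-three-common-neighbours (co≢ pq) a a′ b b′ c c′ (co≢ cd) (co≢ (ed ∘ sym)) (co≢ (ec ∘ sym))
        apart : ∀ {v} → Arc e v → ¬ Arc v e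
        apart a b = arc-asym a b
        odd : ∀ {v w} → Arc v w → ¬ (Arc e v × Arc w e)
        odd a (b , c) = 3-apart b a c refl
        odd′ : ∀ {v w} → Arc w v → ¬ (Arc e v × Arc w e)
        odd′ a (b , c) = not-¬ (arc-parity a) (trans (arc-parity b) (cong not (arc-parity c)))
        meet : o ≡ c₀ ⊎ o ≡ c₁ ⊎ o ≡ c₂ ⊎ o ≡ c₃ → i ≡ c₀ ⊎ i ≡ c₁ ⊎ i ≡ c₂ ⊎ i ≡ c₃ → ⊥
        meet (inj₁ refl) (inj₁ refl) = apart ao ai
        meet (inj₁ refl) (inj₂ (inj₁ refl)) = odd a₀ (ao , ai)
        meet (inj₁ refl) (inj₂ (inj₂ (inj₁ refl))) =
          opposite (2-apart a₀ a₁) (out a₀) (into a₁) (into a₃) (out a₂) (into ao) (out ai) (2-apart a₁ a₂) n₁ n₃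
        meet (inj₁ refl) (inj₂ (inj₂ (inj₂ refl))) = odd′ a₃ (ao , ai)
        meet (inj₂ (inj₁ refl)) (inj₁ refl) = odd′ a₀ (ao , ai)
        meet (inj₂ (inj₁ refl)) (inj₂ (inj₁ refl)) = apart ao ai
        meet (inj₂ (inj₁ refl)) (inj₂ (inj₂ (inj₁ refl))) = odd a₁ (ao , ai)
        meet (inj₂ (inj₁ refl)) (inj₂ (inj₂ (inj₂ refl))) =
          opposite (2-apart a₁ a₂) (out a₁) (into a₂) (into a₀) (out a₃) (into ao) (out ai) (2-apart a₂ a₃) n₂ n₀
        meet (inj₂ (inj₂ (inj₁ refl))) (inj₁ refl) =
          opposite (2-apart a₂ a₃) (out a₂) (into a₃) (into a₁) (out a₀) (into ao) (out ai) (2-apart a₃ a₀) n₃ n₁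
        meet (inj₂ (inj₂ (inj₁ refl))) (inj₂ (inj₁ refl)) = odd′ a₁ (ao , ai)
        meet (inj₂ (inj₂ (inj₁ refl))) (inj₂ (inj₂ (inj₁ refl))) = apart ao ai
        meet (inj₂ (inj₂ (inj₁ refl))) (inj₂ (inj₂ (inj₂ refl))) = odd a₂ (ao , ai)
        meet (inj₂ (inj₂ (inj₂ refl))) (inj₁ refl) = odd a₃ (ao , ai)
        meet (inj₂ (inj₂ (inj₂ refl))) (inj₂ (inj₁ refl)) =
          opposite (2-apart a₃ a₀) (out a₃) (into a₀) (into a₂) (out a₁) (into ao) (out ai) (2-apart a₀ a₁) n₀ n₂
        meet (inj₂ (inj₂ (inj₂ refl))) (inj₂ (inj₂ (inj₁ refl))) = odd′ a₂ (ao , ai)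
        meet (inj₂ (inj₂ (inj₂ refl))) (inj₂ (inj₂ (inj₂ refl))) = apart ao ai

      -- A walk along out-neighbours inside `S` is followed for five steps. It closes a 4-cycle at
      -- `s₀` or at `v₁`, which leaves one pendant vertex, or else it visits six distinct vertices;
      -- parity and asymmetry exclude all other coincidences.
      ∣S∣≢5 : ∣ S ∣ ≢ 5
      ∣S∣≢5 ∣S∣≡5 with out-neighbour s₀∈
      ... | v₁ , v₁∈ , a₀ with out-neighbour v₁∈
      ...   | v₂ , v₂∈ , a₁ with out-neighbour v₂∈
      ...     | v₃ , v₃∈ , a₂ with out-neighbour v₃∈
      ...       | v₄ , v₄∈ , a₃ with v₄ ≟ᶠ s₀
      ...         | no v₄≢ with out-neighbour v₄∈
      ...           | v₅ , v₅∈ , a₄ with v₅ ≟ᶠ v₁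
      ...             | yes refl = pendant (s₀∈ ∷ v₁∈ ∷ v₂∈ ∷ v₃∈ ∷ v₄∈ ∷ []) a₁ a₂ a₃ a₄
                          (1-apart a₀ ∷ 2-apart a₀ a₁ ∷ 3-apart a₀ a₁ a₂ ∷ (v₄≢ ∘ sym) ∷ []) ∣S∣≡5
      ...             | no v₅≢ = contradiction
                          (Unique⇒count≤ (v₅ ∷ s₀ ∷ v₁ ∷ v₂ ∷ v₃ ∷ v₄ ∷ [])
                            ((five ∷ v₅≢ ∷ (3-apart a₂ a₃ a₄ ∘ sym) ∷ (2-apart a₃ a₄ ∘ sym) ∷ (1-apart a₄ ∘ sym) ∷ []) ∷
                             (1-apart a₀ ∷ 2-apart a₀ a₁ ∷ 3-apart a₀ a₁ a₂ ∷ (v₄≢ ∘ sym) ∷ []) ∷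
                             (1-apart a₁ ∷ 2-apart a₁ a₂ ∷ 3-apart a₁ a₂ a₃ ∷ []) ∷ (1-apart a₂ ∷ 2-apart a₂ a₃ ∷ []) ∷
                             (1-apart a₃ ∷ []) ∷ [] ∷ [])
                            (v₅∈ ∷ s₀∈ ∷ v₁∈ ∷ v₂∈ ∷ v₃∈ ∷ v₄∈ ∷ []))
                          (<⇒≱ (≤-reflexive (cong suc ∣S∣≡5)))
        where
        five : v₅ ≢ s₀
        five refl = not-¬ refl (trans (arc-parity a₄) (cong not (trans (arc-parity a₃) (trans (cong not
          (trans (arc-parity a₂) (trans (cong not (trans (arc-parity a₁) (trans (cong not (arc-parity a₀)) (not-involutive _))))
            refl))) (not-involutive _)))))
      ∣S∣≢5 ∣S∣≡5 | v₁ , v₁∈ , a₀ | v₂ , v₂∈ , a₁ | v₃ , v₃∈ , a₂ | .s₀ , v₄∈ , a₃ | yes refl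
        with another (s₀ ∷ v₁ ∷ v₂ ∷ v₃ ∷ []) (≤-reflexive (sym ∣S∣≡5))
      ... | w , w∈ , ne = pendant (w∈ ∷ s₀∈ ∷ v₁∈ ∷ v₂∈ ∷ v₃∈ ∷ []) a₀ a₁ a₂ a₃ ne ∣S∣≡5

      module _ {c} (c∉ : c ∉ˢ S) (few : ∣ ∁ S ∣ ≤ 5) (few-n : ∣ ∁ S ∣ < n) (few-m : ∣ ∁ S ∣ < m) where

        private
          contradict : ∀ ℓs {k v} cert → Unescaped D S k → v ∈ˢ S → Legs D S ℓs v → ¬ Explored ℓs (6 , 6) (start k) cert
          contradict ℓs {k} {v} cert un v∈ legs =
            explore ℓs {cert = cert} (holds ≤-refl (axis (proj₁ (co-in v))) (axis (proj₂ (co-in v))) ((v , (refl , refl) , v∈) ∷ []) [])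
              (refl , refl) legs
            where
            open Refutation D 6 (proj₁ (co v)) (proj₂ (co v)) st cx s₀∈ s₁∈ s₀≢s₁ few few-n few-m un
            axis : ∀ {n x} → x < n → Holds-in n x (interval 6 6 false false)
            axis {x = x} x< = record { above = m≤n+m 6 x ; under = +-monoˡ-< 6 x< ; low = λ () ; high = λ () }

          weaken : ∀ {j k} → j ≤ k → Unescaped D S k → Unescaped D S j
          weaken le un v∈ a w∉ o j≤ = un v∈ a w∉ o (≤-trans j≤ le)

          extend : ∀ k → Unescaped D S k → Unescaped D S (suc k)
          extend k un v∈ a w∉ (here w∈) _ = w∉ w∈
          extend k un v∈ a w∉ o j≤ with m≤n⇒m<n∨m≡n j≤
          ... | inj₁ (s≤s j≤k) = un v∈ a w∉ o j≤k
          extend 0 un v∈ a w∉ (there _ b (here t∈)) j≤ | inj₂ refl =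
            contradict (enter ∷ leave ∷ []) (symmetric straight) un v∈ (enter a w∉ (leave b t∈ [])) explored₁
          extend 1 un v∈ a w∉ (there _ b (there x∉ c (here t∈))) j≤ | inj₂ refl =
            contradict (enter ∷ enter ∷ leave ∷ []) (symmetric u-turn) un v∈ (enter a w∉ (enter b x∉ (leave c t∈ []))) explored₂
          extend 2 un v∈ a w∉ (there _ b (there x∉ c (there y∉ e (here t∈)))) j≤ | inj₂ refl =
            contradict (enter ∷ enter ∷ pass ∷ leave ∷ []) (symmetric three-outside) un v∈
              (enter a w∉ (enter b x∉ (pass alone c (leave e t∈ [])))) explored₃
            where
            alone : ∀ z → Near (co _) (co z) → z ∉ˢ S
            alone z near z∈ with beside⇒arc D near
            ... | inj₁ arc = un v∈ a w∉ (there w∉ b (there x∉ arc (here z∈))) ≤-refl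
            ... | inj₂ arc = un z∈ arc x∉ (there x∉ c (there y∉ e (here t∈))) ≤-refl
          -- The tree relies only on the exclusion of paths through at most three outside vertices,
          -- so the same tree serves every greater length.
          extend (suc (suc (suc k))) un v∈ a w∉ (there _ b (there x∉ c (there y∉ e o@(there z∉ _ _)))) j≤ | inj₂ refl =
            contradict (enter ∷ enter ∷ pass ∷ pass ∷ []) (symmetric two-shielded) (weaken (m≤m+n 3 k) un) v∈
              (enter a w∉ (enter b x∉ (pass second c (pass third e [])))) explored₄
            where
            second : ∀ z → Near (co _) (co z) → z ∉ˢ S
            second z near z∈ with beside⇒arc D near
            ... | inj₁ arc = un v∈ a w∉ (there w∉ b (there x∉ arc (here z∈))) (m≤m+n 2 (suc k))
            ... | inj₂ arc = un z∈ arc x∉ (there x∉ c (there y∉ e o)) ≤-refl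
            third : ∀ z → Near (co _) (co z) → z ∉ˢ S
            third z near z∈ with beside⇒arc D near
            ... | inj₁ arc = un v∈ a w∉ (there w∉ b (there x∉ c (there y∉ arc (here z∈)))) (m≤m+n 3 k)
            ... | inj₂ arc = un z∈ arc y∉ (there y∉ e o) (n≤1+n _)

        unescaped : ∀ k → Unescaped D S k
        unescaped zero    v∈ a w∉ (here w∈) _ = w∉ w∈
        unescaped (suc k) = extend k (unescaped k)

        -- The first arc that leaves S starts a path back into S.
        too-few : ⊥
        too-few = leave-at s₀∈ c∉ (proj₁ (st s₀ c))
          where
          out : ∀ {w} → w ∉ˢ S → Walk D w s₀ → ∃[ j ] Out D S j w
          out w∉ ε = contradiction s₀∈ w∉
          out w∉ (_◅_ {j = x} a p) with x ∈? S
          ... | yes x∈ = _ , there w∉ a (here x∈)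
          ... | no x∉  = _ , there w∉ a (proj₂ (out x∉ p))
          leave-at : ∀ {v w} → v ∈ˢ S → w ∉ˢ S → Walk D v w → ⊥
          leave-at v∈ w∉ ε = w∉ v∈
          leave-at v∈ w∉ (_◅_ {j = x} a p) with x ∈? S
          ... | yes x∈ = leave-at x∈ w∉ p
          ... | no x∉  = let j , o = out x∉ (proj₁ (st x s₀)) in unescaped j v∈ a x∉ o ≤-refl

  -- With fewer than `q` vertices the complement has at most five and fewer than either side of the
  -- grid, which is what `too-few` refutes. A single vertex is no start for that argument and is
  -- bounded by `suc q ≤ n * m` directly.
  spectrum-bounds : ∀ {n m s} q → q ≤ 6 → q ≤ m → q ≤ n → suc q ≤ n * m → StrongConvexitySpectrum (P n □ P m) s →
                    1 ≤ s × s + q ≤ n * m × s ≢ 2 × s ≢ 3 × s ≢ 5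
  spectrum-bounds {n} {m} q q≤6 q≤m q≤n q< (D , st , (S , (cx@((s₀ , s₀∈) , _) , S≢⊤) , refl) , _)
    with 1 <? ∣ S ∣
  ... | no ≯1 = Unique⇒count≤ (s₀ ∷ []) ([] ∷ []) (s₀∈ ∷ []) , ≤-trans (+-monoˡ-≤ q (≮⇒≥ ≯1)) q< ,
    (λ e → ≯1 (≤-reflexive (sym e))) , (λ e → ≯1 (≤-trans (s≤s (s≤s z≤n)) (≤-reflexive (sym e)))) ,
    (λ e → ≯1 (≤-trans (s≤s (s≤s z≤n)) (≤-reflexive (sym e))))
  ... | yes >1 with another (s₀ ∷ []) >1
  ...   | s₁ , s₁∈ , (ne ∷ []) =
    <⇒≤ >1 , decidable-stable (_ ≤? _) (λ ≰ → too-few D st cx s₀∈ s₁∈ (ne ∘ sym) (proj₂ missing)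
      (≤-pred (≤-trans (few (≰⇒> ≰)) q≤6)) (≤-trans (few (≰⇒> ≰)) q≤n) (≤-trans (few (≰⇒> ≰)) q≤m)) ,
    (λ e → <⇒≱ (s≤s (s≤s (s≤s z≤n))) (subst (4 ≤_) e 4≤)) , (λ e → <⇒≱ (s≤s (s≤s (s≤s (s≤s z≤n)))) (subst (4 ≤_) e 4≤)) ,
    ∣S∣≢5 D st cx s₀∈ s₁∈ (ne ∘ sym)
    where
    4≤ = 4≤∣S∣ D st cx s₀∈ s₁∈ (ne ∘ sym)
    missing : ∃[ c ] c ∉ˢ S
    missing with any?ᶠ (λ c → ¬? (c ∈? S))
    ... | yes c = c
    ... | no all = contradiction (⊆-antisym ⊆⊤ (λ {c} _ → decidable-stable (c ∈? S) (λ c∉ → all (c , c∉)))) S≢⊤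
    few : n * m < ∣ S ∣ + q → ∣ ∁ S ∣ < q
    few lt = ≤-trans (s≤s (≤-reflexive (∣∁p∣≡n∸∣p∣ S)))
      (+-cancelˡ-≤ ∣ S ∣ _ _ (≤-trans (≤-reflexive (trans (+-suc ∣ S ∣ _) (cong suc (m+[n∸m]≡n (∣p∣≤n S))))) lt))

-- The arithmetic of which construction yields which value.

open Heights using (staircase; _times_then_)
open Psi2 using (low-staircase)
open Psi7 using (module TwoFaces)
open Cyc using (module AllCyclic)
open Corner using (module SmallCorner)
open Small using (spectrum-7; spectrum-8; spectrum-9)
open Upper using (spectrum-bounds)
open import Data.Nat.Base using (ℕ; zero; suc; _+_; _*_; _∸_; _/_; _%_; _≤_; _<_; z≤n; s≤s)
open import Data.Nat.Properties
open import Data.Nat.DivMod using (m≡m%n+[m/n]*n; m%n<n)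
open import Data.Nat.Tactic.RingSolver using (solve-∀)
open import Data.Product.Base using (Σ-syntax; ∃-syntax; _×_; _,_)
open import Data.Sum.Base using (_⊎_; inj₁; inj₂)
open import Data.Empty using (⊥)
open import Relation.Binary.PropositionalEquality using (_≡_; _≢_; refl; sym; trans; cong; subst)
open import Relation.Nullary using (yes; no; contradiction)
open import Relation.Unary using (_≐_; _∖_; _∪_; ｛_｝)

Realized : ℕ → ℕ → ℕ → Set₁
Realized n m = StrongConvexitySpectrum (P n □ P m)

-- With m = c + 2 and n = A + 4 the heights (m^(k+2), i+2, 2^e) of staircase, where k + e = A,
-- have the sum (k c + i) + (2 m + 2 A + 2).
staircase-at : ∀ k e μ i → i ≤ 2 + μ → Realized (4 + (k + e)) (4 + μ) (i + k * (2 + μ) + (2 * (4 + μ) + 2 * (k + e) + 2))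
staircase-at k e μ i i≤ = subst (Realized (4 + (k + e)) (4 + μ)) (shape k e i μ)
  (staircase k (i + 2) e (4 + μ) (m≤n+m 2 i) (≤-trans (+-monoˡ-≤ 2 i≤) (≤-reflexive (+-comm (2 + μ) 2))))
  where
  shape : ∀ k e i μ → (2 + k) * (4 + μ) + (i + 2 + e * 2) ≡ i + k * (2 + μ) + (2 * (4 + μ) + 2 * (k + e) + 2)
  shape = solve-∀

division : ∀ x c → ∃[ k ] ∃[ i ] (i ≤ c × i + k * suc c ≡ x)
division x c = x / suc c , x % suc c , ≤-pred (m%n<n x (suc c)) , sym (m≡m%n+[m/n]*n x (suc c))

-- Division by m - 2 yields the number of full columns beyond the first two and the height of the
-- next column. Only the upper end has quotient A + 1; it is reached with quotient A and the
-- remainder m - 2 instead.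
staircase-range : ∀ A μ {s} → 2 * (4 + μ) + 2 * A + 2 ≤ s → s ≤ (3 + A) * (4 + μ) → Realized (4 + A) (4 + μ) s
staircase-range A μ low high with m≤n⇒∃[o]m+o≡n low
... | x , refl with division x (1 + μ)
... | k , i , i≤ , refl with k ≤? A
...   | yes k≤A with m≤n⇒∃[o]m+o≡n k≤A
...     | e , refl = subst (Realized (4 + (k + e)) (4 + μ)) (+-comm _ (2 * (4 + μ) + 2 * (k + e) + 2)) (staircase-at k e μ i (m≤n⇒m≤1+n i≤))
staircase-range A μ low high | _ , refl | k , i , i≤ , refl | no k≰A =
  subst (λ B → Realized (4 + B) (4 + μ) (2 * (4 + μ) + 2 * A + 2 + (i + k * (2 + μ)))) (+-identityʳ A)
    (subst (Realized (4 + (A + 0)) (4 + μ)) (trans (flat A μ) (≤-antisym least high)) (staircase-at A 0 μ (2 + μ) ≤-refl))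
  where
  flat : ∀ A μ → 2 + μ + A * (2 + μ) + (2 * (4 + μ) + 2 * (A + 0) + 2) ≡ (3 + A) * (4 + μ)
  flat = solve-∀
  shape : ∀ A μ → (3 + A) * (4 + μ) ≡ 2 * (4 + μ) + 2 * A + 2 + suc A * (2 + μ)
  shape = solve-∀
  least : (3 + A) * (4 + μ) ≤ 2 * (4 + μ) + 2 * A + 2 + (i + k * (2 + μ))
  least = ≤-trans (≤-reflexive (shape A μ)) (+-monoʳ-≤ (2 * (4 + μ) + 2 * A + 2) (≤-trans (*-monoˡ-≤ (2 + μ) (≰⇒> k≰A)) (m≤n+m _ i)))

low-realized : ∀ k H j y₀ A m → k ≤ A → 2 + y₀ ≤ j → j ≤ H → H ≤ m → y₀ ≤ 1 → 2 + y₀ < m →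
               (H ≡ m ⊎ (k ≤ 1 × H ≡ j)) → (H ≡ j ⊎ 2 ≤ k) → (k ≡ 0 → j ≡ 2 + y₀) → Realized (4 + A) m (k * H + (j + (2 + y₀)))
low-realized k H j y₀ A m k≤A β≤j j≤H H≤m y₀≤1 y₀< H-cond level zero-cond =
  subst (λ n → Realized n m (k * H + (j + (2 + y₀)))) size (low-staircase k H j y₀ (A ∸ k) m β≤j j≤H H≤m y₀≤1 y₀< H-cond (flat k level zero-cond))
  where
  size : k + (4 + (A ∸ k)) ≡ 4 + A
  size = trans (+-suc k _) (cong suc (trans (+-suc k _) (cong suc (trans (+-suc k _) (cong suc (trans (+-suc k _) (cong suc (m+[n∸m]≡n k≤A))))))))
  flat : ∀ k → (H ≡ j ⊎ 2 ≤ k) → (k ≡ 0 → j ≡ 2 + y₀) →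
         let h = k times H then 1 times j then 1 times suc (suc y₀) then (λ _ → 0) in h 0 ≡ h 1
  flat zero          _           z = z refl
  flat (suc zero)    (inj₁ e)    _ = e
  flat (suc zero)    (inj₂ (s≤s ()))
  flat (suc (suc _)) _           _ = refl

-- For s - 4 = i + k m the heights are m, taken k times, then i + 2 and 2. If i = m - 1, the height
-- i + 2 would exceed m, and the last two heights are m and 3.
middle-range : ∀ A μ {s} → 2 * (4 + μ) + 4 ≤ s → s < 2 * (4 + μ) + 2 * A + 2 → Realized (4 + A) (4 + μ) s
middle-range A μ low high with m≤n⇒∃[o]m+o≡n (≤-trans (m≤n+m 4 (2 * (4 + μ))) low)
... | x , refl with division x (3 + μ)
... | k , i , i≤ , refl = by (m≤n⇒m<n∨m≡n i≤)
  where
  m = 4 + μ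
  2≤k : 2 ≤ k
  2≤k = ≮⇒≥ λ { (s≤s k≤1) → <⇒≱ (+-monoʳ-< 4 (<-≤-trans (+-mono-<-≤ (s≤s i≤) (*-monoˡ-≤ m k≤1)) (≤-reflexive (+-comm m (1 * m)))))
                              (≤-trans (≤-reflexive (swap m)) low) }
    where
    swap : ∀ m → 4 + (1 * m + m) ≡ 2 * m + 4
    swap = solve-∀
  k≤A : k ≤ A
  k≤A = ≮⇒≥ λ A<k → absurd A (≤-<-trans (+-monoʳ-≤ 4 (≤-trans (*-monoˡ-≤ m A<k) (m≤n+m _ i))) high) (≤-<-trans low high)
    where
    absurd : ∀ A → 4 + suc A * m < 2 * m + 2 * A + 2 → 2 * m + 4 < 2 * m + 2 * A + 2 → ⊥
    absurd zero    _  lt = <⇒≱ lt (≤-trans (≤-reflexive (cong (_+ 2) (+-identityʳ (2 * m)))) (+-monoʳ-≤ (2 * m) (s≤s (s≤s z≤n))))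
    absurd (suc A) lt _  = <⇒≱ lt (≤-trans (m≤m+n _ (A * (2 + μ))) (≤-reflexive (shape A μ)))
      where
      shape : ∀ A μ → 2 * (4 + μ) + 2 * suc A + 2 + A * (2 + μ) ≡ 4 + suc (suc A) * (4 + μ)
      shape = solve-∀
  by : i < 3 + μ ⊎ i ≡ 3 + μ → Realized (4 + A) m (4 + (i + k * m))
  by (inj₁ i<) = subst (Realized (4 + A) m) (shape k i m)
    (low-realized k m (i + 2) 0 A m k≤A (m≤n+m 2 i) (≤-trans (≤-reflexive (+-comm i 2)) (s≤s i<)) ≤-refl z≤n
      (s≤s (s≤s (s≤s z≤n))) (inj₁ refl) (inj₂ 2≤k) (λ e → contradiction (subst (2 ≤_) e 2≤k) λ ()))
    where
    shape : ∀ k i m → k * m + (i + 2 + 2) ≡ 4 + (i + k * m)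
    shape = solve-∀
  by (inj₂ refl) = subst (Realized (4 + A) m) (shape k μ)
    (low-realized k m m 1 A m k≤A (s≤s (s≤s (s≤s z≤n))) ≤-refl ≤-refl ≤-refl (s≤s (s≤s (s≤s (s≤s z≤n)))) (inj₁ refl) (inj₂ 2≤k) (λ e → contradiction (subst (2 ≤_) e 2≤k) λ ()))
    where
    shape : ∀ k μ → k * (4 + μ) + (4 + μ + 3) ≡ 4 + (3 + μ + k * (4 + μ))
    shape = solve-∀

twice-or : ∀ s → ∃[ h ] (s ≡ h + h ⊎ s ≡ suc (h + h))
twice-or zero    = 0 , inj₁ refl
twice-or (suc s) with twice-or s
... | h , inj₁ refl = h , inj₂ refl
... | h , inj₂ refl = suc h , inj₁ (cong suc (sym (+-suc h h)))

-- Two columns of equal height and a third of height 2 or 3, according to the parity of s.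
two-column-range : ∀ A μ {s} → let m = 4 + μ in 8 ≤ s → s < 2 * m + 4 → Realized (5 + A) m s
two-column-range A μ {s} low high with twice-or (s ∸ 2) | m∸n+n≡m (≤-trans (s≤s (s≤s z≤n)) low)
... | h , inj₁ e | s≡ = subst (Realized (5 + A) (4 + μ)) (trans (shape h) s≡′)
  (low-realized 1 h h 0 (suc A) (4 + μ) (s≤s z≤n) (≤-trans (s≤s (s≤s z≤n)) 3≤h) ≤-refl h≤m z≤n (s≤s (s≤s (s≤s z≤n))) (inj₂ (≤-refl , refl)) (inj₁ refl) λ ())
  where
  shape : ∀ h → 1 * h + (h + 2) ≡ h + h + 2
  shape = solve-∀
  s≡′ : h + h + 2 ≡ s
  s≡′ = trans (cong (_+ 2) (sym e)) s≡
  3≤h : 3 ≤ h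
  3≤h = ≮⇒≥ λ h<3 → <⇒≱ (s≤s (+-monoˡ-≤ 2 (≤-trans (+-mono-≤ (≤-pred h<3) (≤-pred h<3)) (m≤n+m 4 1)))) (≤-trans low (≤-reflexive (sym s≡′)))
  h≤m : h ≤ 4 + μ
  h≤m = ≮⇒≥ λ m<h → <⇒≱ high (≤-trans (≤-reflexive (double μ)) (≤-trans (+-monoˡ-≤ 2 (+-mono-≤ m<h m<h)) (≤-reflexive s≡′)))
    where
    double : ∀ μ → 2 * (4 + μ) + 4 ≡ (5 + μ) + (5 + μ) + 2
    double = solve-∀
... | h , inj₂ e | s≡ = subst (Realized (5 + A) (4 + μ)) (trans (shape h) s≡′)
  (low-realized 1 h h 1 (suc A) (4 + μ) (s≤s z≤n) 3≤h ≤-refl h≤m ≤-refl (s≤s (s≤s (s≤s (s≤s z≤n)))) (inj₂ (≤-refl , refl)) (inj₁ refl) λ ())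
  where
  shape : ∀ h → 1 * h + (h + 3) ≡ suc (h + h) + 2
  shape = solve-∀
  s≡′ : suc (h + h) + 2 ≡ s
  s≡′ = trans (cong (_+ 2) (sym e)) s≡
  3≤h : 3 ≤ h
  3≤h = ≮⇒≥ λ h<3 → <⇒≱ (s≤s (+-monoˡ-≤ 3 (+-mono-≤ (≤-pred h<3) (≤-pred h<3))))
    (≤-trans low (≤-reflexive (trans (sym s≡′) (sym (+-suc (h + h) 2)))))
  h≤m : h ≤ 4 + μ
  h≤m = ≮⇒≥ λ m<h → <⇒≱ high (≤-trans (≤-reflexive (double μ)) (≤-trans (+-monoˡ-≤ 2 (+-mono-≤ m<h m<h))
    (≤-trans (n≤1+n _) (≤-reflexive s≡′))))
    where
    double : ∀ μ → 2 * (4 + μ) + 4 ≡ (5 + μ) + (5 + μ) + 2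
    double = solve-∀

large : ∀ A μ {s} → let m = 4 + μ in μ ≤ A → s ≤ (3 + A) * m → 8 ≤ s → Realized (4 + A) m s
large A μ {s} μ≤A high 8≤s with 2 * (4 + μ) + 2 * A + 2 ≤? s
... | yes low = staircase-range A μ low high
-- For n = m = 4 the staircases begin at 10, which leaves 8 and 9.
large zero zero {s} _ _ 8≤s | no ≰ with m≤n⇒m<n∨m≡n 8≤s
... | inj₂ refl = spectrum-8
... | inj₁ 9≤s with m≤n⇒m<n∨m≡n 9≤s
...   | inj₂ refl  = spectrum-9
...   | inj₁ 10≤s = contradiction 10≤s ≰
large (suc A) μ {s} _ _ 8≤s | no ≰ with 2 * (4 + μ) + 4 ≤? s
... | yes low = middle-range (suc A) μ low (≰⇒> ≰)
... | no ≰′   = two-column-range A μ 8≤s (≰⇒> ≰′)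

realize : ∀ A μ {s} → let m = 4 + μ in μ ≤ A → s ≤ (3 + A) * m → 1 ≤ s → s ≢ 2 → s ≢ 3 → s ≢ 5 → Realized (4 + A) m s
realize A μ {1} _ _ _ _ _ _ = AllCyclic.cyclic-spectrum (2 + A) (2 + μ)
realize A μ {2} _ _ _ ≢2 _ _ = contradiction refl ≢2
realize A μ {3} _ _ _ _ ≢3 _ = contradiction refl ≢3
realize A μ {4} _ _ _ _ _ _ =
  low-realized 0 2 2 0 A (4 + μ) z≤n ≤-refl ≤-refl (s≤s (s≤s z≤n)) z≤n (s≤s (s≤s (s≤s z≤n))) (inj₂ (z≤n , refl)) (inj₁ refl) (λ _ → refl)
realize A μ {5} _ _ _ _ _ ≢5 = contradiction refl ≢5
realize A μ {6} _ _ _ _ _ _ =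
  low-realized 0 3 3 1 A (4 + μ) z≤n ≤-refl ≤-refl (s≤s (s≤s (s≤s z≤n))) ≤-refl (s≤s (s≤s (s≤s (s≤s z≤n)))) (inj₂ (z≤n , refl)) (inj₁ refl) (λ _ → refl)
realize (suc A) μ {7} _ _ _ _ _ _ = TwoFaces.two-faces-spectrum A μ
realize zero zero {7} _ _ _ _ _ _ = spectrum-7
realize A μ {suc (suc (suc (suc (suc (suc (suc (suc s)))))))} μ≤A high _ _ _ _ = large A μ μ≤A high (m≤m+n 8 s)

-- The complement has at least 6 and fewer than m vertices. Three of them go to column 1 of the
-- corner and the remaining r = nm - s - 3 to column 0.
realize-near-full : ∀ A μ {s} → let n = 4 + A; m = 4 + μ in (3 + A) * m < s → s ≤ n * m ∸ 6 → Realized n m s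
realize-near-full A μ {s} low high =
  subst (Realized n m) (trans (cong (n * m ∸_) (m+[n∸m]≡n 3≤)) (m∸[m∸n]≡n s≤nm))
    (SmallCorner.corner-spectrum A (3 + μ) (n * m ∸ s ∸ 3) (∸-monoˡ-≤ 3 6≤) r<)
  where
  n = 4 + A
  m = 4 + μ
  s≤nm : s ≤ n * m
  s≤nm = ≤-trans high (m∸n≤m (n * m) 6)
  6≤ : 6 ≤ n * m ∸ s
  6≤ = ≤-trans (≤-reflexive (sym (m∸[m∸n]≡n {n * m} {6} (≤-trans (m≤n+m 6 10) (*-mono-≤ {4} {n} {4} {m} (m≤m+n 4 A) (m≤m+n 4 μ))))))
         (∸-monoʳ-≤ (n * m) high)
  3≤ : 3 ≤ n * m ∸ s
  3≤ = ≤-trans (s≤s (s≤s (s≤s z≤n))) 6≤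
  gap : n * m ∸ s < m
  gap = +-cancelʳ-< s _ _ (≤-<-trans (≤-reflexive (m∸n+n≡m s≤nm)) (+-monoʳ-< m low))
  r< : suc (n * m ∸ s ∸ 3) < 3 + μ
  r< = ≤-trans (≤-reflexive refl) (≤-trans (s≤s (s≤s (∸-monoˡ-≤ 3 (≤-pred gap)))) (m≤n⇒m≤1+n ≤-refl))

theorem23 : (n m : ℕ) → 4 ≤ m → m ≤ n →
    (m ≡ 4 → StrongConvexitySpectrum (P n □ P m) ≐ ([1, n * m ∸ 4 ] ∖ (｛ 2 ｝ ∪ ｛ 3 ｝ ∪ ｛ 5 ｝)))
    × (m ≡ 5 → StrongConvexitySpectrum (P n □ P m) ≐ ([1, n * m ∸ 5 ] ∖ (｛ 2 ｝ ∪ ｛ 3 ｝ ∪ ｛ 5 ｝)))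
    × (6 ≤ m → StrongConvexitySpectrum (P n □ P m) ≐ ([1, n * m ∸ 6 ] ∖ (｛ 2 ｝ ∪ ｛ 3 ｝ ∪ ｛ 5 ｝)))
theorem23 n@(suc (suc (suc (suc A)))) m@(suc (suc (suc (suc μ)))) 4≤m@(s≤s (s≤s (s≤s (s≤s _)))) m≤n@(s≤s (s≤s (s≤s (s≤s μ≤A)))) =
  -- For m = 4 and m = 5 the upper end nm - m computes to (n - 1) m, which the staircases reach. The
  -- corner construction enters only for m at least 6.
  (λ { refl → equal 4 (m≤m+n 4 2) ≤-refl (s≤s z≤n) inj₁ }) ,
  (λ { refl → equal 5 (m≤m+n 5 1) ≤-refl (s≤s z≤n) inj₁ }) ,
  (λ 6≤m → equal 6 ≤-refl 6≤m (s≤s z≤n) (λ s≤ → inj₂ s≤))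
  where
  equal : ∀ q → q ≤ 6 → q ≤ m → 1 ≤ q → (∀ {s} → s ≤ n * m ∸ q → s ≤ (3 + A) * m ⊎ s ≤ n * m ∸ 6) →
          StrongConvexitySpectrum (P n □ P m) ≐ ([1, n * m ∸ q ] ∖ (｛ 2 ｝ ∪ ｛ 3 ｝ ∪ ｛ 5 ｝))
  equal q q≤6 q≤m _ near = forth , back
    where
    forth : ∀ {s} → StrongConvexitySpectrum (P n □ P m) s → ([1, n * m ∸ q ] ∖ (｛ 2 ｝ ∪ ｛ 3 ｝ ∪ ｛ 5 ｝)) s
    forth {s} sp =
      let 1≤s , s+q≤ , ≢2 , ≢3 , ≢5 = spectrum-bounds q q≤6 q≤m (≤-trans q≤m m≤n)
            (≤-trans (s≤s q≤6) (≤-trans (m≤n+m 7 9) (*-mono-≤ {4} {n} {4} {m} (≤-trans 4≤m m≤n) 4≤m))) sp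
      in (1≤s , m+n≤o⇒m≤o∸n s s+q≤) , λ { (inj₁ e) → ≢2 (sym e) ; (inj₂ (inj₁ e)) → ≢3 (sym e) ; (inj₂ (inj₂ e)) → ≢5 (sym e) }
    back : ∀ {s} → ([1, n * m ∸ q ] ∖ (｛ 2 ｝ ∪ ｛ 3 ｝ ∪ ｛ 5 ｝)) s → StrongConvexitySpectrum (P n □ P m) s
    back {s} ((1≤s , s≤) , ∉) with s ≤? (3 + A) * m | near s≤
    ... | yes le | _       = realize A μ μ≤A le 1≤s (λ { refl → ∉ (inj₁ refl) }) (λ { refl → ∉ (inj₂ (inj₁ refl)) }) (λ { refl → ∉ (inj₂ (inj₂ refl)) })
    ... | no ≰   | inj₁ le = contradiction le ≰
    ... | no ≰   | inj₂ le = realize-near-full A μ (≰⇒> ≰) le
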